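{- Let $a>2$ be an integer and let $b,c,d$ be nonnegative integers with $b\leqslant c\leqslant d\leqslant a$. Then $$\{x(ax+b)+y(ay+c)+z(az+d):\ x,y,z\in\mathbb{Z}\}=\mathbb{N}=\{0,1,2,\ldots\}$$ holds if and only if $(a,b,c,d)$ is one of the five quadruples $$(3,0,1,2),\ (3,1,1,2),\ (3,1,2,2),\ (3,1,2,3),\ (4,1,2,3).$$ -}

module Defs where

open import Data.Nat as ℕ using (ℕ)
open import Data.Integer using (ℤ; +_; _+_; _*_; _≤_)
open import Data.Product using (Σ; ∃; _×_; _,_)
open import Relation.Binary.PropositionalEquality using (_≡_)

form : ℕ → ℕ → ℕ → ℕ → ℤ → ℤ → ℤ → ℤ
form a b c d x y z =
  x * ((+ a) * x + + b) + y * ((+ a) * y + + c) + z * ((+ a) * z + + d)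

RepresentsExactlyℕ : ℕ → ℕ → ℕ → ℕ → Set
RepresentsExactlyℕ a b c d =
  (∀ (x y z : ℤ) → + 0 ≤ form a b c d x y z)
  × (∀ (n : ℕ) → ∃ λ (x : ℤ) → ∃ λ (y : ℤ) → ∃ λ (z : ℤ) → form a b c d x y z ≡ + n)

data Listed : ℕ → ℕ → ℕ → ℕ → Set where
  q1 : Listed 3 0 1 2
  q2 : Listed 3 1 1 2
  q3 : Listed 3 1 2 2
  q4 : Listed 3 1 2 3
  q5 : Listed 4 1 2 3

{-# OPTIONS --safe #-}
module Submission where

open import Data.Nat as ℕ using (ℕ; zero; suc; s≤s; z≤n; _≡ᵇ_; _∸_)
import Data.Nat.Properties as ℕₚ
open import Data.Integer using (ℤ; +_; -[1+_]; 0ℤ; 1ℤ; -1ℤ; _+_; _*_; -_; _-_; _<_; _≤_; ∣_∣; +<+; +≤+; _<?_; _≟_; -<+)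
import Data.Integer.Properties as ℤₚ
open import Data.Integer.Tactic.RingSolver using (solve-∀)
open import Data.List using (List; []; _∷_; map; filter; foldr; _++_; cartesianProduct; upTo)
open import Data.List.Membership.Propositional using (_∈_; find; lose)
open import Data.List.Membership.Propositional.Properties using (∈-map⁺; ∈-map⁻; ∈-filter⁺; ∈-filter⁻; ∈-++⁺ˡ; ∈-++⁺ʳ; ∈-++⁻; ∈-cartesianProduct⁺; ∈-upTo⁺; ∈-upTo⁻)
open import Data.List.Membership.Propositional.Properties.WithK using (unique∧set⇒bag)
open import Data.List.Relation.Binary.BagAndSetEquality using (∼bag⇒↭)
open import Data.List.Relation.Binary.Permutation.Propositional using (_↭_; ↭⇒↭ₛ)
open import Data.List.Relation.Binary.Permutation.Setoid.Properties using (foldr-commMonoid)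
open import Data.List.Relation.Unary.All as All using (All; []; _∷_)
open import Data.List.Relation.Unary.AllPairs using ([]; _∷_)
open import Data.List.Relation.Unary.Any using (here; there)
open import Data.List.Relation.Unary.Unique.Propositional using (Unique)
import Data.List.Relation.Unary.Unique.Propositional.Properties as Uniqueₚ
open import Data.Product using (∃; _×_; _,_; proj₁; proj₂)
open import Data.Sum as Sum using (_⊎_; inj₁; inj₂)
open import Data.Empty using (⊥; ⊥-elim)
open import Function using (_∘_; _⇔_; mk⇔)
open import Relation.Nullary using (¬_; Dec; yes; no)
open import Relation.Nullary.Decidable using (_×-dec_; ¬?)
open import Relation.Unary using (Decidable)
open import Relation.Binary.Definitions using (tri<; tri≈; tri>)
open import Relation.Binary.PropositionalEquality using (_≡_; _≢_; refl; sym; trans; cong; cong₂; subst; setoid; module ≡-Reasoning)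
open import Algebra.Bundles using (CommutativeMonoid)
open import Data.Nat.Induction using (<-rec)
open import Defs
open import Data.Bool using (Bool; true; false; T; _∧_; _∨_; not)
open import Data.Fin as Fin using (Fin; toℕ)
import Data.Fin.Properties as Finₚ
open import Data.Bool.ListAction using (any)
open import Data.List.Relation.Unary.Any.Properties using (any⁺; any⁻)
open import Data.Maybe using (Maybe; just; nothing; is-just)
open import Data.Unit using (tt)

-- Completing squares, the five forms are universal as soon as every 12n + 5, 12n + 6, 12n + 9, 12n + 14 and 16n + 14 is a
-- sum of three squares in prescribed residue classes modulo 6 or 8. The classes modulo 3 are reached from an arbitrary
-- representation by rational rotations of denominator 3, so what matters is that every number congruent to 1 or 2 modulo 4
-- is a sum of three squares.
--
-- That is proved by counting. Liouville's elementary identity for the solutions of jd + 2sh = n has two kinds of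
-- consequences. With the character modulo 4 and Jacobi's formula for two squares it counts the representations of an odd N
-- by x² + y² + 2z² + 2w²: there are 4σ(N). With suitable thetas it gives Kronecker's class number relation in the form
-- Σₖ c(N - 2k²) = σ(N), where c(n) > 0 is the weighted number of solutions of λμ + μν + νλ = 2n in fixed parity classes.
-- Comparing the two recursively, the number of representations of n by x² + y² + 2z² is 4c(n), hence positive; likewise
-- for o² + 4w² + 4z² = 4q + 1. Jacobi's formula r₂(n) = 4 Σ χ(d) is obtained in the same way: for n = 4q + 1 both sides
-- satisfy one recursion over the numbers n - i², on one side because exactly one of three squares summing to n is odd.
--
-- Conversely, every n < a must be a sum of a subset of {a - b, a - c, a - d}, so a ≤ 8, and the remaining quadruples each
-- miss a small number.

-- Neither the four-variable count nor the class number relation speaks of a single value of a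
-- ternary form: each evaluates only a sum over `w` of values at `N - 2w²`, or over `k` of values at
-- `2N - k²`. Both sums run over the same arguments, and the term of largest argument is determined
-- by the others, so the two functions agree term by term. Positivity is then read off on the class
-- number side, where the factorisation `1 * n` always contributes; no local-global principle and no
-- primes in progressions enter. The obstacle modulo 3 is that having one coordinate prime to 3 is
-- not enough: for some forms it must be a particular one. Since `2(a² + b²) = (a + b)² + (a - b)²`,
-- a rotation of the binary form `x² + 2y²` acts on the chosen coordinate and on `(a + b)/2`, and
-- leaves `a - b` alone. It cannot move the zero vector. This matters only for (3,1,2,3), when
-- `12n + 14` is twice a square, and there a representation with a nonzero even coordinate has to be
-- built by reflections.

1+4x≡1+2[2x] : ∀ x → 1ℤ + + 4 * x ≡ 1ℤ + + 2 * (+ 2 * x)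
1+4x≡1+2[2x] = solve-∀

[x-y]+y≡x : ∀ x y → x - y + y ≡ x
[x-y]+y≡x = solve-∀

[x+y]-y≡x : ∀ x y → x + y - y ≡ x
[x+y]-y≡x = solve-∀

[2x]²≡4x² : ∀ x → + 2 * x * (+ 2 * x) ≡ + 4 * (x * x)
[2x]²≡4x² = solve-∀

[3x]²≡3[3x²] : ∀ x → + 3 * x * (+ 3 * x) ≡ + 3 * (+ 3 * (x * x))
[3x]²≡3[3x²] = solve-∀

[2y-x]+x≡2y : ∀ x y → + 2 * y - x + x ≡ + 2 * y
[2y-x]+x≡2y = solve-∀

[x-2y]+2y≡x : ∀ x y → x - + 2 * y + + 2 * y ≡ x
[x-2y]+2y≡x = solve-∀

xy+2z≡yx+2z+0 : ∀ x y z → x * y + + 2 * z ≡ y * x + + 2 * z + + 2 * 0ℤ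
xy+2z≡yx+2z+0 = solve-∀

x≡x+2*0 : ∀ x → x ≡ x + + 2 * 0ℤ
x≡x+2*0 = solve-∀

x+2y≡-[x-2[y+x]] : ∀ x y → x + + 2 * y ≡ - (x - + 2 * (y + x))
x+2y≡-[x-2[y+x]] = solve-∀

x≡[x+2y]-2y : ∀ x y → x ≡ x + + 2 * y - + 2 * y
x≡[x+2y]-2y = solve-∀

2[3x]≡3[2x] : ∀ x → + 2 * (+ 3 * x) ≡ + 3 * (+ 2 * x)
2[3x]≡3[2x] = solve-∀

even-first : ∀ x y z → + 2 * (x * (+ 2 * x) + + 2 * (y * y + z * z)) ≡ + 2 * x * (+ 2 * x) + + 4 * (y * y + z * z)
even-first = solve-∀

even-last-two : ∀ x y z → x * x + + 2 * y * (+ 2 * y) + + 2 * z * (+ 2 * z) ≡ x * x + + 4 * (y * y + z * z)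
even-last-two = solve-∀

x≡[x+y]-y : ∀ x y → x ≡ x + y - y
x≡[x+y]-y = solve-∀

odd*odd : ∀ x y → (1ℤ + + 2 * x) * (1ℤ + + 2 * y) ≡ 1ℤ + + 2 * (x + y + + 2 * (x * y))
odd*odd = solve-∀

3+4x-1≡2[1+2x] : ∀ x → 1ℤ + + 2 * (1ℤ + + 2 * x) - 1ℤ ≡ + 2 * (1ℤ + + 2 * x)
3+4x-1≡2[1+2x] = solve-∀

odd+odd : ∀ x y → 1ℤ + + 2 * x + (1ℤ + + 2 * y) ≡ + 2 * (1ℤ + x + y)
odd+odd = solve-∀

8+16x≡8[1+2x] : ∀ x → + 14 + + 16 * x - + 6 ≡ + 8 * (1ℤ + + 2 * x)
8+16x≡8[1+2x] = solve-∀

pad-first : ∀ x → x * x ≡ 0ℤ * 0ℤ + x * x + + 2 * (0ℤ * 0ℤ)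
pad-first = solve-∀

pad-second : ∀ x → x * x ≡ x * x + 0ℤ * 0ℤ + + 2 * (0ℤ * 0ℤ)
pad-second = solve-∀

2y-x≡x+2[y-x] : ∀ x y → + 2 * y - x ≡ x + + 2 * (y - x)
2y-x≡x+2[y-x] = solve-∀

x+2y≡2[y+x]-x : ∀ x y → x + + 2 * y ≡ + 2 * (y + x) - x
x+2y≡2[y+x]-x = solve-∀

neg-odd : ∀ x → - (1ℤ + + 2 * x) ≡ 1ℤ + + 2 * (-1ℤ - x)
neg-odd = solve-∀

[x+2y]+x≡2[y+x] : ∀ x y → x + + 2 * y + x ≡ + 2 * (y + x)
[x+2y]+x≡2[y+x] = solve-∀

[x+y]-[x-y]≡2y : ∀ x y → x + y - (x - y) ≡ + 2 * y
[x+y]-[x-y]≡2y = solve-∀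

x-[x-2y]≡2y : ∀ x y → x - (x - + 2 * y) ≡ + 2 * y
x-[x-2y]≡2y = solve-∀

2[xy]≡x[2y] : ∀ x y → + 2 * (x * y) ≡ x * (+ 2 * y)
2[xy]≡x[2y] = solve-∀

[x+y]+y≡x+2y : ∀ x y → x + y + y ≡ x + + 2 * y
[x+y]+y≡x+2y = solve-∀

[x+2y]-x≡2y : ∀ x y → x + + 2 * y - x ≡ + 2 * y
[x+2y]-x≡2y = solve-∀

-[x*-y]≡xy : ∀ x y → - (x * - y) ≡ x * y
-[x*-y]≡xy = solve-∀

[x+y]+-[x-y]≡2y : ∀ x y → x + y + - (x - y) ≡ + 2 * y
[x+y]+-[x-y]≡2y = solve-∀

[x+y]+[x-y]≡2x : ∀ x y → x + y + (x - y) ≡ + 2 * x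
[x+y]+[x-y]≡2x = solve-∀

x+[x+0]≡2x : ∀ x → x + (x + 0ℤ) ≡ + 2 * x
x+[x+0]≡2x = solve-∀

x+[y-x]≡y : ∀ x y → x + (y - x) ≡ y
x+[y-x]≡y = solve-∀

x+[2y-x]≡2y : ∀ x y → x + (+ 2 * y - x) ≡ + 2 * y
x+[2y-x]≡2y = solve-∀

-[2x]≡2[-x] : ∀ x → - (+ 2 * x) ≡ + 2 * - x
-[2x]≡2[-x] = solve-∀

x²+[y+x²]≡y+2x² : ∀ x y → x * x + (y + x * x) ≡ y + + 2 * (x * x)
x²+[y+x²]≡y+2x² = solve-∀

x²≡2y-[2y-x²] : ∀ x y → x * x ≡ + 2 * y - (+ 2 * y - x * x)
x²≡2y-[2y-x²] = solve-∀

[1+3x]-[1+3y]≡3[x-y] : ∀ x y → 1ℤ + + 3 * x + - (1ℤ + + 3 * y) ≡ + 3 * (x - y)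
[1+3x]-[1+3y]≡3[x-y] = solve-∀

-- Finite sums

+-congʳ : ∀ x {y z} → y ≡ z → x + y ≡ x + z
+-congʳ x = cong (λ t → x + t)

-- Finite sets are predicates on tuples rather than types, so that a set can be cut by the sign of a
-- linear form and its pieces compared with pieces of other sets of tuples.
record Enum {A : Set} (P : A → Set) : Set where
  field
    list     : List A
    unique   : Unique list
    sound    : ∀ {a} → a ∈ list → P a
    complete : ∀ {a} → P a → a ∈ list

open Enum

sumOver : {A : Set} → List A → (A → ℤ) → ℤ
sumOver xs w = foldr _+_ 0ℤ (map w xs)

∑ : {A : Set} {P : A → Set} → Enum P → (A → ℤ) → ℤ
∑ E w = sumOver (list E) w

module _ {A : Set} where

  sumOver-cong : (xs : List A) {w v : A → ℤ} → (∀ {a} → a ∈ xs → w a ≡ v a) → sumOver xs w ≡ sumOver xs v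
  sumOver-cong []       eq = refl
  sumOver-cong (x ∷ xs) eq = cong₂ _+_ (eq (here refl)) (sumOver-cong xs (eq ∘ there))

  sumOver-+ : (xs : List A) (w v : A → ℤ) → sumOver xs (λ a → w a + v a) ≡ sumOver xs w + sumOver xs v
  sumOver-+ []       w v = refl
  sumOver-+ (x ∷ xs) w v = trans (+-congʳ (w x + v x) (sumOver-+ xs w v)) (interchange (w x) (v x) _ _)
    where
    interchange : ∀ a b c d → a + b + (c + d) ≡ (a + c) + (b + d)
    interchange = solve-∀

  sumOver-* : (k : ℤ) (xs : List A) (w : A → ℤ) → sumOver xs (λ a → k * w a) ≡ k * sumOver xs w
  sumOver-* k []       w = sym (ℤₚ.*-zeroʳ k)
  sumOver-* k (x ∷ xs) w = trans (+-congʳ (k * w x) (sumOver-* k xs w)) (sym (ℤₚ.*-distribˡ-+ k (w x) _))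

  sumOver-++ : (xs ys : List A) (w : A → ℤ) → sumOver (xs ++ ys) w ≡ sumOver xs w + sumOver ys w
  sumOver-++ []       ys w = sym (ℤₚ.+-identityˡ _)
  sumOver-++ (x ∷ xs) ys w = trans (+-congʳ (w x) (sumOver-++ xs ys w)) (sym (ℤₚ.+-assoc (w x) _ _))

  sumOver-map : {B : Set} (f : B → A) (xs : List B) (w : A → ℤ) → sumOver (map f xs) w ≡ sumOver xs (w ∘ f)
  sumOver-map f []       w = refl
  sumOver-map f (x ∷ xs) w = +-congʳ (w (f x)) (sumOver-map f xs w)

  sumOver-↭ : {xs ys : List ℤ} → xs ↭ ys → foldr _+_ 0ℤ xs ≡ foldr _+_ 0ℤ ys
  sumOver-↭ p = foldr-commMonoid (setoid ℤ) (CommutativeMonoid.isCommutativeMonoid ℤₚ.+-0-commutativeMonoid) (↭⇒↭ₛ p)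

  unique-map : {B : Set} {f : A → B} (xs : List A) → (∀ {a b} → a ∈ xs → b ∈ xs → f a ≡ f b → a ≡ b) → Unique xs → Unique (map f xs)
  unique-map []       inj []        = []
  unique-map {f = f} (x ∷ xs) inj (px ∷ u) = fresh xs there px ∷ unique-map xs (λ i j → inj (there i) (there j)) u
    where
    fresh : ∀ ys → (∀ {a} → a ∈ ys → a ∈ x ∷ xs) → All (x ≢_) ys → All (f x ≢_) (map f ys)
    fresh []       sub []       = []
    fresh (y ∷ ys) sub (p ∷ ps) = (λ e → p (inj (here refl) (sub (here refl)) e)) ∷ fresh ys (sub ∘ there) ps

-- The inverse laws are demanded only inside `P` and `Q`, so the maps may be plain formulas, with
-- halvings that are exact only on solutions.
record _≅_ {A B : Set} (P : A → Set) (Q : B → Set) : Set where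
  field
    to      : A → B
    from    : B → A
    to-∈    : ∀ {a} → P a → Q (to a)
    from-∈  : ∀ {b} → Q b → P (from b)
    from-to : ∀ {a} → P a → from (to a) ≡ a
    to-from : ∀ {b} → Q b → to (from b) ≡ b

open _≅_

module _ {A : Set} {P : A → Set} where

  ∑-cong : (E : Enum P) {w v : A → ℤ} → (∀ {a} → P a → w a ≡ v a) → ∑ E w ≡ ∑ E v
  ∑-cong E eq = sumOver-cong (list E) (eq ∘ sound E)

  ∑-+ : (E : Enum P) (w v : A → ℤ) → ∑ E (λ a → w a + v a) ≡ ∑ E w + ∑ E v
  ∑-+ E = sumOver-+ (list E)

  ∑-* : (k : ℤ) (E : Enum P) (w : A → ℤ) → ∑ E (λ a → k * w a) ≡ k * ∑ E w
  ∑-* k E = sumOver-* k (list E)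

  ∑-zero : (E : Enum P) {w : A → ℤ} → (∀ {a} → P a → w a ≡ 0ℤ) → ∑ E w ≡ 0ℤ
  ∑-zero E {w} eq = trans (∑-cong E eq) (∑-* 0ℤ E (λ _ → 0ℤ))

  -- The image of one list and the other list are duplicate-free with the same members, hence
  -- permutations of each other, and addition is commutative. All double counting below goes through
  -- this lemma.
  ∑-bij : {B : Set} {Q : B → Set} (i : P ≅ Q) (E : Enum P) (F : Enum Q) {w : A → ℤ} {v : B → ℤ} →
          (∀ {a} → P a → w a ≡ v (to i a)) → ∑ E w ≡ ∑ F v
  ∑-bij {Q = Q} i E F {w} {v} eq = begin
    ∑ E w                              ≡⟨ ∑-cong E eq ⟩
    ∑ E (v ∘ to i)                     ≡⟨ sumOver-map (to i) (list E) v ⟨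
    sumOver (map (to i) (list E)) v    ≡⟨ sumOver-↭ {A = A} (map⁺ v image) ⟩
    ∑ F v                              ∎
    where
    open ≡-Reasoning
    open import Data.List.Relation.Binary.Permutation.Propositional.Properties using (map⁺)
    injective : ∀ {a b} → a ∈ list E → b ∈ list E → to i a ≡ to i b → a ≡ b
    injective p q e = trans (sym (from-to i (sound E p))) (trans (cong (from i) e) (from-to i (sound E q)))
    same : ∀ {x} → x ∈ map (to i) (list E) ⇔ x ∈ list F
    same = mk⇔ there′ back
      where
      there′ : ∀ {x} → x ∈ map (to i) (list E) → x ∈ list F
      there′ p with ∈-map⁻ (to i) p
      ... | a , a∈ , refl = complete F (to-∈ i (sound E a∈))
      back : ∀ {x} → x ∈ list F → x ∈ map (to i) (list E)
      back {x} p = subst (_∈ map (to i) (list E)) (to-from i (sound F p)) (∈-map⁺ (to i) (complete E (from-∈ i (sound F p))))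
    image : map (to i) (list E) ↭ list F
    image = ∼bag⇒↭ (unique∧set⇒bag (unique-map (list E) injective (unique E)) (unique F) same)

  restrict : {R : A → Set} → Enum P → Decidable R → Enum (λ a → P a × R a)
  restrict E R? = record
    { list     = filter R? (list E)
    ; unique   = Uniqueₚ.filter⁺ R? (unique E)
    ; sound    = λ a∈ → let (b , r) = ∈-filter⁻ R? {xs = list E} a∈ in sound E b , r
    ; complete = λ { (p , r) → ∈-filter⁺ R? (complete E p) r }
    }

  ∑-split : {R : A → Set} (E : Enum P) (R? : Decidable R) (w : A → ℤ) →
            ∑ E w ≡ ∑ (restrict E R?) w + ∑ (restrict E (¬? ∘ R?)) w
  ∑-split {R} E R? w = go (list E)
    where
    swap : ∀ x y z → x + (y + z) ≡ y + (x + z)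
    swap = solve-∀
    go : ∀ xs → sumOver xs w ≡ sumOver (filter R? xs) w + sumOver (filter (¬? ∘ R?) xs) w
    go [] = refl
    go (x ∷ xs) with R? x
    ... | yes _ = trans (+-congʳ (w x) (go xs)) (sym (ℤₚ.+-assoc (w x) _ _))
    ... | no  _ = trans (+-congʳ (w x) (go xs)) (swap (w x) (sumOver (filter R? xs) w) (sumOver (filter (¬? ∘ R?) xs) w))

  id≅ : {Q : A → Set} → (∀ {a} → P a → Q a) → (∀ {a} → Q a → P a) → P ≅ Q
  id≅ f g = record { to = λ a → a ; from = λ a → a ; to-∈ = f ; from-∈ = g ; from-to = λ _ → refl ; to-from = λ _ → refl }

  ∑-single : (E : Enum P) {w : A → ℤ} (a₀ : A) → P a₀ → (∀ {a} → P a → a ≢ a₀ → w a ≡ 0ℤ) → ∑ E w ≡ w a₀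
  ∑-single E {w} a₀ p z = go (list E) (unique E) (complete E p) (λ a∈ → z (sound E a∈))
    where
    zero-off : ∀ xs → (∀ {a} → a ∈ xs → w a ≡ 0ℤ) → sumOver xs w ≡ 0ℤ
    zero-off []       h = refl
    zero-off (x ∷ xs) h = cong₂ _+_ (h (here refl)) (zero-off xs (h ∘ there))
    go : ∀ xs → Unique xs → a₀ ∈ xs → (∀ {a} → a ∈ xs → a ≢ a₀ → w a ≡ 0ℤ) → sumOver xs w ≡ w a₀
    go (x ∷ xs) (f ∷ u) (here refl) h =
      trans (+-congʳ (w x) (zero-off xs (λ a∈ → h (there a∈) (λ e → All.lookup f a∈ (sym e))))) (ℤₚ.+-identityʳ (w x))
    go (x ∷ xs) (f ∷ u) (there m) h =
      trans (cong₂ _+_ (h (here refl) (All.lookup f m)) (go xs u m (h ∘ there))) (ℤₚ.+-identityˡ _)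

  ∑-nonneg : (E : Enum P) {w : A → ℤ} → (∀ {a} → P a → 0ℤ ≤ w a) → 0ℤ ≤ ∑ E w
  ∑-nonneg E {w} h = go (list E) (h ∘ sound E)
    where
    go : ∀ xs → (∀ {a} → a ∈ xs → 0ℤ ≤ w a) → 0ℤ ≤ sumOver xs w
    go []       h = ℤₚ.≤-refl
    go (x ∷ xs) h = ℤₚ.+-mono-≤ (h (here refl)) (go xs (h ∘ there))

count : {A : Set} {P : A → Set} → Enum P → ℤ
count E = ∑ E (λ _ → 1ℤ)

count>0 : {A : Set} {P : A → Set} (E : Enum P) {a : A} → P a → 0ℤ < count E
count>0 E p with list E | complete E p
... | x ∷ xs | _ = ℤₚ.+-mono-<-≤ {0ℤ} {1ℤ} {0ℤ} (+<+ (ℕ.s≤s ℕ.z≤n)) (go xs)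
  where
  go : ∀ ys → 0ℤ ≤ sumOver ys (λ _ → 1ℤ)
  go []       = ℤₚ.≤-refl
  go (y ∷ ys) = ℤₚ.+-mono-≤ {0ℤ} {1ℤ} {0ℤ} (+≤+ ℕ.z≤n) (go ys)

count>0⇒∃ : {A : Set} {P : A → Set} (E : Enum P) → 0ℤ < count E → ∃ P
count>0⇒∃ E h with list E | sound E
count>0⇒∃ E (+<+ ()) | [] | _
... | x ∷ xs | s = x , s (here refl)

module _ {A B : Set} {Q : A → B → Set} (F : ∀ a → Enum (Q a)) where

  fibre : A → List (A × B)
  fibre a = map (a ,_) (list (F a))

  fibres : List A → List (A × B)
  fibres []       = []
  fibres (a ∷ as) = fibre a ++ fibres as

  sigma : {P : A → Set} → Enum P → Enum (λ (p : A × B) → P (proj₁ p) × Q (proj₁ p) (proj₂ p))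
  sigma E = record
    { list     = fibres (list E)
    ; unique   = uniq (list E) (unique E)
    ; sound    = λ m → let (x , y) = snd (list E) m in sound E x , sound (F _) y
    ; complete = λ { (p , q) → cmpl (list E) (complete E p) (complete (F _) q) }
    }
    where
    snd : ∀ as {p} → p ∈ fibres as → proj₁ p ∈ as × proj₂ p ∈ list (F (proj₁ p))
    snd (a ∷ as) m with ∈-++⁻ (fibre a) m
    ... | inj₂ m′ = let (x , y) = snd as m′ in there x , y
    ... | inj₁ m′ with ∈-map⁻ (a ,_) m′
    ...   | b , b∈ , refl = here refl , b∈
    cmpl : ∀ as {a b} → a ∈ as → b ∈ list (F a) → (a , b) ∈ fibres as
    cmpl (a ∷ as) (here refl) q = ∈-++⁺ˡ (∈-map⁺ (a ,_) q)
    cmpl (a ∷ as) (there m)   q = ∈-++⁺ʳ (fibre a) (cmpl as m q)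
    uniq : ∀ as → Unique as → Unique (fibres as)
    uniq []       []      = []
    uniq (a ∷ as) (f ∷ u) = Uniqueₚ.++⁺ (Uniqueₚ.map⁺ (cong proj₂) (unique (F a))) (uniq as u) disjoint
      where
      disjoint : ∀ {p} → ¬ (p ∈ fibre a × p ∈ fibres as)
      disjoint (m , m′) with ∈-map⁻ (a ,_) m
      ... | b , _ , refl = All.lookup f (proj₁ (snd as m′)) refl

  ∑-sigma : {P : A → Set} (E : Enum P) (w : A × B → ℤ) → ∑ (sigma E) w ≡ ∑ E (λ a → ∑ (F a) (λ b → w (a , b)))
  ∑-sigma E w = go (list E)
    where
    go : ∀ as → sumOver (fibres as) w ≡ sumOver as (λ a → ∑ (F a) (λ b → w (a , b)))
    go []       = refl
    go (a ∷ as) = trans (sumOver-++ (fibre a) (fibres as) w) (cong₂ _+_ (sumOver-map (a ,_) (list (F a)) w) (go as))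

-- Enumerating bounded decidable sets of integer tuples

Pos : ℤ → Set
Pos x = 0ℤ < x

Pos? : Decidable Pos
Pos? x = 0ℤ <? x

ints : ℕ → List ℤ
ints n = map +_ (upTo (suc n)) ++ map -[1+_] (upTo n)

ints-unique : ∀ n → Unique (ints n)
ints-unique n = Uniqueₚ.++⁺ (Uniqueₚ.map⁺ ℤₚ.+-injective (Uniqueₚ.upTo⁺ (suc n))) (Uniqueₚ.map⁺ ℤₚ.-[1+-injective (Uniqueₚ.upTo⁺ n)) disjoint
  where
  disjoint : ∀ {x} → ¬ (x ∈ map +_ (upTo (suc n)) × x ∈ map -[1+_] (upTo n))
  disjoint (p , q) with ∈-map⁻ +_ p | ∈-map⁻ -[1+_] q
  ... | _ , _ , refl | _ , _ , ()

∈-ints : ∀ n {x} → ∣ x ∣ ℕ.≤ n → x ∈ ints n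
∈-ints n {+ m}      h = ∈-++⁺ˡ (∈-map⁺ +_ (∈-upTo⁺ (ℕ.s≤s h)))
∈-ints n { -[1+ m ]} h = ∈-++⁺ʳ (map +_ (upTo (suc n))) (∈-map⁺ -[1+_] (∈-upTo⁺ h))

enumFrom : {A : Set} {P : A → Set} (xs : List A) → Unique xs → Decidable P → (∀ {a} → P a → a ∈ xs) → Enum P
enumFrom xs u P? c = record
  { list     = filter P? xs
  ; unique   = Uniqueₚ.filter⁺ P? u
  ; sound    = λ a∈ → proj₂ (∈-filter⁻ P? {xs = xs} a∈)
  ; complete = λ p → ∈-filter⁺ P? (c p) p
  }

ℤ² ℤ³ ℤ⁴ : Set
ℤ² = ℤ × ℤ
ℤ³ = ℤ × ℤ × ℤ
ℤ⁴ = ℤ × ℤ × ℤ × ℤ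

enum¹ : {P : ℤ → Set} (n : ℕ) → Decidable P → (∀ {x} → P x → ∣ x ∣ ℕ.≤ n) → Enum P
enum¹ n P? b = enumFrom (ints n) (ints-unique n) P? (λ p → ∈-ints n (b p))

enum² : {P : ℤ² → Set} (n : ℕ) → Decidable P → (∀ {x y} → P (x , y) → ∣ x ∣ ℕ.≤ n × ∣ y ∣ ℕ.≤ n) → Enum P
enum² n P? b = enumFrom (cartesianProduct I I) (Uniqueₚ.cartesianProduct⁺ u u) P?
  λ p → let (bx , by) = b p in ∈-cartesianProduct⁺ (∈-ints n bx) (∈-ints n by)
  where I = ints n ; u = ints-unique n

enum³ : {P : ℤ³ → Set} (n : ℕ) → Decidable P → (∀ {x y z} → P (x , y , z) → ∣ x ∣ ℕ.≤ n × ∣ y ∣ ℕ.≤ n × ∣ z ∣ ℕ.≤ n) → Enum P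
enum³ n P? b = enumFrom (cartesianProduct I (cartesianProduct I I)) (Uniqueₚ.cartesianProduct⁺ u (Uniqueₚ.cartesianProduct⁺ u u)) P?
  λ p → let (bx , by , bz) = b p in ∈-cartesianProduct⁺ (∈-ints n bx) (∈-cartesianProduct⁺ (∈-ints n by) (∈-ints n bz))
  where I = ints n ; u = ints-unique n

enum⁴ : {P : ℤ⁴ → Set} (n : ℕ) → Decidable P →
        (∀ {x y z t} → P (x , y , z , t) → ∣ x ∣ ℕ.≤ n × ∣ y ∣ ℕ.≤ n × ∣ z ∣ ℕ.≤ n × ∣ t ∣ ℕ.≤ n) → Enum P
enum⁴ n P? b = enumFrom (cartesianProduct I (cartesianProduct I (cartesianProduct I I)))
  (Uniqueₚ.cartesianProduct⁺ u (Uniqueₚ.cartesianProduct⁺ u (Uniqueₚ.cartesianProduct⁺ u u))) P?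
  λ p → let (bx , by , bz , bt) = b p in
    ∈-cartesianProduct⁺ (∈-ints n bx) (∈-cartesianProduct⁺ (∈-ints n by) (∈-cartesianProduct⁺ (∈-ints n bz) (∈-ints n bt)))
  where I = ints n ; u = ints-unique n

module _ {A : Set} {P : A → Set} where

  posPart negPart zeroPart : (E : Enum P) (l : A → ℤ) → Enum _
  posPart  E l = restrict {R = λ a → Pos (l a)} E (λ a → Pos? (l a))
  negPart  E l = restrict {R = λ a → Pos (- l a)} E (λ a → Pos? (- l a))
  zeroPart E l = restrict {R = λ a → l a ≡ 0ℤ} E (λ a → l a ≟ 0ℤ)

  -- Every dissection below cuts a solution set by the sign of a linear form. The zero part is
  -- either excluded by parity or is a boundary term to be evaluated.
  ∑-sign : (E : Enum P) (l : A → ℤ) (w : A → ℤ) → ∑ E w ≡ ∑ (posPart E l) w + (∑ (negPart E l) w + ∑ (zeroPart E l) w)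
  ∑-sign E l w = trans (∑-split E (λ a → Pos? (l a)) w)
    (+-congʳ (∑ (posPart E l) w)
      (trans (∑-split E′ (λ a → Pos? (- l a)) w)
        (cong₂ _+_
          (∑-bij (id≅ (λ { ((p , _) , n) → p , n }) (λ { (p , n) → (p , λ q → ℤₚ.<-asym q (neg q n)) , n })) (restrict E′ (λ a → Pos? (- l a))) (negPart E l) (λ _ → refl))
          (∑-bij (id≅ (λ { ((p , np) , nn) → p , zero? np nn }) (λ { (p , e) → (p , λ q → ℤₚ.<-irrefl (sym e) q) , λ q → ℤₚ.<-irrefl (cong -_ (sym e)) q })) (restrict E′ (λ a → ¬? (Pos? (- l a)))) (zeroPart E l) (λ _ → refl)))))
    where
    E′ = restrict E (λ a → ¬? (Pos? (l a)))
    neg : ∀ {x} → 0ℤ < x → 0ℤ < - x → x < 0ℤ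
    neg q n = subst (_< 0ℤ) (ℤₚ.neg-involutive _) (ℤₚ.neg-mono-< n)
    zero? : ∀ {x} → ¬ (0ℤ < x) → ¬ (0ℤ < - x) → x ≡ 0ℤ
    zero? {x} np nn with ℤₚ.<-cmp 0ℤ x
    ... | tri< a _ _ = ⊥-elim (np a)
    ... | tri≈ _ e _ = sym e
    ... | tri> _ _ c = ⊥-elim (nn (ℤₚ.neg-mono-< c))

  ∑-sign≢0 : (E : Enum P) (l : A → ℤ) (w : A → ℤ) → (∀ {a} → P a → l a ≢ 0ℤ) → ∑ E w ≡ ∑ (posPart E l) w + ∑ (negPart E l) w
  ∑-sign≢0 E l w ne = trans (∑-sign E l w) (+-congʳ (∑ (posPart E l) w)
    (trans (+-congʳ (∑ (negPart E l) w) (∑-zero (zeroPart E l) (λ (p , e) → ⊥-elim (ne p e)))) (ℤₚ.+-identityʳ _)))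

-- Positivity and bounds

pos≡ : ∀ {x y} → Pos x → x ≡ y → Pos y
pos≡ p e = subst Pos e p

pos-+ : ∀ {x y} → Pos x → Pos y → Pos (x + y)
pos-+ = ℤₚ.+-mono-<

pos-* : ∀ {x y} → Pos x → Pos y → Pos (x * y)
pos-* (+<+ {n = suc m} _) (+<+ {n = suc n} _) = +<+ (ℕ.s≤s ℕ.z≤n)

pos-double : ∀ {x} → Pos x → Pos (+ 2 * x)
pos-double {x} = pos-* {+ 2} {x} (+<+ (ℕ.s≤s ℕ.z≤n))

pos-half : ∀ {x} → Pos (+ 2 * x) → Pos x
pos-half {+ suc n} _ = +<+ (ℕ.s≤s ℕ.z≤n)
pos-half {+ zero}  p = p

odd-pos : ∀ {s} → Pos s → Pos (+ 2 * s - 1ℤ)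
odd-pos {+ suc s} (+<+ _) = subst (λ k → Pos (+ k)) (sym (ℕₚ.+-suc s (s ℕ.+ 0))) (+<+ (ℕ.s≤s ℕ.z≤n))

between : ∀ {d} → Pos d → Pos (- (d - + 2)) → d ≡ 1ℤ
between (+<+ {n = suc zero} _) _ = refl
between (+<+ {n = suc (suc k)} _) p = ⊥-elim (absurd k p)
  where
  absurd : ∀ k → ¬ Pos (- (+ suc (suc k) - + 2))
  absurd zero    (+<+ ())
  absurd (suc k) ()

pos⇒nonneg : ∀ {x} → Pos x → 0ℤ ≤ x
pos⇒nonneg = ℤₚ.<⇒≤

nonneg-+ : ∀ {x y} → 0ℤ ≤ x → 0ℤ ≤ y → 0ℤ ≤ x + y
nonneg-+ = ℤₚ.+-mono-≤

nonneg-* : ∀ {x y} → 0ℤ ≤ x → 0ℤ ≤ y → 0ℤ ≤ x * y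
nonneg-* {+ m} {+ n} _ _ = subst (0ℤ ≤_) (ℤₚ.pos-* m n) (+≤+ ℕ.z≤n)

nonneg-sq : ∀ x → 0ℤ ≤ x * x
nonneg-sq (+ n)    = nonneg-* {+ n} {+ n} (+≤+ ℕ.z≤n) (+≤+ ℕ.z≤n)
nonneg-sq -[1+ n ] = +≤+ ℕ.z≤n

nonneg-double : ∀ {x} → 0ℤ ≤ x → 0ℤ ≤ + 2 * x
nonneg-double {x} = nonneg-* {+ 2} {x} (+≤+ ℕ.z≤n)

∣∣-mono : ∀ {x y} → 0ℤ ≤ x → x ≤ y → ∣ x ∣ ℕ.≤ ∣ y ∣
∣∣-mono (+≤+ _) (+≤+ h) = h

≤-+ʳ : ∀ {x r} → 0ℤ ≤ r → x ≤ x + r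
≤-+ʳ {x} h = subst (_≤ x + _) (ℤₚ.+-identityʳ x) (ℤₚ.+-monoʳ-≤ x h)

≤-*-pos : ∀ {x y} → Pos x → Pos y → x ≤ x * y
≤-*-pos {x} {y} (+<+ {n = suc m} _) (+<+ {n = suc n} _) = +≤+ (ℕₚ.m≤m*n (suc m) (suc n))

bound-factorˡ : ∀ {x y r N} → Pos x → Pos y → 0ℤ ≤ r → x * y + r ≡ N → ∣ x ∣ ℕ.≤ ∣ N ∣
bound-factorˡ px py hr refl = ∣∣-mono (pos⇒nonneg px) (ℤₚ.≤-trans (≤-*-pos px py) (≤-+ʳ hr))

bound-factorʳ : ∀ {x y r N} → Pos x → Pos y → 0ℤ ≤ r → x * y + r ≡ N → ∣ y ∣ ℕ.≤ ∣ N ∣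
bound-factorʳ {x} {y} {r} px py hr e = bound-factorˡ py px hr (trans (cong (_+ r) (ℤₚ.*-comm y x)) e)

bound-sq : ∀ {x r N} → 0ℤ ≤ r → x * x + r ≡ N → ∣ x ∣ ℕ.≤ ∣ N ∣
bound-sq {x} {r} hr refl = ℕₚ.≤-trans (small x) (∣∣-mono (nonneg-sq x) (≤-+ʳ hr))
  where
  small : ∀ x → ∣ x ∣ ℕ.≤ ∣ x * x ∣
  small (+ zero)  = ℕ.z≤n
  small (+ suc n) = ℕₚ.m≤m*n (suc n) (suc n)
  small -[1+ n ]  = ℕₚ.m≤m*n (suc n) (suc n)

-- For positive `s` and `j` the difference `2u = s - j` is at most their maximum in absolute value.
bound-diff : ∀ {s j u n} → Pos s → Pos j → ∣ s ∣ ℕ.≤ n → ∣ j ∣ ℕ.≤ n → s ≡ j + + 2 * u → ∣ u ∣ ℕ.≤ n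
bound-diff {s} {j} {u} {n} ps pj hs hj refl =
  ℕₚ.≤-trans (small u) (subst (λ x → ∣ x ∣ ℕ.≤ n) ([x+2y]-x≡2y j u) (go {j + + 2 * u} {j} ps pj hs hj))
  where
  small : ∀ x → ∣ x ∣ ℕ.≤ ∣ + 2 * x ∣
  small x = subst (∣ x ∣ ℕ.≤_) (sym (ℤₚ.∣i*j∣≡∣i∣*∣j∣ (+ 2) x)) (ℕₚ.m≤m+n ∣ x ∣ _)
  go : ∀ {x y} → Pos x → Pos y → ∣ x ∣ ℕ.≤ n → ∣ y ∣ ℕ.≤ n → ∣ x - y ∣ ℕ.≤ n
  go {+ a} {+ b} (+<+ _) (+<+ _) ha hb =
    ℕₚ.≤-trans (subst (λ x → ∣ x ∣ ℕ.≤ a ℕ.⊔ b) (sym (ℤₚ.[+m]-[+n]≡m⊖n a b)) (ℤₚ.∣m⊝n∣≤m⊔n a b)) (ℕₚ.⊔-lub ha hb)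

odd≢even : ∀ {x m} → + 2 * x ≢ 1ℤ + + 2 * m
odd≢even {x} {m} e = no-half (x - m) (trans (eq x m) (trans (cong (_- + 2 * m) e) (eq′ m)))
  where
  eq : ∀ x m → + 2 * (x - m) ≡ + 2 * x - + 2 * m
  eq = solve-∀
  eq′ : ∀ m → 1ℤ + + 2 * m - + 2 * m ≡ 1ℤ
  eq′ = solve-∀
  no-half : ∀ y → + 2 * y ≢ 1ℤ
  no-half (+ zero) ()
  no-half (+ suc n) h = contra n (ℤₚ.+-injective h)
    where
    contra : ∀ n → suc (n ℕ.+ (suc n ℕ.+ 0)) ≢ 1
    contra n h with trans (sym (ℕₚ.+-suc n (n ℕ.+ 0))) (ℕₚ.suc-injective h)
    ... | ()
  no-half -[1+ n ] ()

tuple³ : ∀ {x x′ y y′ z z′ : ℤ} → x ≡ x′ → y ≡ y′ → z ≡ z′ → (x , y , z) ≡ (x′ , y′ , z′)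
tuple³ refl refl refl = refl

tuple⁴ : ∀ {x x′ y y′ z z′ t t′ : ℤ} → x ≡ x′ → y ≡ y′ → z ≡ z′ → t ≡ t′ → (x , y , z , t) ≡ (x′ , y′ , z′ , t′)
tuple⁴ refl refl refl refl = refl

-- Liouville's identity

Factor : ℤ → ℤ² → Set
Factor N (j , d) = Pos j × Pos d × j * d ≡ N

factors : ∀ N → Enum (Factor N)
factors N = enum² ∣ N ∣ (λ (j , d) → Pos? j ×-dec Pos? d ×-dec (j * d ≟ N))
  λ (pj , pd , e) → let e′ = trans (ℤₚ.+-identityʳ _) e in
    bound-factorˡ pj pd ℤₚ.≤-refl e′ , bound-factorʳ pj pd ℤₚ.≤-refl e′

Diagonal : ℤ → ℤ³ → Set
Diagonal N (j , d , h) = Pos j × Pos d × Pos h × j * d + + 2 * (j * h) ≡ N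

diagonals : ∀ N → Enum (Diagonal N)
diagonals N = enum³ ∣ N ∣ (λ (j , d , h) → Pos? j ×-dec Pos? d ×-dec Pos? h ×-dec (j * d + + 2 * (j * h) ≟ N))
  λ {j} {d} {h} (pj , pd , ph , e) →
    bound-factorˡ pj pd (pos⇒nonneg (pos-double (pos-* pj ph))) e ,
    bound-factorʳ pj pd (pos⇒nonneg (pos-double (pos-* pj ph))) e ,
    bound-factorʳ (pos-double pj) ph (pos⇒nonneg (pos-* pj pd)) (trans (eq j d h) e)
  where
  eq : ∀ j d h → + 2 * j * h + j * d ≡ j * d + + 2 * (j * h)
  eq = solve-∀

-- For odd N this is the sum of the divisors of N.
mass : ℤ → ℤ
mass N = + 2 * count (diagonals N) + count (factors N)

-- T₁ and T₂ are the solutions of jd + 2sh + 2e(u) = N with u = (s - j)/2 and u = (s + j)/2 respectively; they are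
-- cut into pieces of A and B by steps of the Euclidean algorithm on (j, s) and (d, 2h). Parity of j is automatic, N being odd.
module Liouville (m : ℤ) (e f : ℤ → ℤ) (e≥0 : ∀ u → 0ℤ ≤ e u) (e-even : ∀ u → e (- u) ≡ e u) (f-even : ∀ u → f (- u) ≡ f u) where

  N : ℤ
  N = 1ℤ + + 2 * m

  T₁ T₂ A B : ℤ⁴ → Set
  T₁ (j , d , u , h) = Pos j × Pos d × Pos h × Pos (j + + 2 * u) × j * d + + 2 * ((j + + 2 * u) * h) + + 2 * e u ≡ N
  T₂ (j , d , u , h) = Pos j × Pos d × Pos h × Pos (+ 2 * u - j) × j * d + + 2 * ((+ 2 * u - j) * h) + + 2 * e u ≡ N
  A  (j , d , g , h) = Pos j × Pos d × Pos g × Pos h × j * d + + 4 * (g * h) + + 2 * e g ≡ N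
  B  (s , d , g , t) = Pos s × Pos d × Pos g × Pos (d + + 2 * t) × s * (d + + 2 * t) + + 2 * (g * d) + + 2 * e g ≡ N

  T₀ : ℤ³ → Set
  T₀ (j , d , u) = Pos j × Pos d × Pos (j + + 2 * u) × Pos (j - + 2 * u) × j * d + + 2 * e u ≡ N

  private
    double-e≥0 : ∀ u → 0ℤ ≤ + 2 * e u
    double-e≥0 u = nonneg-double (e≥0 u)

  T₁-enum : Enum T₁
  T₁-enum = enum⁴ ∣ N ∣ (λ (j , d , u , h) → Pos? j ×-dec Pos? d ×-dec Pos? h ×-dec Pos? (j + + 2 * u) ×-dec (_ ≟ N))
    λ {j} {d} {u} {h} (pj , pd , ph , ps , q) →
      let s = j + + 2 * u
          r = nonneg-+ (pos⇒nonneg (pos-double (pos-* ps ph))) (double-e≥0 u)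
          r′ = nonneg-+ (pos⇒nonneg (pos-* pj pd)) (double-e≥0 u)
          q₁ = trans (sym (ℤₚ.+-assoc (j * d) _ _)) q
          q₂ = trans (eq j d s h (e u)) q
          bj = bound-factorˡ pj pd r q₁
          bs = bound-factorˡ ps (pos-double ph) r′ q₂
          bh = bound-factorʳ (pos-double ps) ph r′ (trans (eq′ j d s h (e u)) q)
      in bj , bound-factorʳ pj pd r q₁ , bound-diff ps pj bs bj refl , bh
    where
    eq : ∀ j d s h E → s * (+ 2 * h) + (j * d + + 2 * E) ≡ j * d + + 2 * (s * h) + + 2 * E
    eq = solve-∀
    eq′ : ∀ j d s h E → + 2 * s * h + (j * d + + 2 * E) ≡ j * d + + 2 * (s * h) + + 2 * E
    eq′ = solve-∀

  T₂-enum : Enum T₂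
  T₂-enum = enum⁴ ∣ N ∣ (λ (j , d , u , h) → Pos? j ×-dec Pos? d ×-dec Pos? h ×-dec Pos? (+ 2 * u - j) ×-dec (_ ≟ N))
    λ {j} {d} {u} {h} (pj , pd , ph , ps , q) →
      let s = + 2 * u - j
          r = nonneg-+ (pos⇒nonneg (pos-double (pos-* ps ph))) (double-e≥0 u)
          r′ = nonneg-+ (pos⇒nonneg (pos-* pj pd)) (double-e≥0 u)
          q₁ = trans (sym (ℤₚ.+-assoc (j * d) _ _)) q
          q₃ = trans (eq j d u h (e u)) q
          pu = pos-half (pos≡ (pos-+ ps pj) ([2y-x]+x≡2y j u))
      in bound-factorˡ pj pd r q₁ , bound-factorʳ pj pd r q₁ ,
         bound-u pu pj pd ph ps q , bound-factorʳ (pos-double ps) ph r′ q₃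
    where
    eq : ∀ j d u h E → + 2 * (+ 2 * u - j) * h + (j * d + + 2 * E) ≡ j * d + + 2 * ((+ 2 * u - j) * h) + + 2 * E
    eq = solve-∀
    -- Here `2u = j + s` with `s = 2u - j`, and `j d` and `2 s h` are at least `j` and `s`; this
    -- exhibits `N - u` as a sum of nonnegative terms.
    split : ∀ j d u h E → u * 1ℤ + (j * (d - 1ℤ) + ((+ 2 * u - j) * (+ 2 * h - 1ℤ)) + u + + 2 * E) ≡ j * d + + 2 * ((+ 2 * u - j) * h) + + 2 * E
    split = solve-∀
    pred≥0 : ∀ {x} → Pos x → 0ℤ ≤ x - 1ℤ
    pred≥0 (+<+ {n = suc n} _) = +≤+ ℕ.z≤n
    double≥ : ∀ {x} → Pos x → 0ℤ ≤ + 2 * x - 1ℤ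
    double≥ p = pred≥0 (pos-double p)
    bound-u : ∀ {j d u h} → Pos u → Pos j → Pos d → Pos h → Pos (+ 2 * u - j) → _ → ∣ u ∣ ℕ.≤ ∣ N ∣
    bound-u {j} {d} {u} {h} pu pj pd ph ps q = bound-factorˡ pu (+<+ (ℕ.s≤s ℕ.z≤n))
      (nonneg-+ (nonneg-+ (nonneg-+ (nonneg-* (pos⇒nonneg pj) (pred≥0 pd)) (nonneg-* (pos⇒nonneg ps) (double≥ ph))) (pos⇒nonneg pu)) (double-e≥0 u))
      (trans (split j d u h (e u)) q)

  A-enum : Enum A
  A-enum = enum⁴ ∣ N ∣ (λ (j , d , g , h) → Pos? j ×-dec Pos? d ×-dec Pos? g ×-dec Pos? h ×-dec (_ ≟ N))
    λ {j} {d} {g} {h} (pj , pd , pg , ph , q) →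
      let r = nonneg-+ (nonneg-double (pos⇒nonneg (pos-double (pos-* pg ph)))) (double-e≥0 g)
          r′ = nonneg-+ (pos⇒nonneg (pos-* pj pd)) (double-e≥0 g)
          q₁ = trans (eq₁ j d g h (e g)) q
          q₂ = trans (eq₂ j d g h (e g)) q
          q₃ = trans (eq₃ j d g h (e g)) q
      in bound-factorˡ pj pd r q₁ , bound-factorʳ pj pd r q₁ , bound-factorˡ pg (pos-double (pos-double ph)) r′ q₂ , bound-factorʳ (pos-double (pos-double pg)) ph r′ q₃
    where
    eq₁ : ∀ j d g h E → j * d + (+ 2 * (+ 2 * (g * h)) + + 2 * E) ≡ j * d + + 4 * (g * h) + + 2 * E
    eq₁ = solve-∀
    eq₂ : ∀ j d g h E → g * (+ 2 * (+ 2 * h)) + (j * d + + 2 * E) ≡ j * d + + 4 * (g * h) + + 2 * E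
    eq₂ = solve-∀
    eq₃ : ∀ j d g h E → + 2 * (+ 2 * g) * h + (j * d + + 2 * E) ≡ j * d + + 4 * (g * h) + + 2 * E
    eq₃ = solve-∀

  B-enum : Enum B
  B-enum = enum⁴ ∣ N ∣ (λ (s , d , g , t) → Pos? s ×-dec Pos? d ×-dec Pos? g ×-dec Pos? (d + + 2 * t) ×-dec (_ ≟ N))
    λ {s} {d} {g} {t} (ps , pd , pg , pD , q) →
      let r = nonneg-+ (pos⇒nonneg (pos-double (pos-* pg pd))) (double-e≥0 g)
          r′ = nonneg-+ (pos⇒nonneg (pos-* ps pD)) (double-e≥0 g)
          q₁ = trans (sym (ℤₚ.+-assoc (s * (d + + 2 * t)) _ _)) q
          q₂ = trans (eq₂ s d g (d + + 2 * t) (e g)) q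
          q₃ = trans (eq₃ s d g (d + + 2 * t) (e g)) q
          bd = bound-factorʳ (pos-double pg) pd r′ q₃
      in bound-factorˡ ps pD r q₁ , bd , bound-factorˡ pg (pos-double pd) r′ q₂ , bound-diff pD pd (bound-factorʳ ps pD r q₁) bd refl
    where
    eq₂ : ∀ s d g D E → g * (+ 2 * d) + (s * D + + 2 * E) ≡ s * D + + 2 * (g * d) + + 2 * E
    eq₂ = solve-∀
    eq₃ : ∀ s d g D E → + 2 * g * d + (s * D + + 2 * E) ≡ s * D + + 2 * (g * d) + + 2 * E
    eq₃ = solve-∀

  T₀-enum : Enum T₀
  T₀-enum = enum³ ∣ N ∣ (λ (j , d , u) → Pos? j ×-dec Pos? d ×-dec Pos? (j + + 2 * u) ×-dec Pos? (j - + 2 * u) ×-dec (_ ≟ N))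
    λ {j} {d} {u} (pj , pd , p⁺ , p⁻ , q) →
      let bj = bound-factorˡ pj pd (double-e≥0 u) q
      in bj , bound-factorʳ pj pd (double-e≥0 u) q , bound-u {j} {u} p⁺ p⁻ bj
    where
    double : ∀ j u → j + + 2 * u + (j - + 2 * u) ≡ + 2 * j
    double = solve-∀
    diff : ∀ j u → j + + 2 * u ≡ j - + 2 * u + + 2 * (+ 2 * u)
    diff = solve-∀
    bound-u : ∀ {j u} → Pos (j + + 2 * u) → Pos (j - + 2 * u) → ∣ j ∣ ℕ.≤ ∣ N ∣ → ∣ u ∣ ℕ.≤ ∣ N ∣
    bound-u {j} {u} p q b = ℕₚ.*-cancelˡ-≤ 2 (subst (ℕ._≤ 2 ℕ.* ∣ N ∣) (ℤₚ.∣i*j∣≡∣i∣*∣j∣ (+ 2) u)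
      (bound-diff p q (le (∣∣-mono (pos⇒nonneg p) (subst (j + + 2 * u ≤_) (double j u) (≤-+ʳ (pos⇒nonneg q)))))
                      (le (∣∣-mono (pos⇒nonneg q) (subst (j - + 2 * u ≤_) (trans (ℤₚ.+-comm (j - + 2 * u) (j + + 2 * u)) (double j u)) (≤-+ʳ (pos⇒nonneg p))))) (diff j u)))
      where
      le : ∀ {n} → n ℕ.≤ ∣ + 2 * j ∣ → n ℕ.≤ 2 ℕ.* ∣ N ∣
      le h = ℕₚ.≤-trans h (subst (ℕ._≤ 2 ℕ.* ∣ N ∣) (sym (ℤₚ.∣i*j∣≡∣i∣*∣j∣ (+ 2) j)) (ℕₚ.*-monoʳ-≤ 2 b))

  -- For `T₁` the smaller of `j` and `s = j + 2u` is subtracted from the larger: if `u > 0`,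
  -- `jd + 2sh` is regrouped as `j(d + 2h) + 4uh`, a point of `A`; if `u < 0`, as
  -- `s(d + 2h) + 2(-u)d`, a point of `B`.
  T₁⁺≅A⁺ : (λ a → T₁ a × Pos (proj₁ (proj₂ (proj₂ a)))) ≅ (λ ((j , d , g , h) : ℤ⁴) → A (j , d , g , h) × Pos (d - + 2 * h))
  T₁⁺≅A⁺ = record
    { to      = λ (j , d , u , h) → j , d + + 2 * h , u , h
    ; from    = λ (j , d , u , h) → j , d - + 2 * h , u , h
    ; to-∈    = λ {(j , d , u , h)} ((pj , pd , ph , ps , q) , pu) →
        (pj , pos-+ pd (pos-double ph) , pu , ph , trans (eq₁ j d u h (e u)) q) , pos≡ pd (x≡[x+2y]-2y d h)
    ; from-∈  = λ {(j , d , u , h)} ((pj , pd , pg , ph , q) , pr) →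
        (pj , pr , ph , pos-+ pj (pos-double pg) , trans (eq₂ j d u h (e u)) q) , pg
    ; from-to = λ {(j , d , u , h)} _ → tuple⁴ refl (sym (x≡[x+2y]-2y d h)) refl refl
    ; to-from = λ {(j , d , u , h)} _ → tuple⁴ refl ([x-2y]+2y≡x d h) refl refl
    }
    where
    eq₁ : ∀ j d u h E → j * (d + + 2 * h) + + 4 * (u * h) + + 2 * E ≡ j * d + + 2 * ((j + + 2 * u) * h) + + 2 * E
    eq₁ = solve-∀
    eq₂ : ∀ j d u h E → j * (d - + 2 * h) + + 2 * ((j + + 2 * u) * h) + + 2 * E ≡ j * d + + 4 * (u * h) + + 2 * E
    eq₂ = solve-∀

  third : ℤ⁴ → ℤ
  third (_ , _ , u , _) = u

  T₁⁻≅B⁺ : (λ a → T₁ a × Pos (- third a)) ≅ (λ ((s , d , g , t) : ℤ⁴) → B (s , d , g , t) × Pos t)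
  T₁⁻≅B⁺ = record
    { to      = λ (j , d , u , h) → j + + 2 * u , d , - u , h
    ; from    = λ (s , d , g , t) → s + + 2 * g , d , - g , t
    ; to-∈    = λ {(j , d , u , h)} ((pj , pd , ph , ps , q) , pu) →
        (ps , pd , pu , pos-+ pd (pos-double ph) ,
         trans (+-congʳ ((j + + 2 * u) * (d + + 2 * h) + + 2 * (- u * d)) (cong (λ E → + 2 * E) (e-even u))) (trans (eq₁ j d u h (e u)) q)) , ph
    ; from-∈  = λ {(s , d , g , t)} ((ps , pd , pg , pD , q) , pt) →
        (pos-+ ps (pos-double pg) , pd , pt , pos≡ ps (eq₃ s g) ,
         trans (+-congʳ ((s + + 2 * g) * d + + 2 * ((s + + 2 * g + + 2 * - g) * t)) (cong (λ E → + 2 * E) (e-even g))) (trans (eq₂ s d g t (e g)) q)) , pos≡ pg (eq₄ g)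
    ; from-to = λ {(j , d , u , h)} _ → tuple⁴ (eq₅ j u) refl (sym (eq₄ u)) refl
    ; to-from = λ {(j , d , u , h)} _ → tuple⁴ (sym (eq₃ j u)) refl (sym (eq₄ u)) refl
    }
    where
    eq₁ : ∀ j d u h E → (j + + 2 * u) * (d + + 2 * h) + + 2 * (- u * d) + + 2 * E ≡ j * d + + 2 * ((j + + 2 * u) * h) + + 2 * E
    eq₁ = solve-∀
    eq₂ : ∀ s d g t E → (s + + 2 * g) * d + + 2 * ((s + + 2 * g + + 2 * (- g)) * t) + + 2 * E ≡ s * (d + + 2 * t) + + 2 * (g * d) + + 2 * E
    eq₂ = solve-∀
    eq₃ : ∀ s g → s ≡ s + + 2 * g + + 2 * (- g)
    eq₃ = solve-∀
    eq₄ : ∀ g → g ≡ - (- g)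
    eq₄ g = sym (ℤₚ.neg-involutive g)
    eq₅ : ∀ s g → s + + 2 * g + + 2 * (- g) ≡ s
    eq₅ = solve-∀

  -- For `T₂` it is the smaller of `d` and `2h` that is subtracted. With `s + j = 2u`, `jd + 2sh` is
  -- `j(d - 2h) + 4uh` if `d > 2h`, and `s(2h - d) + 2ud` if `d < 2h`.
  T₂⁺≅A⁺ : (λ ((j , d , u , h) : ℤ⁴) → T₂ (j , d , u , h) × Pos (d - + 2 * h)) ≅ (λ ((j , d , g , h) : ℤ⁴) → A (j , d , g , h) × Pos (+ 2 * g - j))
  T₂⁺≅A⁺ = record
    { to      = λ (j , d , u , h) → j , d - + 2 * h , u , h
    ; from    = λ (j , d , u , h) → j , d + + 2 * h , u , h
    ; to-∈    = λ {(j , d , u , h)} ((pj , pd , ph , ps , q) , pr) →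
        (pj , pr , pos-half (pos≡ (pos-+ ps pj) ([2y-x]+x≡2y j u)) , ph , trans (eq₁ j d u h (e u)) q) , ps
    ; from-∈  = λ {(j , d , u , h)} ((pj , pd , pg , ph , q) , pr) →
        (pj , pos-+ pd (pos-double ph) , ph , pr , trans (eq₂ j d u h (e u)) q) , pos≡ pd (x≡[x+2y]-2y d h)
    ; from-to = λ {(j , d , u , h)} _ → tuple⁴ refl ([x-2y]+2y≡x d h) refl refl
    ; to-from = λ {(j , d , u , h)} _ → tuple⁴ refl (sym (x≡[x+2y]-2y d h)) refl refl
    }
    where
    eq₁ : ∀ j d u h E → j * (d - + 2 * h) + + 4 * (u * h) + + 2 * E ≡ j * d + + 2 * ((+ 2 * u - j) * h) + + 2 * E
    eq₁ = solve-∀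
    eq₂ : ∀ j d u h E → j * (d + + 2 * h) + + 2 * ((+ 2 * u - j) * h) + + 2 * E ≡ j * d + + 4 * (u * h) + + 2 * E
    eq₂ = solve-∀

  T₂⁻≅B⁺ : (λ ((j , d , u , h) : ℤ⁴) → T₂ (j , d , u , h) × Pos (- (d - + 2 * h))) ≅ (λ ((s , d , g , t) : ℤ⁴) → B (s , d , g , t) × Pos (+ 2 * g - s))
  T₂⁻≅B⁺ = record
    { to      = λ (j , d , u , h) → + 2 * u - j , d , u , h - d
    ; from    = λ (s , d , g , t) → + 2 * g - s , d , g , t + d
    ; to-∈    = λ {(j , d , u , h)} ((pj , pd , ph , ps , q) , pr) →
        (ps , pd , pos-half (pos≡ (pos-+ ps pj) ([2y-x]+x≡2y j u)) , pos≡ pr (eq₆ d h) , trans (eq₁ j d u h (e u)) q) , pos≡ pj (eq₃ j u)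
    ; from-∈  = λ {(s , d , g , t)} ((ps , pd , pg , pD , q) , pr) →
        (pr , pd , pos-half (pos≡ (pos-+ pD pd) ([x+2y]+x≡2[y+x] d t)) , pos≡ ps (eq₃ s g) , trans (eq₂ s d g t (e g)) q) , pos≡ pD (x+2y≡-[x-2[y+x]] d t)
    ; from-to = λ {(j , d , u , h)} _ → tuple⁴ (sym (eq₃ j u)) refl refl ([x-y]+y≡x h d)
    ; to-from = λ {(j , d , u , h)} _ → tuple⁴ (sym (eq₃ j u)) refl refl ([x+y]-y≡x h d)
    }
    where
    eq₁ : ∀ j d u h E → (+ 2 * u - j) * (d + + 2 * (h - d)) + + 2 * (u * d) + + 2 * E ≡ j * d + + 2 * ((+ 2 * u - j) * h) + + 2 * E
    eq₁ = solve-∀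
    eq₂ : ∀ s d g t E → (+ 2 * g - s) * d + + 2 * ((+ 2 * g - (+ 2 * g - s)) * (t + d)) + + 2 * E ≡ s * (d + + 2 * t) + + 2 * (g * d) + + 2 * E
    eq₂ = solve-∀
    eq₃ : ∀ j u → j ≡ + 2 * u - (+ 2 * u - j)
    eq₃ = solve-∀
    eq₆ : ∀ d h → - (d - + 2 * h) ≡ d + + 2 * (h - d)
    eq₆ = solve-∀

  -- This bijection and the next match the parts of `A` that `T₂` and `T₁` respectively do not reach
  -- with parts of `B`. They carry no solutions of `T₁` or `T₂`; they make the leftovers cancel in
  -- `liouville`.
  A⁻≅B⁻ : (λ ((j , d , g , h) : ℤ⁴) → A (j , d , g , h) × Pos (- (+ 2 * g - j))) ≅ (λ ((s , d , g , t) : ℤ⁴) → B (s , d , g , t) × Pos (- t))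
  A⁻≅B⁻ = record
    { to      = λ (j , d , g , h) → j - + 2 * g , d + + 2 * h , g , - h
    ; from    = λ (s , d , g , t) → s + + 2 * g , d + + 2 * t , g , - t
    ; to-∈    = λ {(j , d , g , h)} ((pj , pd , pg , ph , q) , pr) →
        (pos≡ pr (eq₃ j g) , pos-+ pd (pos-double ph) , pg , pos≡ pd (eq₄ d h) , trans (eq₁ j d g h (e g)) q) , pos≡ ph (eq₅ h)
    ; from-∈  = λ {(s , d , g , t)} ((ps , pd , pg , pD , q) , pr) →
        (pos-+ ps (pos-double pg) , pD , pg , pr , trans (eq₂ s d g t (e g)) q) , pos≡ ps (eq₆ s g)
    ; from-to = λ {(j , d , g , h)} _ → tuple⁴ ([x-2y]+2y≡x j g) (sym (eq₄ d h)) refl (sym (eq₅ h))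
    ; to-from = λ {(j , d , g , h)} _ → tuple⁴ (eq₈ j g) (sym (eq₄ d h)) refl (sym (eq₅ h))
    }
    where
    eq₁ : ∀ j d g h E → (j - + 2 * g) * (d + + 2 * h + + 2 * - h) + + 2 * (g * (d + + 2 * h)) + + 2 * E ≡ j * d + + 4 * (g * h) + + 2 * E
    eq₁ = solve-∀
    eq₂ : ∀ s d g t E → (s + + 2 * g) * (d + + 2 * t) + + 4 * (g * - t) + + 2 * E ≡ s * (d + + 2 * t) + + 2 * (g * d) + + 2 * E
    eq₂ = solve-∀
    eq₃ : ∀ j g → - (+ 2 * g - j) ≡ j - + 2 * g
    eq₃ = solve-∀
    eq₄ : ∀ d h → d ≡ d + + 2 * h + + 2 * - h
    eq₄ = solve-∀
    eq₅ : ∀ h → h ≡ - - h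
    eq₅ h = sym (ℤₚ.neg-involutive h)
    eq₆ : ∀ s g → s ≡ - (+ 2 * g - (s + + 2 * g))
    eq₆ = solve-∀
    eq₈ : ∀ j g → j + + 2 * g - + 2 * g ≡ j
    eq₈ = solve-∀

  A⁻≅B⁻′ : (λ ((j , d , g , h) : ℤ⁴) → A (j , d , g , h) × Pos (- (d - + 2 * h))) ≅ (λ ((s , d , g , t) : ℤ⁴) → B (s , d , g , t) × Pos (- (+ 2 * g - s)))
  A⁻≅B⁻′ = record
    { to      = λ (j , d , g , h) → j + + 2 * g , - (d - + 2 * h) , g , d - h
    ; from    = λ (s , d , g , t) → - (+ 2 * g - s) , d + + 2 * t , g , t + d
    ; to-∈    = λ {(j , d , g , h)} ((pj , pd , pg , ph , q) , pr) →
        (pos-+ pj (pos-double pg) , pr , pg , pos≡ pd (eq₃ d h) , trans (eq₁ j d g h (e g)) q) , pos≡ pj (eq₄ j g)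
    ; from-∈  = λ {(s , d , g , t)} ((ps , pd , pg , pD , q) , pr) →
        (pr , pD , pg , pos-half (pos≡ (pos-+ pD pd) ([x+2y]+x≡2[y+x] d t)) , trans (eq₂ s d g t (e g)) q) , pos≡ pd (eq₅ d t)
    ; from-to = λ {(j , d , g , h)} _ → tuple⁴ (sym (eq₄ j g)) (sym (eq₃ d h)) refl (eq₆ d h)
    ; to-from = λ {(s , d , g , t)} _ → tuple⁴ (eq₈ s g) (sym (eq₅ d t)) refl (eq₉ d t)
    }
    where
    eq₁ : ∀ j d g h E → (j + + 2 * g) * (- (d - + 2 * h) + + 2 * (d - h)) + + 2 * (g * - (d - + 2 * h)) + + 2 * E ≡ j * d + + 4 * (g * h) + + 2 * E
    eq₁ = solve-∀
    eq₂ : ∀ s d g t E → - (+ 2 * g - s) * (d + + 2 * t) + + 4 * (g * (t + d)) + + 2 * E ≡ s * (d + + 2 * t) + + 2 * (g * d) + + 2 * E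
    eq₂ = solve-∀
    eq₃ : ∀ d h → d ≡ - (d - + 2 * h) + + 2 * (d - h)
    eq₃ = solve-∀
    eq₄ : ∀ j g → j ≡ - (+ 2 * g - (j + + 2 * g))
    eq₄ = solve-∀
    eq₅ : ∀ d t → d ≡ - (d + + 2 * t - + 2 * (t + d))
    eq₅ = solve-∀
    eq₆ : ∀ d h → d - h + - (d - + 2 * h) ≡ h
    eq₆ = solve-∀
    eq₈ : ∀ s g → - (+ 2 * g - s) + + 2 * g ≡ s
    eq₈ = solve-∀
    eq₉ : ∀ d t → d + + 2 * t - (t + d) ≡ t
    eq₉ = solve-∀

  -- At `t = 0` the form of `B` factors as `(s + 2g)d`. With `j = s + 2g` and `u = g`, the condition
  -- `s > 0` becomes `2u < j`.
  B⁰≅T₀⁺ : (λ ((s , d , g , t) : ℤ⁴) → B (s , d , g , t) × t ≡ 0ℤ) ≅ (λ ((j , d , u) : ℤ³) → T₀ (j , d , u) × Pos u)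
  B⁰≅T₀⁺ = record
    { to      = λ (s , d , g , t) → s + + 2 * g , d , g
    ; from    = λ (j , d , u) → j - + 2 * u , d , u , 0ℤ
    ; to-∈    = λ { {(s , d , g , t)} ((ps , pd , pg , pD , q) , refl) →
        (pos-+ ps (pos-double pg) , pd , pos-+ (pos-+ ps (pos-double pg)) (pos-double pg) , pos≡ ps (x≡[x+2y]-2y s g) , trans (eq₁ s d g (e g)) q) , pg }
    ; from-∈  = λ {(j , d , u)} ((pj , pd , p⁺ , p⁻ , q) , pu) →
        (p⁻ , pd , pu , pos≡ pd (sym (ℤₚ.+-identityʳ d)) , trans (eq₂ j d u (e u)) q) , refl
    ; from-to = λ { {(s , d , g , t)} (_ , refl) → tuple⁴ (sym (x≡[x+2y]-2y s g)) refl refl refl }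
    ; to-from = λ {(j , d , u)} _ → tuple³ ([x-2y]+2y≡x j u) refl refl
    }
    where
    eq₁ : ∀ s d g E → (s + + 2 * g) * d + + 2 * E ≡ s * (d + + 2 * 0ℤ) + + 2 * (g * d) + + 2 * E
    eq₁ = solve-∀
    eq₂ : ∀ j d u E → (j - + 2 * u) * (d + + 2 * 0ℤ) + + 2 * (u * d) + + 2 * E ≡ j * d + + 2 * E
    eq₂ = solve-∀

  T₀⁻≅T₀⁺ : (λ ((j , d , u) : ℤ³) → T₀ (j , d , u) × Pos (- u)) ≅ (λ ((j , d , u) : ℤ³) → T₀ (j , d , u) × Pos u)
  T₀⁻≅T₀⁺ = record
    { to      = λ (j , d , u) → j , d , - u
    ; from    = λ (j , d , u) → j , d , - u
    ; to-∈    = λ {(j , d , u)} ((pj , pd , p⁺ , p⁻ , q) , pu) →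
        (pj , pd , pos≡ p⁻ (eq₁ j u) , pos≡ p⁺ (eq₂ j u) , trans (cong (λ E → j * d + + 2 * E) (e-even u)) q) , pu
    ; from-∈  = λ {(j , d , u)} ((pj , pd , p⁺ , p⁻ , q) , pu) →
        (pj , pd , pos≡ p⁻ (eq₁ j u) , pos≡ p⁺ (eq₂ j u) , trans (cong (λ E → j * d + + 2 * E) (e-even u)) q) , pos≡ pu (sym (ℤₚ.neg-involutive u))
    ; from-to = λ {(j , d , u)} _ → tuple³ refl refl (ℤₚ.neg-involutive u)
    ; to-from = λ {(j , d , u)} _ → tuple³ refl refl (ℤₚ.neg-involutive u)
    }
    where
    eq₁ : ∀ j u → j - + 2 * u ≡ j + + 2 * - u
    eq₁ = solve-∀
    eq₂ : ∀ j u → j + + 2 * u ≡ j - + 2 * - u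
    eq₂ = solve-∀

  S₁ S₂ S₀ : ℤ
  S₁ = ∑ T₁-enum (f ∘ third)
  S₂ = ∑ T₂-enum (f ∘ third)
  S₀ = ∑ T₀-enum (λ (j , d , u) → f u)

  module _ (e-zero : e 0ℤ ≡ 0ℤ) (f-zero : f 0ℤ ≡ 1ℤ) where

    T₁⁰≅Diagonal : (λ a → T₁ a × third a ≡ 0ℤ) ≅ Diagonal N
    T₁⁰≅Diagonal = record
      { to      = λ (j , d , u , h) → j , d , h
      ; from    = λ (j , d , h) → j , d , 0ℤ , h
      ; to-∈    = λ { {(j , d , u , h)} ((pj , pd , ph , ps , q) , refl) → pj , pd , ph , trans (eq j d h) (trans (cong (λ E → j * d + + 2 * ((j + + 2 * 0ℤ) * h) + + 2 * E) (sym e-zero)) q) }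
      ; from-∈  = λ {(j , d , h)} (pj , pd , ph , q) → (pj , pd , ph , pos≡ pj (sym (ℤₚ.+-identityʳ j)) , trans (cong (λ E → j * d + + 2 * ((j + + 2 * 0ℤ) * h) + + 2 * E) e-zero) (trans (sym (eq j d h)) q)) , refl
      ; from-to = λ { (_ , refl) → refl }
      ; to-from = λ _ → refl
      }
      where
      eq : ∀ j d h → j * d + + 2 * (j * h) ≡ j * d + + 2 * ((j + + 2 * 0ℤ) * h) + + 2 * 0ℤ
      eq = solve-∀

    T₀⁰≅Factor : (λ ((j , d , u) : ℤ³) → T₀ (j , d , u) × u ≡ 0ℤ) ≅ Factor N
    T₀⁰≅Factor = record
      { to      = λ (j , d , u) → j , d
      ; from    = λ (j , d) → j , d , 0ℤ
      ; to-∈    = λ { {(j , d , u)} ((pj , pd , _ , _ , q) , refl) → pj , pd , trans (sym (ℤₚ.+-identityʳ _)) (trans (cong (λ E → j * d + + 2 * E) (sym e-zero)) q) }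
      ; from-∈  = λ {(j , d)} (pj , pd , q) → (pj , pd , pos≡ pj (sym (ℤₚ.+-identityʳ j)) , pos≡ pj (sym (ℤₚ.+-identityʳ j)) , trans (cong (λ E → j * d + + 2 * E) e-zero) (trans (ℤₚ.+-identityʳ _) q)) , refl
      ; from-to = λ { (_ , refl) → refl }
      ; to-from = λ _ → refl
      }

    -- Cutting `A` and `B` twice each gives `a₁ + a₁⁻ = a₂ + a₂⁻` and `b₁ + a₂⁻ + b₀ = b₂ + a₁⁻`.
    -- Since `S₁ = a₁ + b₁ + t₁` and `S₂ = a₂ + b₂`, the difference `S₁ - S₂` is `t₁ - b₀`. By
    -- evenness of `f`, `S₀ = 2b₀ + t₀`, so the `b₀` cancel and only the solutions with `u = 0`
    -- remain.
    liouville : + 2 * S₁ - + 2 * S₂ + S₀ ≡ mass N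
    liouville = begin
      + 2 * S₁ - + 2 * S₂ + S₀
        ≡⟨ cong₂ (λ x y → + 2 * x - + 2 * y + S₀) s₁ s₂ ⟩
      + 2 * (a₁ + (b₁ + t₁)) - + 2 * (a₂ + b₂) + S₀
        ≡⟨ cong (λ x → + 2 * (a₁ + (b₁ + t₁)) - + 2 * (a₂ + b₂) + x) s₀ ⟩
      + 2 * (a₁ + (b₁ + t₁)) - + 2 * (a₂ + b₂) + (b₀ + (b₀ + t₀))
        ≡⟨ combine a₁ a₂ a₁⁻ a₂⁻ b₁ b₂ b₀ t₁ t₀ (trans (sym sA) sA′) (trans (sym sB) sB′) ⟩
      + 2 * t₁ + t₀
        ≡⟨ cong₂ (λ x y → + 2 * x + y)
             (∑-bij T₁⁰≅Diagonal (zeroPart T₁-enum third) (diagonals N) (λ { (_ , refl) → f-zero }))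
             (∑-bij T₀⁰≅Factor (zeroPart T₀-enum third³) (factors N) (λ { (_ , refl) → f-zero })) ⟩
      mass N ∎
      where
      open ≡-Reasoning
      third³ : ℤ³ → ℤ
      third³ (_ , _ , u) = u
      l₁ l₂ l₃ : ℤ⁴ → ℤ
      l₁ (j , d , u , h) = d - + 2 * h
      l₂ (j , d , g , h) = + 2 * g - j
      l₃ (s , d , g , t) = t
      F = f ∘ third
      a₁ = ∑ (posPart A-enum l₁) F
      a₁⁻ = ∑ (negPart A-enum l₁) F
      a₂ = ∑ (posPart A-enum l₂) F
      a₂⁻ = ∑ (negPart A-enum l₂) F
      b₁ = ∑ (posPart B-enum l₃) F
      b₂ = ∑ (posPart B-enum l₂) F
      b₀ = ∑ (zeroPart B-enum l₃) F
      t₁ = ∑ (zeroPart T₁-enum third) F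
      t₀ = ∑ (zeroPart T₀-enum third³) (f ∘ third³)
      s₁ : S₁ ≡ a₁ + (b₁ + t₁)
      s₁ = trans (∑-sign T₁-enum third F)
        (cong₂ _+_ (∑-bij T₁⁺≅A⁺ (posPart T₁-enum third) (posPart A-enum l₁) (λ _ → refl))
          (cong (_+ t₁) (∑-bij T₁⁻≅B⁺ (negPart T₁-enum third) (posPart B-enum l₃) (λ {a} _ → sym (f-even (third a))))))
      s₂ : S₂ ≡ a₂ + b₂
      -- The boundary `d = 2h` is empty because it would make every term even, whereas `N` is odd.
      -- The boundaries in `sA`, `sA′` and `sB′` are excluded in the same way.
      s₂ = trans (∑-sign≢0 T₂-enum l₁ F (λ {(j , d , u , h)} (_ , _ , _ , _ , q) z → odd≢even {m = m} (trans (eq j d u h (e u)) (trans (cong (λ x → j * x + + 2 * (+ 2 * (u * h)) + + 2 * e u) (sym z)) (trans (eq′ j d u h (e u)) q)))))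
        (cong₂ _+_ (∑-bij T₂⁺≅A⁺ (posPart T₂-enum l₁) (posPart A-enum l₂) (λ _ → refl))
                   (∑-bij T₂⁻≅B⁺ (negPart T₂-enum l₁) (posPart B-enum l₂) (λ _ → refl)))
        where
        eq : ∀ j d u h E → + 2 * (+ 2 * (u * h) + E) ≡ j * 0ℤ + + 2 * (+ 2 * (u * h)) + + 2 * E
        eq = solve-∀
        eq′ : ∀ j d u h E → j * (d - + 2 * h) + + 2 * (+ 2 * (u * h)) + + 2 * E ≡ j * d + + 2 * ((+ 2 * u - j) * h) + + 2 * E
        eq′ = solve-∀
      s₀ : S₀ ≡ b₀ + (b₀ + t₀)
      s₀ = trans (∑-sign T₀-enum third³ (f ∘ third³))
        (cong₂ _+_ pos (cong (_+ t₀) (trans (∑-bij T₀⁻≅T₀⁺ (negPart T₀-enum third³) (posPart T₀-enum third³) (λ {a} _ → sym (f-even (third³ a)))) pos)))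
        where
        pos = sym (∑-bij B⁰≅T₀⁺ (zeroPart B-enum l₃) (posPart T₀-enum third³) (λ _ → refl))
      sA : ∑ A-enum F ≡ a₁ + a₁⁻
      sA = ∑-sign≢0 A-enum l₁ F (λ {(j , d , g , h)} (_ , _ , _ , _ , q) z → odd≢even {m = m} (trans (eq j d g h (e g)) (trans (cong (λ x → j * x + + 2 * (j * h) + + 4 * (g * h) + + 2 * e g) (sym z)) (trans (eq′ j d g h (e g)) q))))
        where
        eq : ∀ j d g h E → + 2 * (j * h + + 2 * (g * h) + E) ≡ j * 0ℤ + + 2 * (j * h) + + 4 * (g * h) + + 2 * E
        eq = solve-∀
        eq′ : ∀ j d g h E → j * (d - + 2 * h) + + 2 * (j * h) + + 4 * (g * h) + + 2 * E ≡ j * d + + 4 * (g * h) + + 2 * E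
        eq′ = solve-∀
      sA′ : ∑ A-enum F ≡ a₂ + a₂⁻
      sA′ = ∑-sign≢0 A-enum l₂ F (λ {(j , d , g , h)} (_ , _ , _ , _ , q) z → odd≢even {m = m} (trans (eq j d g h (e g)) (trans (cong (λ x → - x * d + + 2 * (g * d) + + 4 * (g * h) + + 2 * e g) (sym z)) (trans (eq′ j d g h (e g)) q))))
        where
        eq : ∀ j d g h E → + 2 * (g * d + + 2 * (g * h) + E) ≡ - 0ℤ * d + + 2 * (g * d) + + 4 * (g * h) + + 2 * E
        eq = solve-∀
        eq′ : ∀ j d g h E → - (+ 2 * g - j) * d + + 2 * (g * d) + + 4 * (g * h) + + 2 * E ≡ j * d + + 4 * (g * h) + + 2 * E
        eq′ = solve-∀
      sB : ∑ B-enum F ≡ b₁ + (a₂⁻ + b₀)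
      sB = trans (∑-sign B-enum l₃ F) (cong (λ x → b₁ + (x + b₀)) (sym (∑-bij A⁻≅B⁻ (negPart A-enum l₂) (negPart B-enum l₃) (λ _ → refl))))
      sB′ : ∑ B-enum F ≡ b₂ + a₁⁻
      sB′ = trans (∑-sign≢0 B-enum l₂ F (λ {(s , d , g , t)} (_ , _ , _ , _ , q) z → odd≢even {m = m} (trans (eq s d g t (e g)) (trans (cong (λ x → - x * (d + + 2 * t) + + 2 * (g * (d + + 2 * t)) + + 2 * (g * d) + + 2 * e g) (sym z)) (trans (eq′ s d g t (e g)) q)))))
        (cong (λ x → b₂ + x) (sym (∑-bij A⁻≅B⁻′ (negPart A-enum l₁) (negPart B-enum l₂) (λ _ → refl))))
        where
        eq : ∀ s d g t E → + 2 * (g * (d + + 2 * t) + g * d + E) ≡ - 0ℤ * (d + + 2 * t) + + 2 * (g * (d + + 2 * t)) + + 2 * (g * d) + + 2 * E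
        eq = solve-∀
        eq′ : ∀ s d g t E → - (+ 2 * g - s) * (d + + 2 * t) + + 2 * (g * (d + + 2 * t)) + + 2 * (g * d) + + 2 * E ≡ s * (d + + 2 * t) + + 2 * (g * d) + + 2 * E
        eq′ = solve-∀
      combine : ∀ a₁ a₂ a₁⁻ a₂⁻ b₁ b₂ b₀ t₁ t₀ → a₁ + a₁⁻ ≡ a₂ + a₂⁻ → b₁ + (a₂⁻ + b₀) ≡ b₂ + a₁⁻ →
                + 2 * (a₁ + (b₁ + t₁)) - + 2 * (a₂ + b₂) + (b₀ + (b₀ + t₀)) ≡ + 2 * t₁ + t₀
      combine a₁ a₂ a₁⁻ a₂⁻ b₁ b₂ b₀ t₁ t₀ p q = begin
        + 2 * (a₁ + (b₁ + t₁)) - + 2 * (a₂ + b₂) + (b₀ + (b₀ + t₀))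
          ≡⟨ eq₁ a₁ a₂ a₁⁻ a₂⁻ b₁ b₂ b₀ t₁ t₀ ⟩
        + 2 * (a₁ + a₁⁻) + + 2 * (b₁ + (a₂⁻ + b₀)) - + 2 * (a₂ + a₂⁻) - + 2 * (b₂ + a₁⁻) + (+ 2 * t₁ + t₀)
          ≡⟨ cong₂ (λ x y → + 2 * x + + 2 * y - + 2 * (a₂ + a₂⁻) - + 2 * (b₂ + a₁⁻) + (+ 2 * t₁ + t₀)) p q ⟩
        + 2 * (a₂ + a₂⁻) + + 2 * (b₂ + a₁⁻) - + 2 * (a₂ + a₂⁻) - + 2 * (b₂ + a₁⁻) + (+ 2 * t₁ + t₀)
          ≡⟨ eq₂ (a₂ + a₂⁻) (b₂ + a₁⁻) t₁ t₀ ⟩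
        + 2 * t₁ + t₀ ∎
        where
        eq₁ : ∀ a₁ a₂ a₁⁻ a₂⁻ b₁ b₂ b₀ t₁ t₀ → + 2 * (a₁ + (b₁ + t₁)) - + 2 * (a₂ + b₂) + (b₀ + (b₀ + t₀)) ≡
              + 2 * (a₁ + a₁⁻) + + 2 * (b₁ + (a₂⁻ + b₀)) - + 2 * (a₂ + a₂⁻) - + 2 * (b₂ + a₁⁻) + (+ 2 * t₁ + t₀)
        eq₁ = solve-∀
        eq₂ : ∀ x y t₁ t₀ → + 2 * x + + 2 * y - + 2 * x - + 2 * y + (+ 2 * t₁ + t₀) ≡ + 2 * t₁ + t₀
        eq₂ = solve-∀

-- Solution sets fibred over an integer parameter

Box : ℕ → ℤ → Set
Box n k = ∣ k ∣ ℕ.≤ n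

box : ∀ n → Enum (Box n)
box n = enum¹ n (λ k → ∣ k ∣ ℕ.≤? n) (λ b → b)

module _ {B : Set} {Q : ℤ → B → Set} (n : ℕ) (F : ∀ k → Enum (Q k)) (bound : ∀ {k b} → Q k b → Box n k) where

  fibred : Enum (λ (p : ℤ × B) → Q (proj₁ p) (proj₂ p))
  fibred = record
    { list = list S ; unique = unique S ; sound = λ m → proj₂ (sound S m) ; complete = λ q → complete S (bound q , q) }
    where S = sigma F (box n)

  -- A sum over `k` of fibre counts becomes one count over pairs, to which bijections mixing `k`
  -- with the other coordinates apply. The box contains every `k` with a nonempty fibre.
  ∑-fibred : (w : ℤ × B → ℤ) → ∑ fibred w ≡ ∑ (box n) (λ k → ∑ (F k) (λ b → w (k , b)))
  ∑-fibred = ∑-sigma F (box n)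

move : ∀ {x y N} → x + y ≡ N → x ≡ N - y
move {x} {y} refl = x≡[x+y]-y x y

unmove : ∀ {x y N} → x ≡ N - y → x + y ≡ N
unmove {_} {y} {N} refl = [x-y]+y≡x N y

-- c₂ m counts the solutions of λμ + μν + νλ = 2m with λ = 2l and μ = 2p even, those with lp = 0 having weight 1/2.

Triple : ℤ → ℤ³ → Set
Triple m (l , p , v) = Pos l × Pos p × Pos v × + 2 * (l * p) + v * (l + p) ≡ m

triples : ∀ m → Enum (Triple m)
triples m = enum³ ∣ m ∣ (λ (l , p , v) → Pos? l ×-dec Pos? p ×-dec Pos? v ×-dec (_ ≟ m))
  λ {l} {p} {v} (pl , pp , pv , q) →
    let r = pos⇒nonneg (pos-* pv (pos-+ pl pp)) ; r′ = pos⇒nonneg (pos-double (pos-* pl pp)) in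
    bound-factorˡ pl (pos-double pp) r (trans (eq₁ l p v) q) ,
    bound-factorʳ (pos-double pl) pp r (trans (eq₂ l p v) q) ,
    bound-factorˡ pv (pos-+ pl pp) r′ (trans (ℤₚ.+-comm (v * (l + p)) _) q)
  where
  eq₁ : ∀ l p v → l * (+ 2 * p) + v * (l + p) ≡ + 2 * (l * p) + v * (l + p)
  eq₁ = solve-∀
  eq₂ : ∀ l p v → + 2 * l * p + v * (l + p) ≡ + 2 * (l * p) + v * (l + p)
  eq₂ = solve-∀

c₂ : ℤ → ℤ
c₂ m = count (triples m) + count (factors m)

square : ℤ → ℤ
square u = u * u

neg-sq : ∀ u → - u * - u ≡ u * u
neg-sq = solve-∀

-- With j = l + p and u = k - l, 2lp + v(l + p) + 2k² becomes jv + 2(j + 2u)l + 2u².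
module EvenRelation (m : ℤ) where

  open Liouville m square (λ _ → 1ℤ) nonneg-sq neg-sq (λ _ → refl)

  Y : ℤ⁴ → Set
  Y (k , t) = Triple (N - + 2 * (k * k)) t

  Y₀ : ℤ³ → Set
  Y₀ (k , t) = Factor (N - + 2 * (k * k)) t

  private
    bound-k : ∀ {k r} → 0ℤ ≤ r → r ≡ N - + 2 * (k * k) → Box ∣ N ∣ k
    bound-k {k} {r} hr q = bound-sq {k} {N = N} (nonneg-+ hr (nonneg-sq k)) (trans (x²+[y+x²]≡y+2x² k r) (unmove {r} {+ 2 * (k * k)} {N} q))

    bound-Y : ∀ {k t} → Y (k , t) → Box ∣ N ∣ k
    bound-Y {k} (pl , pp , pv , q) = bound-k {k} (nonneg-+ (pos⇒nonneg (pos-double (pos-* pl pp))) (pos⇒nonneg (pos-* pv (pos-+ pl pp)))) q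

    bound-Y₀ : ∀ {k t} → Y₀ (k , t) → Box ∣ N ∣ k
    bound-Y₀ {k} (pj , pd , q) = bound-k {k} (pos⇒nonneg (pos-* pj pd)) q

    F : ∀ k → Enum (Triple (N - + 2 * (k * k)))
    F k = triples (N - + 2 * (k * k))

    F₀ : ∀ k → Enum (Factor (N - + 2 * (k * k)))
    F₀ k = factors (N - + 2 * (k * k))

  Y-enum : Enum Y
  Y-enum = fibred ∣ N ∣ F (λ {k} {t} → bound-Y {k} {t})

  Y₀-enum : Enum Y₀
  Y₀-enum = fibred ∣ N ∣ F₀ (λ {k} {t} → bound-Y₀ {k} {t})

  lY : ℤ⁴ → ℤ
  lY (k , l , p , v) = + 2 * k + p - l

  l₁ : ℤ⁴ → ℤ
  l₁ (j , d , u , h) = j - h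

  l⁻ l⁺ : ℤ³ → ℤ
  l⁻ (k , p , v) = p - + 2 * k
  l⁺ (k , p , v) = p + + 2 * k

  Y⁺≅T₁⁺ : (λ a → Y a × Pos (lY a)) ≅ (λ a → T₁ a × Pos (l₁ a))
  Y⁺≅T₁⁺ = record
    { to      = λ (k , l , p , v) → l + p , v , k - l , l
    ; from    = λ (j , d , u , h) → u + h , h , j - h , d
    ; to-∈    = λ {(k , l , p , v)} ((pl , pp , pv , q) , ps) →
        (pos-+ pl pp , pv , pl , pos≡ ps (eq₁ k l p) , trans (eq₂ k l p v) (unmove {y = + 2 * (k * k)} q)) , pos≡ pp (eq₃ l p)
    ; from-∈  = λ {(j , d , u , h)} ((pj , pd , ph , ps , q) , pr) →
        (ph , pr , pd , move {y = + 2 * ((u + h) * (u + h))} (trans (eq₄ j d u h) q)) , pos≡ ps (eq₅ j u h)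
    ; from-to = λ {(k , l , p , v)} _ → tuple⁴ ([x-y]+y≡x k l) refl (sym (eq₃ l p)) refl
    ; to-from = λ {(j , d , u , h)} _ → tuple⁴ (eq₇ j h) refl ([x+y]-y≡x u h) refl
    }
    where
    eq₁ : ∀ k l p → + 2 * k + p - l ≡ l + p + + 2 * (k - l)
    eq₁ = solve-∀
    eq₂ : ∀ k l p v → (l + p) * v + + 2 * ((l + p + + 2 * (k - l)) * l) + + 2 * ((k - l) * (k - l)) ≡ + 2 * (l * p) + v * (l + p) + + 2 * (k * k)
    eq₂ = solve-∀
    eq₃ : ∀ l p → p ≡ l + p - l
    eq₃ = solve-∀
    eq₄ : ∀ j d u h → + 2 * (h * (j - h)) + d * (h + (j - h)) + + 2 * ((u + h) * (u + h)) ≡ j * d + + 2 * ((j + + 2 * u) * h) + + 2 * (u * u)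
    eq₄ = solve-∀
    eq₅ : ∀ j u h → j + + 2 * u ≡ + 2 * (u + h) + (j - h) - h
    eq₅ = solve-∀
    eq₇ : ∀ j h → h + (j - h) ≡ j
    eq₇ = solve-∀

  Y⁻≅Y⁺ : (λ a → Y a × Pos (- lY a)) ≅ (λ a → Y a × Pos (lY a))
  Y⁻≅Y⁺ = record
    { to      = λ (k , l , p , v) → - k , p , l , v
    ; from    = λ (k , l , p , v) → - k , p , l , v
    ; to-∈    = λ {(k , l , p , v)} ((pl , pp , pv , q) , ps) → (pp , pl , pv , equation k l p v q) , pos≡ ps (eq₁ k l p)
    ; from-∈  = λ {(k , l , p , v)} ((pl , pp , pv , q) , ps) → (pp , pl , pv , equation k l p v q) , pos≡ ps (eq₂ k l p)
    ; from-to = λ {(k , l , p , v)} _ → tuple⁴ (ℤₚ.neg-involutive k) refl refl refl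
    ; to-from = λ {(k , l , p , v)} _ → tuple⁴ (ℤₚ.neg-involutive k) refl refl refl
    }
    where
    eq₁ : ∀ k l p → - (+ 2 * k + p - l) ≡ + 2 * - k + l - p
    eq₁ = solve-∀
    eq₂ : ∀ k l p → + 2 * k + p - l ≡ - (+ 2 * - k + l - p)
    eq₂ = solve-∀
    eq₃ : ∀ k l p v → + 2 * (p * l) + v * (p + l) + + 2 * (- k * - k) ≡ + 2 * (l * p) + v * (l + p) + + 2 * (k * k)
    eq₃ = solve-∀
    equation : ∀ k l p v → + 2 * (l * p) + v * (l + p) ≡ N - + 2 * (k * k) → + 2 * (p * l) + v * (p + l) ≡ N - + 2 * (- k * - k)
    equation k l p v q = move {y = + 2 * (- k * - k)} {N} (trans (eq₃ k l p v) (unmove {y = + 2 * (k * k)} {N} q))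

  T₁⁰≅Y₀⁻ : (λ a → T₁ a × l₁ a ≡ 0ℤ) ≅ (λ a → Y₀ a × Pos (- l⁻ a))
  T₁⁰≅Y₀⁻ = record
    { to      = λ (j , d , u , h) → u + j , j , d
    ; from    = λ (k , p , v) → p , v , k - p , p
    ; to-∈    = λ {(j , d , u , h)} ((pj , pd , ph , ps , q) , z) → let h≡j = sym (ℤₚ.i-j≡0⇒i≡j j h z) in
        (pj , pd , move {y = + 2 * ((u + j) * (u + j))} (trans (eq₁ j d u) (trans (cong (λ x → j * d + + 2 * ((j + + 2 * u) * x) + + 2 * (u * u)) (sym h≡j)) q))) , pos≡ ps (x+2y≡-[x-2[y+x]] j u)
    ; from-∈  = λ {(k , p , v)} ((pp , pv , q) , ps) →
        (pp , pv , pp , pos≡ ps (eq₃ k p) , trans (eq₄ k p v) (unmove {y = + 2 * (k * k)} q)) , ℤₚ.+-inverseʳ p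
    ; from-to = λ {(j , d , u , h)} (_ , z) → tuple⁴ refl refl ([x+y]-y≡x u j) (ℤₚ.i-j≡0⇒i≡j j h z)
    ; to-from = λ {(k , p , v)} _ → tuple³ ([x-y]+y≡x k p) refl refl
    }
    where
    eq₁ : ∀ j d u → j * d + + 2 * ((u + j) * (u + j)) ≡ j * d + + 2 * ((j + + 2 * u) * j) + + 2 * (u * u)
    eq₁ = solve-∀
    eq₃ : ∀ k p → - (p - + 2 * k) ≡ p + + 2 * (k - p)
    eq₃ = solve-∀
    eq₄ : ∀ k p v → p * v + + 2 * ((p + + 2 * (k - p)) * p) + + 2 * ((k - p) * (k - p)) ≡ p * v + + 2 * (k * k)
    eq₄ = solve-∀

  -- Raising `u` by `j` turns `(s - j)/2` into `(s + j)/2` with `s` fixed. The square of `u` grows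
  -- by `j * s`, which lowering `h` by `j` compensates; this is why `e` is taken to be the square.
  T₁⁻≅T₂ : (λ a → T₁ a × Pos (- l₁ a)) ≅ T₂
  T₁⁻≅T₂ = record
    { to      = λ (j , d , u , h) → j , d , u + j , - (j - h)
    ; from    = λ (j , d , u , h) → j , d , u - j , h + j
    ; to-∈    = λ {(j , d , u , h)} ((pj , pd , ph , ps , q) , pr) →
        pj , pd , pr , pos≡ ps (x+2y≡2[y+x]-x j u) , trans (eq₂ j d u h) q
    ; from-∈  = λ {(j , d , u , h)} (pj , pd , ph , ps , q) →
        (pj , pd , pos-+ ph pj , pos≡ ps (2y-x≡x+2[y-x] j u) , trans (eq₄ j d u h) q) , pos≡ ph (eq₅ j h)
    ; from-to = λ {(j , d , u , h)} _ → tuple⁴ refl refl ([x+y]-y≡x u j) (eq₇ j h)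
    ; to-from = λ {(j , d , u , h)} _ → tuple⁴ refl refl ([x-y]+y≡x u j) (sym (eq₅ j h))
    }
    where
    eq₂ : ∀ j d u h → j * d + + 2 * ((+ 2 * (u + j) - j) * - (j - h)) + + 2 * ((u + j) * (u + j)) ≡ j * d + + 2 * ((j + + 2 * u) * h) + + 2 * (u * u)
    eq₂ = solve-∀
    eq₄ : ∀ j d u h → j * d + + 2 * ((j + + 2 * (u - j)) * (h + j)) + + 2 * ((u - j) * (u - j)) ≡ j * d + + 2 * ((+ 2 * u - j) * h) + + 2 * (u * u)
    eq₄ = solve-∀
    eq₅ : ∀ j h → h ≡ - (j - (h + j))
    eq₅ = solve-∀
    eq₇ : ∀ j h → - (j - h) + j ≡ h
    eq₇ = solve-∀

  Y₀⁺≅T₀ : (λ a → (Y₀ a × Pos (l⁻ a)) × Pos (l⁺ a)) ≅ T₀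
  Y₀⁺≅T₀ = record
    { to      = λ (k , p , v) → p , v , k
    ; from    = λ (j , d , u) → u , j , d
    ; to-∈    = λ {(k , p , v)} (((pp , pv , q) , p⁻) , p⁺) → pp , pv , p⁺ , p⁻ , unmove {y = + 2 * (k * k)} q
    ; from-∈  = λ {(j , d , u)} (pj , pd , p⁺ , p⁻ , q) → ((pj , pd , move {y = + 2 * (u * u)} q) , p⁻) , p⁺
    ; from-to = λ _ → refl
    ; to-from = λ _ → refl
    }

  Y₀⁻≅Y₀⁻ : (λ a → (Y₀ a × Pos (l⁻ a)) × Pos (- l⁺ a)) ≅ (λ a → Y₀ a × Pos (- l⁻ a))
  Y₀⁻≅Y₀⁻ = record
    { to      = λ (k , p , v) → - k , p , v
    ; from    = λ (k , p , v) → - k , p , v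
    ; to-∈    = λ {(k , p , v)} (((pp , pv , q) , _) , p⁺) → (pp , pv , equation k p v q) , pos≡ p⁺ (cong -_ (eq₁ k p))
    ; from-∈  = λ {(k , p , v)} ((pp , pv , q) , p⁻) →
        ((pp , pv , equation k p v q) , pos≡ (pos-+ (pos-double pp) p⁻) (eq₂ k p)) , pos≡ p⁻ (cong -_ (eq₃ k p))
    ; from-to = λ {(k , p , v)} _ → tuple³ (ℤₚ.neg-involutive k) refl refl
    ; to-from = λ {(k , p , v)} _ → tuple³ (ℤₚ.neg-involutive k) refl refl
    }
    where
    eq₁ : ∀ k p → p + + 2 * k ≡ p - + 2 * - k
    eq₁ = solve-∀
    eq₂ : ∀ k p → + 2 * p + - (p - + 2 * k) ≡ p - + 2 * - k
    eq₂ = solve-∀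
    eq₃ : ∀ k p → p - + 2 * k ≡ p + + 2 * - k
    eq₃ = solve-∀
    eq₄ : ∀ k → + 2 * (k * k) ≡ + 2 * (- k * - k)
    eq₄ = solve-∀
    equation : ∀ k p v → p * v ≡ N - + 2 * (k * k) → p * v ≡ N - + 2 * (- k * - k)
    equation k p v q = trans q (cong (λ x → N - x) (eq₄ k))

  -- Let `y` count the part `h < j` of `T₁`, and `z` the part `p < 2k` of `Y₀`. The symmetry
  -- `(k, l, p)` to `(-k, p, l)` gives `Y = 2y`. In `Y₀` the range `|2k| < p` is `T₀`, and the two
  -- outer ranges have `z` elements each. Comparing `j` with `h` in `T₁` gives `S₁ = y + S₂ + z`.
  -- Hence `Y + Y₀ = 2S₁ - 2S₂ + S₀`.
  even-relation : ∑ (box ∣ N ∣) (λ k → c₂ (N - + 2 * (k * k))) ≡ mass N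
  even-relation = begin
    ∑ (box ∣ N ∣) (λ k → c₂ (N - + 2 * (k * k)))
      ≡⟨ ∑-+ (box ∣ N ∣) (count ∘ F) (count ∘ F₀) ⟩
    ∑ (box ∣ N ∣) (count ∘ F) + ∑ (box ∣ N ∣) (count ∘ F₀)
      ≡⟨ cong₂ _+_ (∑-fibred ∣ N ∣ F (λ {k} {t} → bound-Y {k} {t}) one) (∑-fibred ∣ N ∣ F₀ (λ {k} {t} → bound-Y₀ {k} {t}) one) ⟨
    count Y-enum + count Y₀-enum
      ≡⟨ cong₂ _+_ sY sY₀ ⟩
    (y + y) + ((S₀ + z) + z)
      ≡⟨ combine y z (S₂) (S₀) ⟩
    + 2 * (y + (S₂ + z)) - + 2 * S₂ + S₀
      ≡⟨ cong (λ x → + 2 * x - + 2 * S₂ + S₀) s₁ ⟨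
    + 2 * S₁ - + 2 * S₂ + S₀
      ≡⟨ liouville refl refl ⟩
    mass N ∎
    where
    open ≡-Reasoning
    one : {A : Set} → A → ℤ
    one _ = 1ℤ
    y = ∑ (posPart T₁-enum l₁) one
    z = ∑ (negPart Y₀-enum l⁻) one
    Y₀⁺ = posPart Y₀-enum l⁻
    yT = ∑-bij Y⁺≅T₁⁺ (posPart Y-enum lY) (posPart T₁-enum l₁) {v = one} (λ _ → refl)
    sY : count Y-enum ≡ y + y
    sY = trans (∑-sign≢0 Y-enum lY one (λ {(k , l , p , v)} (_ , _ , _ , q) z → odd≢even {m = m}
           (trans (eq₁ k l p v) (trans (cong (λ x → + 2 * (l * p) + v * (+ 2 * k + + 2 * p - x) + + 2 * (k * k)) (sym z)) (trans (eq₂ k l p v) (unmove {y = + 2 * (k * k)} q))))))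
      (cong₂ _+_ yT (trans (∑-bij Y⁻≅Y⁺ (negPart Y-enum lY) (posPart Y-enum lY) (λ _ → refl)) yT))
      where
      eq₁ : ∀ k l p v → + 2 * (l * p + v * (k + p) + k * k) ≡ + 2 * (l * p) + v * (+ 2 * k + + 2 * p - 0ℤ) + + 2 * (k * k)
      eq₁ = solve-∀
      eq₂ : ∀ k l p v → + 2 * (l * p) + v * (+ 2 * k + + 2 * p - (+ 2 * k + p - l)) + + 2 * (k * k) ≡ + 2 * (l * p) + v * (l + p) + + 2 * (k * k)
      eq₂ = solve-∀
    parity : ∀ p v k x → + 2 * x ≡ p → p * v ≡ N - + 2 * (k * k) → ⊥
    parity p v k x refl q = odd≢even {x * v + k * k} {m} (trans (eq x v k) (unmove {y = + 2 * (k * k)} q))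
      where
      eq : ∀ x v k → + 2 * (x * v + k * k) ≡ + 2 * x * v + + 2 * (k * k)
      eq = solve-∀
    sY₀ : count Y₀-enum ≡ (S₀ + z) + z
    sY₀ = trans (∑-sign≢0 Y₀-enum l⁻ one (λ {(k , p , v)} (_ , _ , q) e → parity p v k k (sym (ℤₚ.i-j≡0⇒i≡j p _ e)) q))
      (cong (_+ z) (trans (∑-sign≢0 Y₀⁺ l⁺ one (λ {(k , p , v)} ((_ , _ , q) , _) e → parity p v k (- k) (sym (ℤₚ.i-j≡0⇒i≡j p _ (trans (eq k p) e))) q))
        (cong₂ _+_ (∑-bij Y₀⁺≅T₀ (posPart Y₀⁺ l⁺) T₀-enum (λ _ → refl))
                   (∑-bij Y₀⁻≅Y₀⁻ (negPart Y₀⁺ l⁺) (negPart Y₀-enum l⁻) (λ _ → refl)))))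
      where
      eq : ∀ k p → p - + 2 * - k ≡ p + + 2 * k
      eq = solve-∀
    s₁ : S₁ ≡ y + (S₂ + z)
    s₁ = trans (∑-sign T₁-enum l₁ one) (+-congʳ y (cong₂ _+_
      (∑-bij T₁⁻≅T₂ (negPart T₁-enum l₁) T₂-enum (λ _ → refl))
      (∑-bij T₁⁰≅Y₀⁻ (zeroPart T₁-enum l₁) (negPart Y₀-enum l⁻) (λ _ → refl))))
    combine : ∀ y z s₂ s₀ → (y + y) + ((s₀ + z) + z) ≡ + 2 * (y + (s₂ + z)) - + 2 * s₂ + s₀
    combine = solve-∀

-- Parity

parity : ∀ x → ∃ λ y → x ≡ + 2 * y ⊎ x ≡ 1ℤ + + 2 * y
parity (+ n) = natural n
  where
  natural : ∀ n → ∃ λ y → + n ≡ + 2 * y ⊎ + n ≡ 1ℤ + + 2 * y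
  natural zero = 0ℤ , inj₁ refl
  natural (suc n) with natural n
  ... | y , inj₁ e = y , inj₂ (cong (λ x → 1ℤ + x) e)
  ... | y , inj₂ e = 1ℤ + y , inj₁ (trans (cong (λ x → 1ℤ + x) e) (eq y))
    where
    eq : ∀ y → 1ℤ + (1ℤ + + 2 * y) ≡ + 2 * (1ℤ + y)
    eq = solve-∀
parity -[1+ n ] with parity (+ n)
... | y , inj₁ e = -1ℤ - y , inj₂ (trans (neg n) (trans (cong (λ x → -1ℤ - x) e) (eq y)))
  where
  neg : ∀ n → -[1+ n ] ≡ -1ℤ - + n
  neg zero    = refl
  neg (suc n) = refl
  eq : ∀ y → -1ℤ - + 2 * y ≡ 1ℤ + + 2 * (-1ℤ - y)
  eq = solve-∀
... | y , inj₂ e = -1ℤ - y , inj₁ (trans (neg n) (trans (cong (λ x → -1ℤ - x) e) (eq y)))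
  where
  neg : ∀ n → -[1+ n ] ≡ -1ℤ - + n
  neg zero    = refl
  neg (suc n) = refl
  eq : ∀ y → -1ℤ - (1ℤ + + 2 * y) ≡ + 2 * (-1ℤ - y)
  eq = solve-∀

half : ℤ → ℤ
half x = proj₁ (parity x)

cancel-double : ∀ {x y} → + 2 * x ≡ + 2 * y → x ≡ y
cancel-double {x} {y} = ℤₚ.*-cancelˡ-≡ (+ 2) x y

half-double : ∀ x → half (+ 2 * x) ≡ x
half-double x with parity (+ 2 * x)
... | y , inj₁ e = sym (cancel-double e)
... | y , inj₂ e = ⊥-elim (odd≢even {x} {y} e)

even-half : ∀ {x y} → x ≡ + 2 * y → + 2 * half x ≡ x
even-half {y = y} refl = cong (λ z → + 2 * z) (half-double y)

-- k² ≡ l² (mod 2) forces k ≡ l (mod 2).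
half-diff : ∀ k l y → k * k ≡ l * l + + 2 * y → + 2 * half (l - k) ≡ l - k
half-diff k l y e with parity (l - k)
... | z , inj₁ p = sym p
... | z , inj₂ p = ⊥-elim (odd≢even { - y} {z + + 2 * (z * k) + + 2 * (z * z) + k + z}
  (trans (eq₁ l y) (trans (cong (λ x → l * l - x) (sym e)) (trans (eq₂ k l) (trans (cong (λ x → x * (x + + 2 * k)) p) (eq₃ k z))))))
  where
  eq₁ : ∀ l y → + 2 * - y ≡ l * l - (l * l + + 2 * y)
  eq₁ = solve-∀
  eq₂ : ∀ k l → l * l - k * k ≡ (l - k) * (l - k + + 2 * k)
  eq₂ = solve-∀
  eq₃ : ∀ k z → (1ℤ + + 2 * z) * (1ℤ + + 2 * z + + 2 * k) ≡ 1ℤ + + 2 * (z + + 2 * (z * k) + + 2 * (z * z) + k + z)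
  eq₃ = solve-∀

-- c₁ n is twice the number of solutions of λμ + μν + νλ = n with λ = l, λ + μ = 2J and ν = 2h, those with h = 0 having weight 1/2.

OddTriple : ℤ → ℤ³ → Set
OddTriple n (l , J , h) = Pos l × Pos (+ 2 * J - l) × Pos h × l * (+ 2 * J - l) + + 4 * (h * J) ≡ n

OddPair : ℤ → ℤ² → Set
OddPair n (l , J) = Pos l × Pos (+ 2 * J - l) × l * (+ 2 * J - l) ≡ n

mean-pos : ∀ {l J} → Pos l → Pos (+ 2 * J - l) → Pos J
mean-pos {l} {J} p q = pos-half (pos≡ (pos-+ p q) (x+[2y-x]≡2y l J))

bound-mean : ∀ {l J r n} → Pos l → Pos (+ 2 * J - l) → 0ℤ ≤ r → l * (+ 2 * J - l) + r ≡ n →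
             ∣ l ∣ ℕ.≤ ∣ n ∣ × ∣ J ∣ ℕ.≤ ∣ n ∣
bound-mean {l} {J} {r} {n} pl pm hr q = bl , ℕₚ.*-cancelˡ-≤ 2 (ℕₚ.≤-trans (subst (ℕ._≤ ∣ l ∣ ℕ.+ ∣ + 2 * J - l ∣)
    (trans (cong ∣_∣ (x+[2y-x]≡2y l J)) (ℤₚ.∣i*j∣≡∣i∣*∣j∣ (+ 2) J)) (ℤₚ.∣i+j∣≤∣i∣+∣j∣ l (+ 2 * J - l)))
    (subst (∣ l ∣ ℕ.+ ∣ + 2 * J - l ∣ ℕ.≤_) (cong (∣ n ∣ ℕ.+_) (sym (ℕₚ.+-identityʳ ∣ n ∣))) (ℕₚ.+-mono-≤ bl (bound-factorʳ pl pm hr q))))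
  where
  bl = bound-factorˡ pl pm hr q

oddTriples : ∀ n → Enum (OddTriple n)
oddTriples n = enum³ ∣ n ∣ (λ (l , J , h) → Pos? l ×-dec Pos? (+ 2 * J - l) ×-dec Pos? h ×-dec (_ ≟ n))
  λ {l} {J} {h} (pl , pm , ph , q) →
    let pJ = mean-pos {l} {J} pl pm
        (bl , bJ) = bound-mean {l} {J} pl pm (pos⇒nonneg (pos-* {+ 4} (+<+ (ℕ.s≤s ℕ.z≤n)) (pos-* ph pJ))) q
    in bl , bJ , bound-factorˡ ph (pos-double (pos-double pJ)) (pos⇒nonneg (pos-* pl pm)) (trans (eq l J h) q)
  where
  eq : ∀ l J h → h * (+ 2 * (+ 2 * J)) + l * (+ 2 * J - l) ≡ l * (+ 2 * J - l) + + 4 * (h * J)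
  eq = solve-∀

oddPairs : ∀ n → Enum (OddPair n)
oddPairs n = enum² ∣ n ∣ (λ (l , J) → Pos? l ×-dec Pos? (+ 2 * J - l) ×-dec (_ ≟ n))
  λ {l} {J} (pl , pm , q) → bound-mean {l} {J} pl pm ℤₚ.≤-refl (trans (ℤₚ.+-identityʳ _) q)

c₁ : ℤ → ℤ
c₁ n = + 2 * count (oddTriples n) + count (oddPairs n)

-- With j = k - l + J and l - k = 2u, l(2J - l) + 4hJ + k² becomes 2(jl + 2(j + 2u)h + 2u²).
module OddRelation (m : ℤ) where

  open Liouville m square (λ _ → 1ℤ) nonneg-sq neg-sq (λ _ → refl)

  N₂ : ℤ
  N₂ = + 2 * N

  Z : ℤ⁴ → Set
  Z (k , t) = OddTriple (N₂ - k * k) t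

  Z₀ : ℤ³ → Set
  Z₀ (k , t) = OddPair (N₂ - k * k) t

  private
    F : ∀ k → Enum (OddTriple (N₂ - k * k))
    F k = oddTriples (N₂ - k * k)

    F₀ : ∀ k → Enum (OddPair (N₂ - k * k))
    F₀ k = oddPairs (N₂ - k * k)

    bound-k : ∀ {k r} → 0ℤ ≤ r → r ≡ N₂ - k * k → Box ∣ N₂ ∣ k
    bound-k {k} {r} hr q = bound-sq {k} {N = N₂} hr (trans (ℤₚ.+-comm (k * k) r) (unmove {r} {k * k} {N₂} q))

    bound-Z : ∀ {k t} → Z (k , t) → Box ∣ N₂ ∣ k
    bound-Z {k} {l , J , h} (pl , pm , ph , q) =
      bound-k {k} (nonneg-+ (pos⇒nonneg (pos-* pl pm)) (pos⇒nonneg (pos-* {+ 4} (+<+ (ℕ.s≤s ℕ.z≤n)) (pos-* ph (mean-pos {l} {J} pl pm))))) q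

    bound-Z₀ : ∀ {k t} → Z₀ (k , t) → Box ∣ N₂ ∣ k
    bound-Z₀ {k} (pl , pm , q) = bound-k {k} (pos⇒nonneg (pos-* pl pm)) q

  Z-enum : Enum Z
  Z-enum = fibred ∣ N₂ ∣ F (λ {k} {t} → bound-Z {k} {t})

  Z₀-enum : Enum Z₀
  Z₀-enum = fibred ∣ N₂ ∣ F₀ (λ {k} {t} → bound-Z₀ {k} {t})

  W : ℤ³ → Set
  W (j , d , u) = Pos j × Pos d × Pos (j + + 2 * u) × j * d + + 2 * (u * u) ≡ N

  W-enum : Enum W
  W-enum = enum³ ∣ N ∣ (λ (j , d , u) → Pos? j ×-dec Pos? d ×-dec Pos? (j + + 2 * u) ×-dec (_ ≟ N))
    λ {j} {d} {u} (pj , pd , ps , q) → let r = nonneg-double (nonneg-sq u) in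
      bound-factorˡ pj pd r q , bound-factorʳ pj pd r q ,
      bound-sq {u} (nonneg-+ (pos⇒nonneg (pos-* pj pd)) (nonneg-sq u)) (trans (eq j d u) q)
    where
    eq : ∀ j d u → u * u + (j * d + u * u) ≡ j * d + + 2 * (u * u)
    eq = solve-∀

  lZ : ℤ⁴ → ℤ
  lZ (k , l , J , h) = k - l + J

  lZ₀ : ℤ³ → ℤ
  lZ₀ (k , l , J) = k - l + J

  l₁ : ℤ⁴ → ℤ
  l₁ (j , d , u , h) = + 2 * (j + + 2 * u) - d

  l₀ l₂ : ℤ³ → ℤ
  l₀ (j , d , u) = + 2 * (j + + 2 * u) - d
  l₂ (j , d , u) = j - + 2 * u

  private
    double-half : ∀ k l J r → l * (+ 2 * J - l) + + 4 * r ≡ N₂ - k * k → + 2 * half (l - k) ≡ l - k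
    double-half k l J r q = half-diff k l (N - l * J - + 2 * r) (trans (x²≡2y-[2y-x²] k N) (trans (cong (λ x → + 2 * N - x) (sym q)) (eq₂ l J r N)))
      where
      eq₂ : ∀ l J r N → + 2 * N - (l * (+ 2 * J - l) + + 4 * r) ≡ l * l + + 2 * (N - l * J - + 2 * r)
      eq₂ = solve-∀

    substituted : ∀ k l J h u → + 2 * u ≡ l - k → l * (+ 2 * J - l) + + 4 * (h * J) ≡ N₂ - k * k →
                  (k - l + J) * l + + 2 * (J * h) + + 2 * (u * u) ≡ N
    substituted k l J h u e q = cancel-double (trans (eq₁ k l J h u) (trans (cong (λ x → + 2 * ((k - l + J) * l) + + 4 * (h * J) + x * x) e)
      (trans (eq₂ k l J h) (unmove {y = k * k} q))))
      where
      eq₁ : ∀ k l J h u → + 2 * ((k - l + J) * l + + 2 * (J * h) + + 2 * (u * u)) ≡ + 2 * ((k - l + J) * l) + + 4 * (h * J) + + 2 * u * (+ 2 * u)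
      eq₁ = solve-∀
      eq₂ : ∀ k l J h → + 2 * ((k - l + J) * l) + + 4 * (h * J) + (l - k) * (l - k) ≡ l * (+ 2 * J - l) + + 4 * (h * J) + k * k
      eq₂ = solve-∀

    shift : ∀ k l J u → + 2 * u ≡ l - k → J ≡ k - l + J + + 2 * u
    shift k l J u e = trans (eq k l J) (cong (λ x → k - l + J + x) (sym e))
      where
      eq : ∀ k l J → J ≡ k - l + J + (l - k)
      eq = solve-∀

    unshift : ∀ k l u → + 2 * u ≡ l - k → l - + 2 * u ≡ k
    unshift k l u e = trans (cong (λ x → l - x) e) (eq k l)
      where
      eq : ∀ k l → l - (l - k) ≡ k
      eq = solve-∀

    half-back : ∀ d u → half (d - (d - + 2 * u)) ≡ u
    half-back d u = trans (cong half (x-[x-2y]≡2y d u)) (half-double u)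

    pair⇒triple : ∀ {l J n} → l * (+ 2 * J - l) ≡ n → l * (+ 2 * J - l) + + 4 * (0ℤ * J) ≡ n
    pair⇒triple {l} {J} q = trans (eq l J) q
      where
      eq : ∀ l J → l * (+ 2 * J - l) + + 4 * (0ℤ * J) ≡ l * (+ 2 * J - l)
      eq = solve-∀

  Z⁺≅T₁⁺ : (λ a → Z a × Pos (lZ a)) ≅ (λ a → T₁ a × Pos (l₁ a))
  Z⁺≅T₁⁺ = record
    { to      = λ (k , l , J , h) → k - l + J , l , half (l - k) , h
    ; from    = λ (j , d , u , h) → d - + 2 * u , d , j + + 2 * u , h
    ; to-∈    = λ {(k , l , J , h)} ((pl , pm , ph , q) , ps) →
        let e = double-half k l J (h * J) q ; J≡ = shift k l J (half (l - k)) e in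
        (ps , pl , ph , pos≡ (mean-pos {l} {J} pl pm) J≡ ,
         trans (cong (λ x → (k - l + J) * l + + 2 * (x * h) + + 2 * (half (l - k) * half (l - k))) (sym J≡)) (substituted k l J h (half (l - k)) e q)) ,
        pos≡ pm (cong (λ x → + 2 * x - l) J≡)
    ; from-∈  = λ {(j , d , u , h)} ((pj , pd , ph , ps , q) , pr) →
        (pd , pr , ph , move {y = (d - + 2 * u) * (d - + 2 * u)} (trans (eq₁ j d u h) (cong (λ x → + 2 * x) q))) , pos≡ pj (eq₂ j d u)
    ; from-to = λ {(k , l , J , h)} ((pl , pm , ph , q) , ps) →
        let e = double-half k l J (h * J) q in tuple⁴ (unshift k l (half (l - k)) e) refl (sym (shift k l J (half (l - k)) e)) refl
    ; to-from = λ {(j , d , u , h)} _ → tuple⁴ (sym (eq₂ j d u)) refl (half-back d u) refl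
    }
    where
    eq₁ : ∀ j d u h → d * (+ 2 * (j + + 2 * u) - d) + + 4 * (h * (j + + 2 * u)) + (d - + 2 * u) * (d - + 2 * u) ≡ + 2 * (j * d + + 2 * ((j + + 2 * u) * h) + + 2 * (u * u))
    eq₁ = solve-∀
    eq₂ : ∀ j d u → j ≡ d - + 2 * u - d + (j + + 2 * u)
    eq₂ = solve-∀

  Z₀⁺≅W⁺ : (λ a → Z₀ a × Pos (lZ₀ a)) ≅ (λ a → W a × Pos (l₀ a))
  Z₀⁺≅W⁺ = record
    { to      = λ (k , l , J) → k - l + J , l , half (l - k)
    ; from    = λ (j , d , u) → d - + 2 * u , d , j + + 2 * u
    ; to-∈    = λ {(k , l , J)} ((pl , pm , q) , ps) →
        let q′ = pair⇒triple {l} {J} q ; e = double-half k l J (0ℤ * J) q′ ; J≡ = shift k l J (half (l - k)) e in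
        (ps , pl , pos≡ (mean-pos {l} {J} pl pm) J≡ , trans (eq₀ (k - l + J) l J (half (l - k))) (substituted k l J 0ℤ (half (l - k)) e q′)) ,
        pos≡ pm (cong (λ x → + 2 * x - l) J≡)
    ; from-∈  = λ {(j , d , u)} ((pj , pd , ps , q) , pr) →
        (pd , pr , move {y = (d - + 2 * u) * (d - + 2 * u)} (trans (eq₁ j d u) (cong (λ x → + 2 * x) q))) , pos≡ pj (eq₂ j d u)
    ; from-to = λ {(k , l , J)} ((pl , pm , q) , ps) →
        let e = double-half k l J (0ℤ * J) (pair⇒triple {l} {J} q) in tuple³ (unshift k l (half (l - k)) e) refl (sym (shift k l J (half (l - k)) e))
    ; to-from = λ {(j , d , u)} _ → tuple³ (sym (eq₂ j d u)) refl (half-back d u)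
    }
    where
    eq₀ : ∀ j l J u → j * l + + 2 * (u * u) ≡ j * l + + 2 * (J * 0ℤ) + + 2 * (u * u)
    eq₀ = solve-∀
    eq₁ : ∀ j d u → d * (+ 2 * (j + + 2 * u) - d) + (d - + 2 * u) * (d - + 2 * u) ≡ + 2 * (j * d + + 2 * (u * u))
    eq₁ = solve-∀
    eq₂ : ∀ j d u → j ≡ d - + 2 * u - d + (j + + 2 * u)
    eq₂ = solve-∀

  private
    reflect : ∀ k l J r → l * (+ 2 * J - l) + r ≡ N₂ - k * k → (+ 2 * J - l) * (+ 2 * J - (+ 2 * J - l)) + r ≡ N₂ - - k * - k
    reflect k l J r q = trans (eq l J r) (trans q (cong (λ x → N₂ - x) (sym (neg-sq k))))
      where
      eq : ∀ l J r → (+ 2 * J - l) * (+ 2 * J - (+ 2 * J - l)) + r ≡ l * (+ 2 * J - l) + r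
      eq = solve-∀
    reflect-l : ∀ l J → + 2 * J - (+ 2 * J - l) ≡ l
    reflect-l = solve-∀
    reflect-s : ∀ k l J → - (k - l + J) ≡ - k - (+ 2 * J - l) + J
    reflect-s = solve-∀
    reflect-s′ : ∀ k l J → k - l + J ≡ - (- k - (+ 2 * J - l) + J)
    reflect-s′ = solve-∀
    add0 : ∀ {x y} → x + 0ℤ ≡ y → x ≡ y
    add0 {x} e = trans (sym (ℤₚ.+-identityʳ x)) e

  Z⁻≅Z⁺ : (λ a → Z a × Pos (- lZ a)) ≅ (λ a → Z a × Pos (lZ a))
  Z⁻≅Z⁺ = record
    { to      = λ (k , l , J , h) → - k , + 2 * J - l , J , h
    ; from    = λ (k , l , J , h) → - k , + 2 * J - l , J , h
    ; to-∈    = λ {(k , l , J , h)} ((pl , pm , ph , q) , ps) → (pm , pos≡ pl (sym (reflect-l l J)) , ph , reflect k l J (+ 4 * (h * J)) q) , pos≡ ps (reflect-s k l J)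
    ; from-∈  = λ {(k , l , J , h)} ((pl , pm , ph , q) , ps) → (pm , pos≡ pl (sym (reflect-l l J)) , ph , reflect k l J (+ 4 * (h * J)) q) , pos≡ ps (reflect-s′ k l J)
    ; from-to = λ {(k , l , J , h)} _ → tuple⁴ (ℤₚ.neg-involutive k) (reflect-l l J) refl refl
    ; to-from = λ {(k , l , J , h)} _ → tuple⁴ (ℤₚ.neg-involutive k) (reflect-l l J) refl refl
    }

  Z₀⁻≅Z₀⁺ : (λ a → Z₀ a × Pos (- lZ₀ a)) ≅ (λ a → Z₀ a × Pos (lZ₀ a))
  Z₀⁻≅Z₀⁺ = record
    { to      = λ (k , l , J) → - k , + 2 * J - l , J
    ; from    = λ (k , l , J) → - k , + 2 * J - l , J
    ; to-∈    = λ {(k , l , J)} ((pl , pm , q) , ps) → (pm , pos≡ pl (sym (reflect-l l J)) , add0 (reflect k l J 0ℤ (trans (ℤₚ.+-identityʳ _) q))) , pos≡ ps (reflect-s k l J)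
    ; from-∈  = λ {(k , l , J)} ((pl , pm , q) , ps) → (pm , pos≡ pl (sym (reflect-l l J)) , add0 (reflect k l J 0ℤ (trans (ℤₚ.+-identityʳ _) q))) , pos≡ ps (reflect-s′ k l J)
    ; from-to = λ {(k , l , J)} _ → tuple³ (ℤₚ.neg-involutive k) (reflect-l l J) refl
    ; to-from = λ {(k , l , J)} _ → tuple³ (ℤₚ.neg-involutive k) (reflect-l l J) refl
    }

  private
    s-shift : ∀ j u → j + + 2 * u ≡ + 2 * (u + j) - j
    s-shift = solve-∀
    s-unshift : ∀ j u → + 2 * u - j ≡ j + + 2 * (u - j)
    s-unshift = solve-∀
    d-back : ∀ j d u → - (+ 2 * (j + + 2 * u) - d) + + 2 * (+ 2 * (u + j) - j) ≡ d
    d-back = solve-∀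
    d-forth : ∀ j d u → d ≡ - (+ 2 * (j + + 2 * (u - j)) - (d + + 2 * (+ 2 * u - j)))
    d-forth = solve-∀
    add-sub : ∀ u j → u + j - j ≡ u
    add-sub = solve-∀
    sub-add : ∀ u j → u - j + j ≡ u
    sub-add = solve-∀

  -- Again `u` grows by `j` and its square by `j * s`, but now the excess is taken from `j * d`: `d`
  -- falls by `2s` and `h` stays.
  T₁⁻≅T₂ : (λ a → T₁ a × Pos (- l₁ a)) ≅ T₂
  T₁⁻≅T₂ = record
    { to      = λ (j , d , u , h) → j , - (+ 2 * (j + + 2 * u) - d) , u + j , h
    ; from    = λ (j , d , u , h) → j , d + + 2 * (+ 2 * u - j) , u - j , h
    ; to-∈    = λ {(j , d , u , h)} ((pj , pd , ph , ps , q) , pr) →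
        pj , pr , ph , pos≡ ps (s-shift j u) , trans (eq₁ j d u h) q
    ; from-∈  = λ {(j , d , u , h)} (pj , pd , ph , ps , q) →
        (pj , pos-+ pd (pos-double ps) , ph , pos≡ ps (s-unshift j u) , trans (eq₂ j d u h) q) , pos≡ pd (d-forth j d u)
    ; from-to = λ {(j , d , u , h)} _ → tuple⁴ refl (d-back j d u) (add-sub u j) refl
    ; to-from = λ {(j , d , u , h)} _ → tuple⁴ refl (sym (d-forth j d u)) (sub-add u j) refl
    }
    where
    eq₁ : ∀ j d u h → j * - (+ 2 * (j + + 2 * u) - d) + + 2 * ((+ 2 * (u + j) - j) * h) + + 2 * ((u + j) * (u + j)) ≡ j * d + + 2 * ((j + + 2 * u) * h) + + 2 * (u * u)
    eq₁ = solve-∀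
    eq₂ : ∀ j d u h → j * (d + + 2 * (+ 2 * u - j)) + + 2 * ((j + + 2 * (u - j)) * h) + + 2 * ((u - j) * (u - j)) ≡ j * d + + 2 * ((+ 2 * u - j) * h) + + 2 * (u * u)
    eq₂ = solve-∀

  W⁻≅W⁻ : (λ a → W a × Pos (- l₀ a)) ≅ (λ a → W a × Pos (- l₂ a))
  W⁻≅W⁻ = record
    { to      = λ (j , d , u) → j , - (+ 2 * (j + + 2 * u) - d) , u + j
    ; from    = λ (j , d , u) → j , d + + 2 * (+ 2 * u - j) , u - j
    ; to-∈    = λ {(j , d , u)} ((pj , pd , ps , q) , pr) →
        (pj , pr , pos≡ (pos-+ ps (pos-double pj)) (eq₃ j u) , trans (eq₁ j d u) q) , pos≡ ps (x+2y≡-[x-2[y+x]] j u)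
    ; from-∈  = λ {(j , d , u)} ((pj , pd , ps , q) , pr) → let ps′ = pos≡ pr (eq₅ j u) in
        (pj , pos-+ pd (pos-double ps′) , pos≡ ps′ (s-unshift j u) , trans (eq₂ j d u) q) , pos≡ pd (d-forth j d u)
    ; from-to = λ {(j , d , u)} _ → tuple³ refl (d-back j d u) (add-sub u j)
    ; to-from = λ {(j , d , u)} _ → tuple³ refl (sym (d-forth j d u)) (sub-add u j)
    }
    where
    eq₁ : ∀ j d u → j * - (+ 2 * (j + + 2 * u) - d) + + 2 * ((u + j) * (u + j)) ≡ j * d + + 2 * (u * u)
    eq₁ = solve-∀
    eq₂ : ∀ j d u → j * (d + + 2 * (+ 2 * u - j)) + + 2 * ((u - j) * (u - j)) ≡ j * d + + 2 * (u * u)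
    eq₂ = solve-∀
    eq₃ : ∀ j u → j + + 2 * u + + 2 * j ≡ j + + 2 * (u + j)
    eq₃ = solve-∀
    eq₅ : ∀ j u → - (j - + 2 * u) ≡ + 2 * u - j
    eq₅ = solve-∀

  W⁺≅T₀ : (λ a → W a × Pos (l₂ a)) ≅ T₀
  W⁺≅T₀ = id≅ (λ ((pj , pd , p⁺ , q) , p⁻) → pj , pd , p⁺ , p⁻ , q) (λ (pj , pd , p⁺ , p⁻ , q) → (pj , pd , p⁺ , q) , p⁻)

  private
    one : {A : Set} → A → ℤ
    one _ = 1ℤ

    even-product : ∀ j d r x → + 2 * x ≡ j * d → j * d + + 2 * r ≡ N → ⊥
    even-product j d r x e q = odd≢even {x + r} {m} (trans (ℤₚ.*-distribˡ-+ (+ 2) x r) (trans (cong (_+ + 2 * r) e) q))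

    reassoc : ∀ x y z → x + + 2 * (y + z) ≡ x + + 2 * y + + 2 * z
    reassoc = solve-∀

    d-even : ∀ j d s → + 2 * s - d ≡ 0ℤ → + 2 * (j * s) ≡ j * d
    d-even j d s e = trans (2[xy]≡x[2y] j s) (cong (λ x → j * x) (ℤₚ.i-j≡0⇒i≡j _ d e))

    j-even : ∀ j d u → j - + 2 * u ≡ 0ℤ → + 2 * (u * d) ≡ j * d
    j-even j d u e = trans (eq u d) (cong (λ x → x * d) (sym (ℤₚ.i-j≡0⇒i≡j j _ e)))
      where
      eq : ∀ u d → + 2 * (u * d) ≡ + 2 * u * d
      eq = solve-∀

    s≢0 : ∀ k l J h → l * (+ 2 * J - l) + + 4 * (h * J) ≡ N₂ - k * k → k - l + J ≢ 0ℤ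
    s≢0 k l J h q z = even-product (k - l + J) l (J * h + u * u) 0ℤ (cong (_* l) (sym z))
      (trans (reassoc ((k - l + J) * l) (J * h) (u * u)) (substituted k l J h u (double-half k l J (h * J) q) q))
      where u = half (l - k)

  -- Let `z` count the part `d < 2s` of `T₁`, where `s = j + 2u`. The symmetry `(k, l)` to
  -- `(-k, 2J - l)` gives `Z = 2z`; the part `d > 2s` of `T₁` is `T₂`, so `S₁ = z + S₂`; and
  -- `Z₀ = 2S₀`. Then `2Z + Z₀` is twice the left side of `liouville`.
  odd-relation : ∑ (box ∣ N₂ ∣) (λ k → c₁ (N₂ - k * k)) ≡ + 2 * mass N
  odd-relation = begin
    ∑ (box ∣ N₂ ∣) (λ k → c₁ (N₂ - k * k))
      ≡⟨ ∑-+ (box ∣ N₂ ∣) (λ k → + 2 * count (F k)) (count ∘ F₀) ⟩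
    ∑ (box ∣ N₂ ∣) (λ k → + 2 * count (F k)) + ∑ (box ∣ N₂ ∣) (count ∘ F₀)
      ≡⟨ cong (_+ ∑ (box ∣ N₂ ∣) (count ∘ F₀)) (∑-* (+ 2) (box ∣ N₂ ∣) (count ∘ F)) ⟩
    + 2 * ∑ (box ∣ N₂ ∣) (count ∘ F) + ∑ (box ∣ N₂ ∣) (count ∘ F₀)
      ≡⟨ cong₂ (λ x y → + 2 * x + y) (∑-fibred ∣ N₂ ∣ F (λ {k} {t} → bound-Z {k} {t}) one) (∑-fibred ∣ N₂ ∣ F₀ (λ {k} {t} → bound-Z₀ {k} {t}) one) ⟨
    + 2 * count Z-enum + count Z₀-enum
      ≡⟨ cong₂ (λ x y → + 2 * x + y) sZ sZ₀ ⟩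
    + 2 * (z + z) + (S₀ + S₀)
      ≡⟨ combine z S₂ S₀ ⟩
    + 2 * (+ 2 * (z + S₂) - + 2 * S₂ + S₀)
      ≡⟨ cong (λ x → + 2 * (+ 2 * x - + 2 * S₂ + S₀)) s₁ ⟨
    + 2 * (+ 2 * S₁ - + 2 * S₂ + S₀)
      ≡⟨ cong (λ x → + 2 * x) (liouville refl refl) ⟩
    + 2 * mass N ∎
    where
    open ≡-Reasoning
    z = ∑ (posPart T₁-enum l₁) one
    v = ∑ (negPart W-enum l₂) one
    zT = ∑-bij Z⁺≅T₁⁺ (posPart Z-enum lZ) (posPart T₁-enum l₁) {v = one} (λ _ → refl)
    sZ : count Z-enum ≡ z + z
    sZ = trans (∑-sign≢0 Z-enum lZ one (λ {(k , l , J , h)} (_ , _ , _ , q) → s≢0 k l J h q))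
      (cong₂ _+_ zT (trans (∑-bij Z⁻≅Z⁺ (negPart Z-enum lZ) (posPart Z-enum lZ) (λ _ → refl)) zT))
    s₁ : S₁ ≡ z + S₂
    s₁ = trans (∑-sign≢0 T₁-enum l₁ one (λ {(j , d , u , h)} (_ , _ , _ , _ , q) e →
           even-product j d ((j + + 2 * u) * h + u * u) (j * (j + + 2 * u)) (d-even j d (j + + 2 * u) e) (trans (reassoc (j * d) ((j + + 2 * u) * h) (u * u)) q)))
      (+-congʳ z (∑-bij T₁⁻≅T₂ (negPart T₁-enum l₁) T₂-enum (λ _ → refl)))
    -- `W` is cut by two different linear forms. The negative parts correspond under the map of
    -- `T₁⁻≅T₂` with `h` forgotten, so the positive parts have equal size, and one of them is `T₀`.
    w⁺ : ∑ (posPart W-enum l₀) one ≡ S₀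
    w⁺ = ∙-cancelʳ v _ _ (trans (sym split₀) split₂)
      where
      open import Algebra.Properties.AbelianGroup ℤₚ.+-0-abelianGroup using (∙-cancelʳ)
      split₀ : count W-enum ≡ ∑ (posPart W-enum l₀) one + v
      split₀ = trans (∑-sign≢0 W-enum l₀ one (λ {(j , d , u)} (_ , _ , _ , q) e → even-product j d (u * u) (j * (j + + 2 * u)) (d-even j d (j + + 2 * u) e) q))
        (+-congʳ (∑ (posPart W-enum l₀) one) (∑-bij W⁻≅W⁻ (negPart W-enum l₀) (negPart W-enum l₂) (λ _ → refl)))
      split₂ : count W-enum ≡ S₀ + v
      split₂ = trans (∑-sign≢0 W-enum l₂ one (λ {(j , d , u)} (_ , _ , _ , q) e → even-product j d (u * u) (u * d) (j-even j d u e) q))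
        (cong (_+ v) (∑-bij W⁺≅T₀ (posPart W-enum l₂) T₀-enum (λ _ → refl)))
    zW = trans (∑-bij Z₀⁺≅W⁺ (posPart Z₀-enum lZ₀) (posPart W-enum l₀) {v = one} (λ _ → refl)) w⁺
    sZ₀ : count Z₀-enum ≡ S₀ + S₀
    sZ₀ = trans (∑-sign≢0 Z₀-enum lZ₀ one (λ {(k , l , J)} (_ , _ , q) → s≢0 k l J 0ℤ (pair⇒triple {l} {J} q)))
      (cong₂ _+_ zW (trans (∑-bij Z₀⁻≅Z₀⁺ (negPart Z₀-enum lZ₀) (posPart Z₀-enum lZ₀) (λ _ → refl)) zW))
    combine : ∀ z s₂ s₀ → + 2 * (z + z) + (s₀ + s₀) ≡ + 2 * (+ 2 * (z + s₂) - + 2 * s₂ + s₀)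
    combine = solve-∀

-- The quadratic characters modulo 2 and 4

-- `sg x` is `(-1)^x`, a character of the additive group. `χ` is the multiplicative character of
-- conductor 4, with value `(-1)^y` at `1 + 2y`.
sg : ℤ → ℤ
sg x with parity x
... | _ , inj₁ _ = 1ℤ
... | _ , inj₂ _ = -1ℤ

χ : ℤ → ℤ
χ x with parity x
... | _ , inj₁ _ = 0ℤ
... | y , inj₂ _ = sg y

sg-even : ∀ y → sg (+ 2 * y) ≡ 1ℤ
sg-even y with parity (+ 2 * y)
... | _ , inj₁ _ = refl
... | z , inj₂ e = ⊥-elim (odd≢even {y} {z} e)

sg-odd : ∀ y → sg (1ℤ + + 2 * y) ≡ -1ℤ
sg-odd y with parity (1ℤ + + 2 * y)
... | z , inj₁ e = ⊥-elim (odd≢even {z} {y} (sym e))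
... | _ , inj₂ _ = refl

χ-even : ∀ y → χ (+ 2 * y) ≡ 0ℤ
χ-even y with parity (+ 2 * y)
... | _ , inj₁ _ = refl
... | z , inj₂ e = ⊥-elim (odd≢even {y} {z} e)

χ-odd : ∀ y → χ (1ℤ + + 2 * y) ≡ sg y
χ-odd y with parity (1ℤ + + 2 * y)
... | z , inj₁ e = ⊥-elim (odd≢even {z} {y} (sym e))
... | z , inj₂ e = cong sg (cancel-double {z} {y} (∙-cancelˡ 1ℤ (+ 2 * z) (+ 2 * y) (sym e)))
  where open import Algebra.Properties.AbelianGroup ℤₚ.+-0-abelianGroup using (∙-cancelˡ)

sg-+ : ∀ x y → sg (x + y) ≡ sg x * sg y
sg-+ x y with parity x | parity y
... | a , inj₁ refl | b , inj₁ refl = trans (cong sg (eq a b)) (sg-even (a + b))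
  where
  eq : ∀ a b → + 2 * a + + 2 * b ≡ + 2 * (a + b)
  eq = solve-∀
... | a , inj₁ refl | b , inj₂ refl = trans (cong sg (eq a b)) (sg-odd (a + b))
  where
  eq : ∀ a b → + 2 * a + (1ℤ + + 2 * b) ≡ 1ℤ + + 2 * (a + b)
  eq = solve-∀
... | a , inj₂ refl | b , inj₁ refl = trans (cong sg (eq a b)) (sg-odd (a + b))
  where
  eq : ∀ a b → 1ℤ + + 2 * a + + 2 * b ≡ 1ℤ + + 2 * (a + b)
  eq = solve-∀
... | a , inj₂ refl | b , inj₂ refl = trans (cong sg (eq a b)) (sg-even (1ℤ + (a + b)))
  where
  eq : ∀ a b → 1ℤ + + 2 * a + (1ℤ + + 2 * b) ≡ + 2 * (1ℤ + (a + b))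
  eq = solve-∀

sg-neg : ∀ x → sg (- x) ≡ sg x
sg-neg x with parity x
... | a , inj₁ refl = trans (cong sg (-[2x]≡2[-x] a)) (sg-even (- a))
... | a , inj₂ refl = trans (cong sg (neg-odd a)) (sg-odd (-1ℤ - a))

sg-sq : ∀ x → sg x * sg x ≡ 1ℤ
sg-sq x with parity x
... | _ , inj₁ _ = refl
... | _ , inj₂ _ = refl

χ-shift : ∀ x y → χ (x + + 2 * y) ≡ sg y * χ x
χ-shift x y with parity x
... | a , inj₁ refl = trans (trans (cong χ (sym (ℤₚ.*-distribˡ-+ (+ 2) a y))) (χ-even (a + y))) (sym (ℤₚ.*-zeroʳ (sg y)))
... | a , inj₂ refl = trans (trans (cong χ (eq a y)) (χ-odd (y + a))) (sg-+ y a)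
  where
  eq : ∀ a y → 1ℤ + + 2 * a + + 2 * y ≡ 1ℤ + + 2 * (y + a)
  eq = solve-∀

χ-neg : ∀ x → χ (- x) ≡ - χ x
χ-neg x with parity x
... | a , inj₁ refl = trans (cong χ (-[2x]≡2[-x] a)) (χ-even (- a))
... | a , inj₂ refl = trans (cong χ (neg-odd a)) (trans (χ-odd (-1ℤ - a)) (trans (sg-+ -1ℤ (- a)) (trans (ℤₚ.-1*i≡-i (sg (- a))) (cong -_ (sg-neg a)))))

sg-χ : ∀ x → sg x * χ x ≡ - χ x
sg-χ x with parity x
... | _ , inj₁ _ = refl
... | a , inj₂ _ = ℤₚ.-1*i≡-i (sg a)

-- Two squares

X : ℤ → ℤ
X n = ∑ (factors n) (λ (j , d) → χ d)

TwoSquares : ℤ → ℤ² → Set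
TwoSquares n (x , y) = x * x + y * y ≡ n

twoSquares : ∀ n → Enum (TwoSquares n)
twoSquares n = enum² ∣ n ∣ (λ (x , y) → x * x + y * y ≟ n)
  λ {x} {y} q → bound-sq {x} (nonneg-sq y) q , bound-sq {y} (nonneg-sq x) (trans (ℤₚ.+-comm (y * y) (x * x)) q)

r₂ : ℤ → ℤ
r₂ n = count (twoSquares n)

IsZero : ℤ → ℤ → Set
IsZero n t = t ≡ 0ℤ × n ≡ 0ℤ

isZero : ∀ n → Enum (IsZero n)
isZero n = enum¹ 0 (λ t → (t ≟ 0ℤ) ×-dec (n ≟ 0ℤ)) (λ { (refl , _) → ℕ.z≤n })

-- The last term corrects `n = 0`, where `r₂` is 1 but there are no positive factors. It is the size
-- of a set with at most one point, so that it can be summed over fibres like the other two.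
defect : ℤ → ℤ
defect n = r₂ n - + 4 * X n - count (isZero n)

self-neg⇒0 : ∀ {x} → x ≡ - x → x ≡ 0ℤ
self-neg⇒0 {+ zero} _ = refl

module FourKPlusOne (q : ℤ) where

  n : ℤ
  n = 1ℤ + + 4 * q

  Ω : ℤ³ → Set
  Ω (i , t) = Factor (n - i * i) t

  private
    bound-i : ∀ {i r} → 0ℤ ≤ r → r ≡ n - i * i → Box ∣ n ∣ i
    bound-i {i} {r} hr e = bound-sq {i} {N = n} hr (trans (ℤₚ.+-comm (i * i) r) (unmove {r} {i * i} {n} e))

    bound-Ω : ∀ {i t} → Ω (i , t) → Box ∣ n ∣ i
    bound-Ω {i} (pj , pd , e) = bound-i {i} (pos⇒nonneg (pos-* pj pd)) e

    F : ∀ i → Enum (Factor (n - i * i))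
    F i = factors (n - i * i)

  Ω-enum : Enum Ω
  Ω-enum = fibred ∣ n ∣ F (λ {i} {t} → bound-Ω {i} {t})

  ∑-Ω : ∀ v → ∑ Ω-enum v ≡ ∑ (box ∣ n ∣) (λ i → ∑ (factors (n - i * i)) (λ t → v (i , t)))
  ∑-Ω = ∑-fibred ∣ n ∣ F (λ {i} {t} → bound-Ω {i} {t})

  equation : ∀ {i d e} → Ω (i , d , e) → i * i + d * e ≡ n
  equation {i} {d} {e} (_ , _ , q) = trans (ℤₚ.+-comm (i * i) (d * e)) (unmove {d * e} {i * i} {n} q)

  inΩ : ∀ {i d e} → Pos d → Pos e → i * i + d * e ≡ n → Ω (i , d , e)
  inΩ {i} {d} {e} pd pe q = pd , pe , move {d * e} {i * i} {n} (trans (ℤₚ.+-comm (d * e) (i * i)) q)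

  l l′ : ℤ³ → ℤ
  l  (i , d , e) = d - + 2 * i - e
  l′ (y , d , e) = e - d - + 2 * y

  w g : ℤ³ → ℤ
  w (i , d , e) = sg i * χ e
  g (y , d , e) = sg d * χ (e - d)

  -- A shear by `e` followed by a sign change preserves `i * i + d * e` once `d` becomes
  -- `d - 2i - e`. It multiplies `sg i` by `sg e`, which is -1 wherever `χ e` is nonzero; so this
  -- involution reverses `w`.
  Ω⁺≅Ω⁺ : (λ a → Ω a × Pos (l a)) ≅ (λ a → Ω a × Pos (l a))
  Ω⁺≅Ω⁺ = record
    { to = φ ; from = φ ; to-∈ = φ-∈ ; from-∈ = φ-∈
    ; from-to = λ {(i , d , e)} _ → tuple³ (eq₁ i e) (eq₂ i d e) refl
    ; to-from = λ {(i , d , e)} _ → tuple³ (eq₁ i e) (eq₂ i d e) refl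
    }
    where
    φ : ℤ³ → ℤ³
    φ (i , d , e) = - i - e , d - + 2 * i - e , e
    eq₁ : ∀ i e → - (- i - e) - e ≡ i
    eq₁ = solve-∀
    eq₂ : ∀ i d e → d - + 2 * i - e - + 2 * (- i - e) - e ≡ d
    eq₂ = solve-∀
    eq₃ : ∀ i d e → (- i - e) * (- i - e) + (d - + 2 * i - e) * e ≡ i * i + d * e
    eq₃ = solve-∀
    φ-∈ : ∀ {a} → Ω a × Pos (l a) → Ω (φ a) × Pos (l (φ a))
    φ-∈ {i , d , e} (h@(pd , pe , _) , pl) = inΩ { - i - e} pl pe (trans (eq₃ i d e) (equation {i} {d} {e} h)) , pos≡ pd (sym (eq₂ i d e))

  Ω⁻≅Ω⁺ : (λ a → Ω a × Pos (- l a)) ≅ (λ a → Ω a × Pos (l′ a))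
  Ω⁻≅Ω⁺ = record
    { to      = λ (i , d , e) → i - d , d , - (d - + 2 * i - e)
    ; from    = λ (y , d , e) → y + d , d , e - d - + 2 * y
    ; to-∈    = λ {(i , d , e)} (h@(pd , pe , _) , pl) →
        inΩ {i - d} pd pl (trans (eq₁ i d e) (equation {i} {d} {e} h)) , pos≡ pe (eq₂ i d e)
    ; from-∈  = λ {(y , d , e)} (h@(pd , pe , _) , pl) →
        inΩ {y + d} pd pl (trans (eq₃ y d e) (equation {y} {d} {e} h)) , pos≡ pe (eq₄ y d e)
    ; from-to = λ {(i , d , e)} _ → tuple³ ([x-y]+y≡x i d) refl (sym (eq₂ i d e))
    ; to-from = λ {(y , d , e)} _ → tuple³ ([x+y]-y≡x y d) refl (sym (eq₄ y d e))
    }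
    where
    eq₁ : ∀ i d e → (i - d) * (i - d) + d * - (d - + 2 * i - e) ≡ i * i + d * e
    eq₁ = solve-∀
    eq₂ : ∀ i d e → e ≡ - (d - + 2 * i - e) - d - + 2 * (i - d)
    eq₂ = solve-∀
    eq₃ : ∀ y d e → (y + d) * (y + d) + d * (e - d - + 2 * y) ≡ y * y + d * e
    eq₃ = solve-∀
    eq₄ : ∀ y d e → e ≡ - (d - + 2 * (y + d) - (e - d - + 2 * y))
    eq₄ = solve-∀

  flip≅ : (λ a → Ω a × Pos (- l′ a)) ≅ (λ a → Ω a × Pos (l′ a))
  flip≅ = record
    { to      = λ (y , d , e) → - y , e , d
    ; from    = λ (y , d , e) → - y , e , d
    ; to-∈    = λ {(y , d , e)} (h@(pd , pe , _) , pl) → inΩ { - y} pe pd (trans (eq₁ y d e) (equation {y} {d} {e} h)) , pos≡ pl (eq₂ y d e)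
    ; from-∈  = λ {(y , d , e)} (h@(pd , pe , _) , pl) → inΩ { - y} pe pd (trans (eq₁ y d e) (equation {y} {d} {e} h)) , pos≡ pl (eq₃ y d e)
    ; from-to = λ {(y , d , e)} _ → tuple³ (ℤₚ.neg-involutive y) refl refl
    ; to-from = λ {(y , d , e)} _ → tuple³ (ℤₚ.neg-involutive y) refl refl
    }
    where
    eq₁ : ∀ y d e → - y * - y + e * d ≡ y * y + d * e
    eq₁ = solve-∀
    eq₂ : ∀ y d e → - (e - d - + 2 * y) ≡ d - e - + 2 * - y
    eq₂ = solve-∀
    eq₃ : ∀ y d e → e - d - + 2 * y ≡ - (d - e - + 2 * - y)
    eq₃ = solve-∀

  swap≅ : Ω ≅ Ω
  swap≅ = record
    { to = ψ ; from = ψ ; to-∈ = λ {a} → ψ-∈ {a} ; from-∈ = λ {a} → ψ-∈ {a} ; from-to = λ _ → refl ; to-from = λ _ → refl }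
    where
    ψ : ℤ³ → ℤ³
    ψ (y , d , e) = y , e , d
    ψ-∈ : ∀ {a} → Ω a → Ω (ψ a)
    ψ-∈ {y , d , e} (pd , pe , q) = pe , pd , trans (ℤₚ.*-comm e d) q

  Σsgχ Σχ boundary : ℤ
  Σsgχ = ∑ Ω-enum w
  Σχ = ∑ Ω-enum (λ (i , d , e) → χ e)
  boundary = ∑ (zeroPart Ω-enum l) w

  -- Work modulo 4, where `n` is 1. If `y` is even, `d` and `e` are odd and both sides vanish. If
  -- `y` is odd, 4 divides `d * e`: either both factors are even and both sides vanish, or one is
  -- odd and the other a multiple of 4, and then `sg d * χ (e - d)` is `χ` of the odd one.
  pointwise : ∀ {y d e} → y * y + d * e ≡ n → + 2 * (sg d * χ (e - d)) ≡ (1ℤ - sg y) * (χ e + χ d)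
  pointwise {y} {d} {e} h with parity y | parity d | parity e
  ... | a , inj₁ refl | b , inj₁ refl | c , _ = ⊥-elim (odd≢even {+ 2 * (a * a) + b * e} {+ 2 * q} (trans (eq₁ a b e) (trans h (1+4x≡1+2[2x] q))))
    where
    eq₁ : ∀ a b e → + 2 * (+ 2 * (a * a) + b * e) ≡ + 2 * a * (+ 2 * a) + + 2 * b * e
    eq₁ = solve-∀
  ... | a , inj₁ refl | b , _ | c , inj₁ refl = ⊥-elim (odd≢even {+ 2 * (a * a) + d * c} {+ 2 * q} (trans (eq₁ a d c) (trans h (1+4x≡1+2[2x] q))))
    where
    eq₁ : ∀ a d c → + 2 * (+ 2 * (a * a) + d * c) ≡ + 2 * a * (+ 2 * a) + d * (+ 2 * c)
    eq₁ = solve-∀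
  ... | a , inj₁ refl | b , inj₂ refl | c , inj₂ refl =
    trans (cong (λ x → + 2 * (-1ℤ * x)) (trans (cong χ (eq b c)) (χ-even (c - b)))) (eq₃ (sg c) (sg b))
    where
    eq : ∀ b c → 1ℤ + + 2 * c - (1ℤ + + 2 * b) ≡ + 2 * (c - b)
    eq = solve-∀
    eq₃ : ∀ x y → 0ℤ ≡ 0ℤ * (x + y)
    eq₃ x y = sym (ℤₚ.*-zeroˡ (x + y))
  ... | a , inj₂ refl | b , inj₂ refl | c , inj₂ refl =
    ⊥-elim (odd≢even {1ℤ + + 2 * (a + a * a) + (b + c + + 2 * (b * c))} {+ 2 * q} (trans (eq₁ a b c) (trans h (1+4x≡1+2[2x] q))))
    where
    eq₁ : ∀ a b c → + 2 * (1ℤ + + 2 * (a + a * a) + (b + c + + 2 * (b * c))) ≡ (1ℤ + + 2 * a) * (1ℤ + + 2 * a) + (1ℤ + + 2 * b) * (1ℤ + + 2 * c)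
    eq₁ = solve-∀
  ... | a , inj₂ refl | b , inj₁ refl | c , inj₁ refl = cong (λ x → + 2 * (1ℤ * x)) (trans (cong χ (eq b c)) (χ-even (c - b)))
    where
    eq : ∀ b c → + 2 * c - + 2 * b ≡ + 2 * (c - b)
    eq = solve-∀
  ... | a , inj₂ refl | b , inj₁ refl | c , inj₂ refl with parity b
  ...   | b′ , inj₁ refl = trans (cong (λ x → + 2 * (1ℤ * x)) χ≡) (eq₃ (sg c))
    where
    eq : ∀ b c → 1ℤ + + 2 * c - + 2 * (+ 2 * b) ≡ 1ℤ + + 2 * c + + 2 * (+ 2 * - b)
    eq = solve-∀
    χ≡ : χ (1ℤ + + 2 * c - + 2 * (+ 2 * b′)) ≡ sg c
    χ≡ = trans (cong χ (eq b′ c)) (trans (χ-shift (1ℤ + + 2 * c) (+ 2 * - b′)) (trans (cong₂ _*_ (sg-even (- b′)) (χ-odd c)) (ℤₚ.*-identityˡ (sg c))))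
    eq₃ : ∀ x → + 2 * (1ℤ * x) ≡ + 2 * (x + 0ℤ)
    eq₃ = solve-∀
  ...   | b′ , inj₂ refl = ⊥-elim (odd≢even {q - a - a * a} {c + b′ + + 2 * (b′ * c)} (cancel-double (trans (eq₁ a q) (trans (cong (λ x → x - (1ℤ + + 2 * a) * (1ℤ + + 2 * a)) (sym h)) (eq₂ a b′ c)))))
    where
    eq₁ : ∀ a q → + 2 * (+ 2 * (q - a - a * a)) ≡ 1ℤ + + 4 * q - (1ℤ + + 2 * a) * (1ℤ + + 2 * a)
    eq₁ = solve-∀
    eq₂ : ∀ a b c → (1ℤ + + 2 * a) * (1ℤ + + 2 * a) + + 2 * (1ℤ + + 2 * b) * (1ℤ + + 2 * c) - (1ℤ + + 2 * a) * (1ℤ + + 2 * a) ≡ + 2 * (1ℤ + + 2 * (c + b + + 2 * (b * c)))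
    eq₂ = solve-∀
  pointwise {y} {d} {e} h | a , inj₂ refl | b , inj₂ refl | c , inj₁ refl with parity c
  ...   | c′ , inj₁ refl = trans (cong (λ x → + 2 * (-1ℤ * x)) χ≡) (eq₃ (sg b))
    where
    eq : ∀ b c → + 2 * (+ 2 * c) - (1ℤ + + 2 * b) ≡ - (1ℤ + + 2 * b) + + 2 * (+ 2 * c)
    eq = solve-∀
    χ≡ : χ (+ 2 * (+ 2 * c′) - (1ℤ + + 2 * b)) ≡ - sg b
    χ≡ = trans (cong χ (eq b c′)) (trans (χ-shift (- (1ℤ + + 2 * b)) (+ 2 * c′)) (trans (cong₂ _*_ (sg-even c′) (trans (χ-neg (1ℤ + + 2 * b)) (cong -_ (χ-odd b)))) (ℤₚ.*-identityˡ (- sg b))))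
    eq₃ : ∀ x → + 2 * (-1ℤ * - x) ≡ + 2 * (0ℤ + x)
    eq₃ = solve-∀
  ...   | c′ , inj₂ refl = ⊥-elim (odd≢even {q - a - a * a} {c′ + b + + 2 * (b * c′)} (cancel-double (trans (eq₁ a q) (trans (cong (λ x → x - (1ℤ + + 2 * a) * (1ℤ + + 2 * a)) (sym h)) (eq₂ a b c′)))))
    where
    eq₁ : ∀ a q → + 2 * (+ 2 * (q - a - a * a)) ≡ 1ℤ + + 4 * q - (1ℤ + + 2 * a) * (1ℤ + + 2 * a)
    eq₁ = solve-∀
    eq₂ : ∀ a b c → (1ℤ + + 2 * a) * (1ℤ + + 2 * a) + (1ℤ + + 2 * b) * (+ 2 * (1ℤ + + 2 * c)) - (1ℤ + + 2 * a) * (1ℤ + + 2 * a) ≡ + 2 * (1ℤ + + 2 * (c + b + + 2 * (b * c)))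
    eq₂ = solve-∀

  -- The region `l > 0` contributes 0 to `Σsgχ`. A shear by `d` carries the region `l < 0` to
  -- `l′ > 0` and `w` to `g`, so `Σsgχ = p + boundary`. Exchanging `d` and `e` gives the full sum of
  -- `g` as `2p`, and `pointwise` evaluates the same sum as `Σχ - Σsgχ`. Eliminating `p` gives the
  -- claim.
  characters : + 3 * Σsgχ - Σχ ≡ + 2 * boundary
  characters = combine Σsgχ Σχ boundary p V≡ (cancel-double (trans G≡ (trans (sym twice) (cong (λ x → + 2 * x) G⁺))))
    where
    p = ∑ (posPart Ω-enum l′) g
    P = ∑ (posPart Ω-enum l) w
    P≡0 : P ≡ 0ℤ
    P≡0 = self-neg⇒0 (trans (∑-bij Ω⁺≅Ω⁺ (posPart Ω-enum l) (posPart Ω-enum l) {v = λ a → -1ℤ * w a} (λ {(i , d , e)} _ → weight i e))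
                            (trans (∑-* -1ℤ (posPart Ω-enum l) w) (ℤₚ.-1*i≡-i P)))
      where
      eq : ∀ a b c → -1ℤ * (a * b * c) ≡ - (a * (b * c))
      eq = solve-∀
      weight : ∀ i e → sg i * χ e ≡ -1ℤ * (sg (- i - e) * χ e)
      weight i e = sym (trans (cong (λ x → -1ℤ * (x * χ e)) (trans (sg-+ (- i) (- e)) (cong₂ _*_ (sg-neg i) (sg-neg e))))
        (trans (eq (sg i) (sg e) (χ e)) (trans (cong (λ x → - (sg i * x)) (sg-χ e)) (-[x*-y]≡xy (sg i) (χ e)))))
    V≡ : Σsgχ ≡ p + boundary
    V≡ = trans (∑-sign Ω-enum l w) (trans (cong₂ (λ x y → x + (y + boundary)) P≡0
      (∑-bij Ω⁻≅Ω⁺ (negPart Ω-enum l) (posPart Ω-enum l′) (λ {(i , d , e)} _ → sym (weight i d e)))) (ℤₚ.+-identityˡ _))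
      where
      eq₁ : ∀ i d e → - (d - + 2 * i - e) - d ≡ e + + 2 * (i - d)
      eq₁ = solve-∀
      eq₂ : ∀ a b c → b * (a * b * c) ≡ b * b * (a * c)
      eq₂ = solve-∀
      weight : ∀ i d e → sg d * χ (- (d - + 2 * i - e) - d) ≡ sg i * χ e
      weight i d e = trans (cong (λ x → sg d * x) (trans (cong χ (eq₁ i d e)) (trans (χ-shift e (i - d))
        (cong (_* χ e) (trans (sg-+ i (- d)) (cong (λ x → sg i * x) (sg-neg d)))))))
        (trans (eq₂ (sg i) (sg d) (χ e)) (trans (cong (_* (sg i * χ e)) (sg-sq d)) (ℤₚ.*-identityˡ _)))
    G⁺ : ∑ Ω-enum g ≡ + 2 * p
    G⁺ = trans (∑-sign Ω-enum l′ g) (trans (cong₂ (λ x y → p + (x + y))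
      (∑-bij flip≅ (negPart Ω-enum l′) (posPart Ω-enum l′) (λ {(y , d , e)} _ → weight d e))
      (∑-zero (zeroPart Ω-enum l′) (λ {(y , d , e)} (_ , z) → trans (cong (λ x → sg d * x) (trans (cong χ (ℤₚ.i-j≡0⇒i≡j (e - d) _ z)) (χ-even y))) (ℤₚ.*-zeroʳ (sg d)))))
      (x+[x+0]≡2x p))
      where
      eq₁ : ∀ d e → e ≡ d + (e - d)
      eq₁ = solve-∀
      eq₂ : ∀ d e → d - e ≡ - (e - d)
      eq₂ = solve-∀
      eq₃ : ∀ a b c → a * b * - c ≡ - (a * (b * c))
      eq₃ = solve-∀
      weight : ∀ d e → sg d * χ (e - d) ≡ sg e * χ (d - e)
      weight d e = sym (trans (cong₂ _*_ (trans (cong sg (eq₁ d e)) (sg-+ d (e - d))) (trans (cong χ (eq₂ d e)) (χ-neg (e - d))))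
        (trans (eq₃ (sg d) (sg (e - d)) (χ (e - d))) (trans (cong (λ x → - (sg d * x)) (sg-χ (e - d))) (-[x*-y]≡xy (sg d) (χ (e - d))))))
    H = ∑ Ω-enum (λ (y , d , e) → (1ℤ - sg y) * χ e)
    twice : + 2 * ∑ Ω-enum g ≡ + 2 * H
    twice = trans (sym (∑-* (+ 2) Ω-enum g)) (trans (∑-cong Ω-enum (λ {(y , d , e)} h → trans (pointwise {y} {d} {e} (equation {y} {d} {e} h)) (ℤₚ.*-distribˡ-+ (1ℤ - sg y) (χ e) (χ d))))
      (trans (∑-+ Ω-enum (λ (y , d , e) → (1ℤ - sg y) * χ e) (λ (y , d , e) → (1ℤ - sg y) * χ d))
        (trans (+-congʳ H (∑-bij swap≅ Ω-enum Ω-enum (λ _ → refl))) (eq H))))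
      where
      eq : ∀ h → h + h ≡ + 2 * h
      eq = solve-∀
    G≡ : + 2 * (Σχ - Σsgχ) ≡ + 2 * H
    G≡ = cong (λ x → + 2 * x) (sym (trans (∑-cong Ω-enum (λ {(y , d , e)} _ → eq (sg y) (χ e)))
      (trans (∑-+ Ω-enum (λ (y , d , e) → χ e) (λ a → -1ℤ * w a)) (+-congʳ Σχ (trans (∑-* -1ℤ Ω-enum w) (ℤₚ.-1*i≡-i Σsgχ))))))
      where
      eq : ∀ a c → (1ℤ - a) * c ≡ c + -1ℤ * (a * c)
      eq = solve-∀
    combine : ∀ v x b p → v ≡ p + b → x - v ≡ + 2 * p → + 3 * v - x ≡ + 2 * b
    combine v x b p refl h = trans (eq₁ (p + b) x) (trans (cong (λ z → + 2 * (p + b) - z) h) (eq₂ p b))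
      where
      eq₁ : ∀ v x → + 3 * v - x ≡ + 2 * v - (x - v)
      eq₁ = solve-∀
      eq₂ : ∀ p b → + 2 * (p + b) - + 2 * p ≡ + 2 * b
      eq₂ = solve-∀

  Sq : ℤ² → Set
  Sq (i , t) = IsZero (n - i * i) t

  Sq-enum : Enum Sq
  Sq-enum = fibred ∣ n ∣ (λ i → isZero (n - i * i)) (λ {i} (_ , e) → bound-i {i} ℤₚ.≤-refl (sym e))

  ∑-Sq : ∀ v → ∑ Sq-enum v ≡ ∑ (box ∣ n ∣) (λ i → ∑ (isZero (n - i * i)) (λ t → v (i , t)))
  ∑-Sq = ∑-fibred ∣ n ∣ (λ i → isZero (n - i * i)) (λ {i} (_ , e) → bound-i {i} ℤₚ.≤-refl (sym e))

  Sq⁺ : Enum _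
  Sq⁺ = posPart Sq-enum proj₁

  square-odd : ∀ s → s * s ≡ n → sg s ≡ -1ℤ
  square-odd s h with parity s
  ... | a , inj₁ refl = ⊥-elim (odd≢even {+ 2 * (a * a)} {+ 2 * q} (trans (eq₁ a) (trans h (1+4x≡1+2[2x] q))))
    where
    eq₁ : ∀ a → + 2 * (+ 2 * (a * a)) ≡ + 2 * a * (+ 2 * a)
    eq₁ = solve-∀
  ... | a , inj₂ _ = refl

  Ω⁰ : ℤ³ → Set
  Ω⁰ a = Ω a × l a ≡ 0ℤ

  d≡ : ∀ {i d e} → l (i , d , e) ≡ 0ℤ → d ≡ + 2 * i + e
  d≡ {i} {d} {e} z = trans (eq₁ i d e) (trans (cong (_+ (+ 2 * i + e)) z) (ℤₚ.+-identityˡ _))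
    where
    eq₁ : ∀ i d e → d ≡ d - + 2 * i - e + (+ 2 * i + e)
    eq₁ = solve-∀

  sum-square : ∀ {i d e} → Ω⁰ (i , d , e) → (i + e) * (i + e) ≡ n
  sum-square {i} {d} {e} (h , z) = trans (eq i e) (trans (cong (λ x → i * i + x * e) (sym (d≡ {i} {d} {e} z))) (equation {i} {d} {e} h))
    where
    eq : ∀ i e → (i + e) * (i + e) ≡ i * i + (+ 2 * i + e) * e
    eq = solve-∀

  w≡χ : ∀ {i d e} → Ω⁰ (i , d , e) → sg i * χ e ≡ χ e
  w≡χ {i} {d} {e} h = trans (cong (_* χ e) sgi) (trans (eq (sg e) (χ e)) (trans (cong -_ (sg-χ e)) (ℤₚ.neg-involutive (χ e))))
    where
    eq : ∀ a c → -1ℤ * a * c ≡ - (a * c)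
    eq = solve-∀
    sgi : sg i ≡ -1ℤ * sg e
    sgi = trans (cong sg (x≡[x+y]-y i e)) (trans (sg-+ (i + e) (- e)) (cong₂ _*_ (square-odd (i + e) (sum-square {i} {d} {e} h)) (sg-neg e)))

  l″ : ℤ³ → ℤ
  l″ (i , d , e) = d - + 2

  -- On `Ω⁰` the sum `d + e` is `2s` with `s * s = n`, so `s` is odd. Replacing `e` by
  -- `d - 2 = 2s - 2 - e` negates it modulo 4, hence reverses `χ e`.
  Ω⁰⁺≅Ω⁰⁺ : (λ a → Ω⁰ a × Pos (l″ a)) ≅ (λ a → Ω⁰ a × Pos (l″ a))
  Ω⁰⁺≅Ω⁰⁺ = record
    { to = φ ; from = φ ; to-∈ = φ-∈ ; from-∈ = φ-∈
    ; from-to = λ {(i , d , e)} _ → tuple³ (eq₁ i d e) (eq₂ d) (eq₃ e)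
    ; to-from = λ {(i , d , e)} _ → tuple³ (eq₁ i d e) (eq₂ d) (eq₃ e)
    }
    where
    φ : ℤ³ → ℤ³
    φ (i , d , e) = i + e - d + + 2 , e + + 2 , d - + 2
    eq₁ : ∀ i d e → i + e - d + + 2 + (d - + 2) - (e + + 2) + + 2 ≡ i
    eq₁ = solve-∀
    eq₂ : ∀ d → d - + 2 + + 2 ≡ d
    eq₂ = solve-∀
    eq₃ : ∀ e → e + + 2 - + 2 ≡ e
    eq₃ = solve-∀
    eq₄ : ∀ i d e → e + + 2 - + 2 * (i + e - d + + 2) - (d - + 2) ≡ d - + 2 * i - e
    eq₄ = solve-∀
    eq₅ : ∀ i e → (i + e - (+ 2 * i + e) + + 2) * (i + e - (+ 2 * i + e) + + 2) + (e + + 2) * (+ 2 * i + e - + 2) ≡ i * i + (+ 2 * i + e) * e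
    eq₅ = solve-∀
    φ-∈ : ∀ {a} → Ω⁰ a × Pos (l″ a) → Ω⁰ (φ a) × Pos (l″ (φ a))
    φ-∈ {i , d , e} ((h@(pd , pe , _) , z) , pl) with d≡ {i} {d} {e} z
    ... | refl = (inΩ {i + e - (+ 2 * i + e) + + 2} (pos-+ pe (+<+ (ℕ.s≤s ℕ.z≤n))) pl (trans (eq₅ i e) (equation {i} {+ 2 * i + e} {e} h)) , trans (eq₄ i (+ 2 * i + e) e) z) , pos≡ pe (sym (eq₃ e))

  Ω⁰⁻≅Sq⁺ : (λ a → Ω⁰ a × Pos (- l″ a)) ≅ (λ a → Sq a × Pos (proj₁ a))
  Ω⁰⁻≅Sq⁺ = record
    { to      = λ (i , d , e) → i + e , 0ℤ
    ; from    = λ (s , t) → 1ℤ - s , 1ℤ , + 2 * s - 1ℤ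
    ; to-∈    = λ {(i , d , e)} (h@((pd , pe , _) , z) , pl) →
        (refl , ℤₚ.i≡j⇒i-j≡0 (sym (sum-square {i} {d} {e} h))) , pos-half (pos≡ (pos-+ pe pd) (trans (cong (λ x → e + x) (d≡ {i} {d} {e} z)) (eq₁ i e)))
    ; from-∈  = λ {(s , t)} ((_ , z) , ps) →
        (inΩ {1ℤ - s} (+<+ (ℕ.s≤s ℕ.z≤n)) (odd-pos ps) (trans (eq₂ s) (sym (ℤₚ.i-j≡0⇒i≡j n (s * s) z))) , eq₃ s) , +<+ (ℕ.s≤s ℕ.z≤n)
    ; from-to = λ {(i , d , e)} (((pd , pe , _) , z) , pl) → let d≡1 = between pd pl in
        tuple³ (trans (cong (_- (i + e)) (trans (sym d≡1) (d≡ {i} {d} {e} z))) (eq₄ i e)) (sym d≡1)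
               (trans (cong (λ x → + 2 * (i + e) - x) (trans (sym d≡1) (d≡ {i} {d} {e} z))) (eq₅ i e))
    ; to-from = λ { {(s , t)} ((refl , _) , _) → cong (_, 0ℤ) (eq₆ s) }
    }
    where
    eq₁ : ∀ i e → e + (+ 2 * i + e) ≡ + 2 * (i + e)
    eq₁ = solve-∀
    eq₂ : ∀ s → (1ℤ - s) * (1ℤ - s) + 1ℤ * (+ 2 * s - 1ℤ) ≡ s * s
    eq₂ = solve-∀
    eq₃ : ∀ s → 1ℤ - + 2 * (1ℤ - s) - (+ 2 * s - 1ℤ) ≡ 0ℤ
    eq₃ = solve-∀
    eq₄ : ∀ i e → + 2 * i + e - (i + e) ≡ i
    eq₄ = solve-∀
    eq₅ : ∀ i e → + 2 * (i + e) - (+ 2 * i + e) ≡ e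
    eq₅ = solve-∀
    eq₆ : ∀ s → 1ℤ - s + (+ 2 * s - 1ℤ) ≡ s
    eq₆ = solve-∀

  -- For fixed `s = i + e`, a positive root of `n`, the weights are `χ e` for `e` from 1 to
  -- `2s - 1`: the pattern 1, 0, -1, 0, with sum 1. The pairing cancels `d > 2`, `d = 2` has even
  -- `e`, and `d = 1` contributes `χ (2s - 1) = 1` since `s` is odd.
  boundary≡ : boundary ≡ count Sq⁺
  boundary≡ = trans (∑-sign E l″ w) (trans (cong₂ _+_ vanish (cong₂ _+_ (∑-bij Ω⁰⁻≅Sq⁺ (negPart E l″) Sq⁺ weight) zeros)) (eq (count Sq⁺)))
    where
    E = zeroPart Ω-enum l
    eq : ∀ x → 0ℤ + (x + 0ℤ) ≡ x
    eq = solve-∀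
    P = ∑ (posPart E l″) w
    vanish : P ≡ 0ℤ
    vanish = self-neg⇒0 (trans (∑-bij Ω⁰⁺≅Ω⁰⁺ (posPart E l″) (posPart E l″) {v = λ a → -1ℤ * w a} (λ {(i , d , e)} h → opposite i d e h))
                               (trans (∑-* -1ℤ (posPart E l″) w) (ℤₚ.-1*i≡-i P)))
      where
      eq₁ : ∀ i e → + 2 * i + e - + 2 ≡ e + + 2 * (i - 1ℤ)
      eq₁ = solve-∀
      eq₂ : ∀ i e → i + e - (+ 2 * i + e) + + 2 ≡ - i + + 2 * 1ℤ
      eq₂ = solve-∀
      eq₃ : ∀ a c → -1ℤ * (a * 1ℤ * (a * -1ℤ * c)) ≡ a * a * c
      eq₃ = solve-∀
      opposite : ∀ i d e → Ω⁰ (i , d , e) × Pos (d - + 2) → sg i * χ e ≡ -1ℤ * (sg (i + e - d + + 2) * χ (d - + 2))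
      opposite i d e (h , _) = trans (w≡χ {i} {d} {e} h) (sym (trans (cong (λ x → -1ℤ * (sg (i + e - x + + 2) * χ (x - + 2))) (d≡ {i} {d} {e} (proj₂ h)))
        (trans (cong₂ (λ x y → -1ℤ * (x * y))
          (trans (cong sg (eq₂ i e)) (trans (sg-+ (- i) (+ 2 * 1ℤ)) (cong (_* 1ℤ) (sg-neg i))))
          (trans (cong χ (eq₁ i e)) (trans (χ-shift e (i - 1ℤ)) (cong (_* χ e) (sg-+ i -1ℤ)))))
        (trans (eq₃ (sg i) (χ e)) (trans (cong (_* χ e) (sg-sq i)) (ℤₚ.*-identityˡ (χ e)))))))
    zeros : ∑ (zeroPart E l″) w ≡ 0ℤ
    zeros = ∑-zero (zeroPart E l″) (λ {(i , d , e)} ((_ , z) , z′) → trans (cong (λ x → sg i * x) (trans (cong χ (even i d e z z′)) (χ-even (1ℤ - i)))) (ℤₚ.*-zeroʳ (sg i)))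
      where
      eq₁ : ∀ i d e → e ≡ d - + 2 - (d - + 2 * i - e) + + 2 * (1ℤ - i)
      eq₁ = solve-∀
      even : ∀ i d e → d - + 2 * i - e ≡ 0ℤ → d - + 2 ≡ 0ℤ → e ≡ + 2 * (1ℤ - i)
      even i d e z z′ = trans (eq₁ i d e) (trans (cong₂ (λ x y → x - y + + 2 * (1ℤ - i)) z′ z) (ℤₚ.+-identityˡ _))
    weight : ∀ {a} → Ω⁰ a × Pos (- l″ a) → w a ≡ 1ℤ
    weight {i , d , e} (h@((pd , pe , _) , z) , pl) = trans (w≡χ {i} {d} {e} h) (trans (cong χ (e≡ (trans (sym (between pd pl)) (d≡ {i} {d} {e} z))))
      (trans (χ-odd (s - 1ℤ)) (trans (sg-+ s -1ℤ) (cong (_* -1ℤ) (square-odd s (sum-square {i} {d} {e} h))))))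
      where
      s = i + e
      eq₁ : ∀ i e → e ≡ + 2 * (i + e) - (+ 2 * i + e)
      eq₁ = solve-∀
      eq₂ : ∀ s → + 2 * s - 1ℤ ≡ 1ℤ + + 2 * (s - 1ℤ)
      eq₂ = solve-∀
      e≡ : 1ℤ ≡ + 2 * i + e → e ≡ 1ℤ + + 2 * (s - 1ℤ)
      e≡ h = trans (eq₁ i e) (trans (cong (λ x → + 2 * s - x) (sym h)) (eq₂ s))

module _ (q : ℤ) where

  open FourKPlusOne q

  private
    one : {A : Set} → A → ℤ
    one _ = 1ℤ

    -- The weight is 2 at even and -4 at odd `i`. It is chosen so that the weights of three
    -- coordinates, exactly one of them odd, add up to 0.
    c : ℤ → ℤ
    c i = + 3 * sg i - 1ℤ

  ThreeSquares : ℤ³ → Set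
  ThreeSquares (i , t) = TwoSquares (n - i * i) t

  private
    three : ∀ {i x y} → ThreeSquares (i , x , y) → i * i + (x * x + y * y) ≡ n
    three {i} {x} {y} h = trans (ℤₚ.+-comm (i * i) _) (unmove {y = i * i} {n} h)

    three⁻ : ∀ {i x y} → i * i + (x * x + y * y) ≡ n → ThreeSquares (i , x , y)
    three⁻ {i} {x} {y} h = move {y = i * i} {n} (trans (ℤₚ.+-comm _ (i * i)) h)

    bound³ : ∀ {i t} → ThreeSquares (i , t) → Box ∣ n ∣ i
    bound³ {i} {x , y} h = bound-sq {i} {N = n} (nonneg-+ (nonneg-sq x) (nonneg-sq y)) (three {i} {x} {y} h)

  threeSquares : Enum ThreeSquares
  threeSquares = fibred ∣ n ∣ (λ i → twoSquares (n - i * i)) (λ {i} {t} → bound³ {i} {t})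

  sign-sum : ∀ i x y → i * i + (x * x + y * y) ≡ n → sg i + (sg x + sg y) ≡ 1ℤ
  sign-sum i x y h with parity i | parity x | parity y
  ... | a , inj₁ refl | b , inj₁ refl | d , inj₁ refl = ⊥-elim (odd≢even {+ 2 * (a * a + b * b + d * d)} {+ 2 * q} (trans (eq a b d) (trans h (1+4x≡1+2[2x] q))))
    where
    eq : ∀ a b d → + 2 * (+ 2 * (a * a + b * b + d * d)) ≡ + 2 * a * (+ 2 * a) + (+ 2 * b * (+ 2 * b) + + 2 * d * (+ 2 * d))
    eq = solve-∀
  ... | a , inj₁ refl | b , inj₁ refl | d , inj₂ refl = refl
  ... | a , inj₁ refl | b , inj₂ refl | d , inj₁ refl = refl
  ... | a , inj₂ refl | b , inj₁ refl | d , inj₁ refl = refl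
  ... | a , inj₁ refl | b , inj₂ refl | d , inj₂ refl = ⊥-elim (odd≢even {1ℤ + + 2 * (a * a + b * b + b + d * d + d)} {+ 2 * q} (trans (eq a b d) (trans h (1+4x≡1+2[2x] q))))
    where
    eq : ∀ a b d → + 2 * (1ℤ + + 2 * (a * a + b * b + b + d * d + d)) ≡ + 2 * a * (+ 2 * a) + ((1ℤ + + 2 * b) * (1ℤ + + 2 * b) + (1ℤ + + 2 * d) * (1ℤ + + 2 * d))
    eq = solve-∀
  ... | a , inj₂ refl | b , inj₁ refl | d , inj₂ refl = ⊥-elim (odd≢even {1ℤ + + 2 * (a * a + a + b * b + d * d + d)} {+ 2 * q} (trans (eq a b d) (trans h (1+4x≡1+2[2x] q))))
    where
    eq : ∀ a b d → + 2 * (1ℤ + + 2 * (a * a + a + b * b + d * d + d)) ≡ (1ℤ + + 2 * a) * (1ℤ + + 2 * a) + (+ 2 * b * (+ 2 * b) + (1ℤ + + 2 * d) * (1ℤ + + 2 * d))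
    eq = solve-∀
  ... | a , inj₂ refl | b , inj₂ refl | d , inj₁ refl = ⊥-elim (odd≢even {1ℤ + + 2 * (a * a + a + b * b + b + d * d)} {+ 2 * q} (trans (eq a b d) (trans h (1+4x≡1+2[2x] q))))
    where
    eq : ∀ a b d → + 2 * (1ℤ + + 2 * (a * a + a + b * b + b + d * d)) ≡ (1ℤ + + 2 * a) * (1ℤ + + 2 * a) + ((1ℤ + + 2 * b) * (1ℤ + + 2 * b) + + 2 * d * (+ 2 * d))
    eq = solve-∀
  ... | a , inj₂ refl | b , inj₂ refl | d , inj₂ refl = ⊥-elim (odd≢even {q} {a * a + a + b * b + b + d * d + d} (cancel-double (trans (eq₁ q) (trans (cong (_- 1ℤ) (sym h)) (eq₂ a b d)))))
    where
    eq₁ : ∀ q → + 2 * (+ 2 * q) ≡ 1ℤ + + 4 * q - 1ℤ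
    eq₁ = solve-∀
    eq₂ : ∀ a b d → (1ℤ + + 2 * a) * (1ℤ + + 2 * a) + ((1ℤ + + 2 * b) * (1ℤ + + 2 * b) + (1ℤ + + 2 * d) * (1ℤ + + 2 * d)) - 1ℤ ≡ + 2 * (1ℤ + + 2 * (a * a + a + b * b + b + d * d + d))
    eq₂ = solve-∀

  rotate≅ : ThreeSquares ≅ ThreeSquares
  rotate≅ = record
    { to      = λ (i , x , y) → x , y , i
    ; from    = λ (i , x , y) → y , i , x
    ; to-∈    = λ {(i , x , y)} h → three⁻ {x} {y} {i} (trans (eq₁ i x y) (three {i} {x} {y} h))
    ; from-∈  = λ {(i , x , y)} h → three⁻ {y} {i} {x} (trans (eq₂ i x y) (three {i} {x} {y} h))
    ; from-to = λ _ → refl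
    ; to-from = λ _ → refl
    }
    where
    eq₁ : ∀ i x y → x * x + (y * y + i * i) ≡ i * i + (x * x + y * y)
    eq₁ = solve-∀
    eq₂ : ∀ i x y → y * y + (i * i + x * x) ≡ i * i + (x * x + y * y)
    eq₂ = solve-∀

  three-squares-sum : ∑ threeSquares (c ∘ proj₁) ≡ 0ℤ
  three-squares-sum = begin
    ∑ E (c ∘ proj₁)                               ≡⟨ ∑-+ E (λ a → + 3 * s₁ a) (λ _ → -1ℤ) ⟩
    ∑ E (λ a → + 3 * s₁ a) + ∑ E (λ _ → -1ℤ)      ≡⟨ cong (_+ ∑ E (λ _ → -1ℤ)) (∑-* (+ 3) E s₁) ⟩
    + 3 * ∑ E s₁ + ∑ E (λ _ → -1ℤ)                ≡⟨ cong (_+ ∑ E (λ _ → -1ℤ)) triple ⟩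
    ∑ E (λ a → s₁ a + (s₂ a + s₃ a)) + ∑ E (λ _ → -1ℤ)
      ≡⟨ ∑-+ E (λ a → s₁ a + (s₂ a + s₃ a)) (λ _ → -1ℤ) ⟨
    ∑ E (λ a → s₁ a + (s₂ a + s₃ a) + -1ℤ)        ≡⟨ ∑-zero E (λ {(i , x , y)} h → cong (_- 1ℤ) (sign-sum i x y (three {i} {x} {y} h))) ⟩
    0ℤ ∎
    where
    open ≡-Reasoning
    E = threeSquares
    s₁ s₂ s₃ : ℤ³ → ℤ
    s₁ (i , x , y) = sg i
    s₂ (i , x , y) = sg x
    s₃ (i , x , y) = sg y
    s₃≡ : ∑ E s₃ ≡ ∑ E s₂
    s₃≡ = ∑-bij rotate≅ E E (λ _ → refl)
    s₂≡ : ∑ E s₂ ≡ ∑ E s₁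
    s₂≡ = ∑-bij rotate≅ E E (λ _ → refl)
    triple : + 3 * ∑ E s₁ ≡ ∑ E (λ a → s₁ a + (s₂ a + s₃ a))
    triple = sym (trans (∑-+ E s₁ (λ a → s₂ a + s₃ a)) (trans (+-congʳ (∑ E s₁) (trans (∑-+ E s₂ s₃) (cong₂ _+_ s₂≡ (trans s₃≡ s₂≡)))) (eq (∑ E s₁))))
      where
      eq : ∀ x → x + (x + x) ≡ + 3 * x
      eq = solve-∀

  squares-sum : ∑ Sq-enum (c ∘ proj₁) ≡ - (+ 8 * boundary)
  squares-sum = begin
    ∑ Sq-enum (c ∘ proj₁)     ≡⟨ ∑-cong Sq-enum (λ {(i , t)} (_ , z) → cong (λ x → + 3 * x - 1ℤ) (square-odd i (sym (ℤₚ.i-j≡0⇒i≡j n (i * i) z)))) ⟩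
    ∑ Sq-enum (λ _ → - + 4 * 1ℤ) ≡⟨ ∑-* (- + 4) Sq-enum one ⟩
    - + 4 * count Sq-enum     ≡⟨ cong (λ x → - + 4 * x) sym-count ⟩
    - + 4 * (count Sq⁺ + count Sq⁺) ≡⟨ cong (λ x → - + 4 * (x + x)) boundary≡ ⟨
    - + 4 * (boundary + boundary) ≡⟨ eq boundary ⟩
    - (+ 8 * boundary) ∎
    where
    open ≡-Reasoning
    eq : ∀ b → - + 4 * (b + b) ≡ - (+ 8 * b)
    eq = solve-∀
    neg≅ : (λ a → Sq a × Pos (- proj₁ a)) ≅ (λ a → Sq a × Pos (proj₁ a))
    neg≅ = record
      { to      = λ (i , t) → - i , t
      ; from    = λ (i , t) → - i , t
      ; to-∈    = λ {(i , t)} ((e , z) , p) → (e , trans (cong (λ x → n - x) (neg-sq i)) z) , p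
      ; from-∈  = λ {(i , t)} ((e , z) , p) → (e , trans (cong (λ x → n - x) (neg-sq i)) z) , pos≡ p (sym (ℤₚ.neg-involutive i))
      ; from-to = λ {(i , t)} _ → cong (_, t) (ℤₚ.neg-involutive i)
      ; to-from = λ {(i , t)} _ → cong (_, t) (ℤₚ.neg-involutive i)
      }
    sym-count : count Sq-enum ≡ count Sq⁺ + count Sq⁺
    sym-count = trans (∑-sign≢0 Sq-enum proj₁ one (λ { {(i , t)} (_ , z) refl → contra (square-odd 0ℤ (sym (ℤₚ.i-j≡0⇒i≡j n 0ℤ z))) }))
      (+-congʳ (count Sq⁺) (∑-bij neg≅ (negPart Sq-enum proj₁) Sq⁺ (λ _ → refl)))
      where
      contra : 1ℤ ≢ -1ℤ
      contra ()

  -- With `b = boundary`, the three summands of `defect` contribute 0 by symmetry of the three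
  -- squares, `-4 * 2b` by `characters`, and `8b`, because each of the `2b` roots of `n` is odd and
  -- has weight -4.
  defect-recurrence : ∑ (box ∣ n ∣) (λ i → c i * defect (n - i * i)) ≡ 0ℤ
  defect-recurrence = begin
    ∑ B (λ i → c i * defect (n - i * i))
      ≡⟨ ∑-cong B (λ {i} _ → eq₁ (c i) (r₂ (n - i * i)) (X (n - i * i)) (count (isZero (n - i * i)))) ⟩
    ∑ B (λ i → c i * r₂ (n - i * i) + (- + 4 * (c i * X (n - i * i)) + -1ℤ * (c i * count (isZero (n - i * i)))))
      ≡⟨ trans (∑-+ B f₁ (λ i → - + 4 * f₂ i + -1ℤ * f₃ i)) (+-congʳ (∑ B f₁) (trans (∑-+ B (λ i → - + 4 * f₂ i) (λ i → -1ℤ * f₃ i)) (cong₂ _+_ (∑-* (- + 4) B f₂) (∑-* -1ℤ B f₃)))) ⟩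
    ∑ B (λ i → c i * r₂ (n - i * i)) + (- + 4 * ∑ B (λ i → c i * X (n - i * i)) + -1ℤ * ∑ B (λ i → c i * count (isZero (n - i * i))))
      ≡⟨ cong₂ _+_ s₁ (cong₂ (λ x y → - + 4 * x + -1ℤ * y) s₂ s₃) ⟩
    0ℤ + (- + 4 * (+ 2 * boundary) + -1ℤ * - (+ 8 * boundary))
      ≡⟨ eq₂ boundary ⟩
    0ℤ ∎
    where
    open ≡-Reasoning
    B = box ∣ n ∣
    f₁ f₂ f₃ : ℤ → ℤ
    f₁ i = c i * r₂ (n - i * i)
    f₂ i = c i * X (n - i * i)
    f₃ i = c i * count (isZero (n - i * i))
    eq₁ : ∀ c r x z → c * (r - + 4 * x - z) ≡ c * r + (- + 4 * (c * x) + -1ℤ * (c * z))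
    eq₁ = solve-∀
    eq₂ : ∀ b → 0ℤ + (- + 4 * (+ 2 * b) + -1ℤ * - (+ 8 * b)) ≡ 0ℤ
    eq₂ = solve-∀
    s₁ : ∑ B (λ i → c i * r₂ (n - i * i)) ≡ 0ℤ
    s₁ = trans (∑-cong B (λ {i} _ → sym (trans (∑-cong (twoSquares (n - i * i)) (λ _ → sym (ℤₚ.*-identityʳ (c i)))) (∑-* (c i) (twoSquares (n - i * i)) one))))
      (trans (sym (∑-fibred ∣ n ∣ (λ i → twoSquares (n - i * i)) (λ {i} {t} → bound³ {i} {t}) (c ∘ proj₁))) three-squares-sum)
    s₃ : ∑ B (λ i → c i * count (isZero (n - i * i))) ≡ - (+ 8 * boundary)
    s₃ = trans (∑-cong B (λ {i} _ → sym (trans (∑-cong (isZero (n - i * i)) (λ _ → sym (ℤₚ.*-identityʳ (c i)))) (∑-* (c i) (isZero (n - i * i)) one))))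
      (trans (sym (∑-Sq (c ∘ proj₁))) squares-sum)
    s₂ : ∑ B (λ i → c i * X (n - i * i)) ≡ + 2 * boundary
    s₂ = begin
      ∑ B (λ i → c i * X (n - i * i))
        ≡⟨ ∑-cong B (λ {i} _ → sym (∑-* (c i) (factors (n - i * i)) (χ ∘ proj₂))) ⟩
      ∑ B (λ i → ∑ (factors (n - i * i)) (λ t → c i * χ (proj₂ t)))
        ≡⟨ ∑-Ω (λ (i , d , e) → c i * χ e) ⟨
      ∑ Ω-enum (λ (i , d , e) → c i * χ e)
        ≡⟨ ∑-cong Ω-enum (λ {(i , d , e)} _ → eq (sg i) (χ e)) ⟩
      ∑ Ω-enum (λ (i , d , e) → + 3 * (sg i * χ e) + -1ℤ * χ e)
        ≡⟨ trans (∑-+ Ω-enum (λ (i , d , e) → + 3 * (sg i * χ e)) (λ (i , d , e) → -1ℤ * χ e)) (cong₂ _+_ (∑-* (+ 3) Ω-enum w) (∑-* -1ℤ Ω-enum (λ (i , d , e) → χ e))) ⟩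
      + 3 * Σsgχ + -1ℤ * Σχ
        ≡⟨ cong (λ x → + 3 * Σsgχ + x) (ℤₚ.-1*i≡-i Σχ) ⟩
      + 3 * Σsgχ - Σχ
        ≡⟨ characters ⟩
      + 2 * boundary ∎
      where
      eq : ∀ a x → (+ 3 * a - 1ℤ) * x ≡ + 3 * (a * x) + -1ℤ * x
      eq = solve-∀

-- Jacobi's two-square formula for all integers

private
  empty : {A : Set} {P : A → Set} (E : Enum P) {w : A → ℤ} → (∀ {a} → P a → ⊥) → ∑ E w ≡ 0ℤ
  empty E h = ∑-zero E (λ p → ⊥-elim (h p))

  defect-vanishes : ∀ {n} → r₂ n ≡ 0ℤ → X n ≡ 0ℤ → n ≢ 0ℤ → defect n ≡ 0ℤ
  defect-vanishes {n} r x z = trans (cong₂ (λ a b → a - + 4 * b - count (isZero n)) r x) (cong (λ a → 0ℤ - a) (empty (isZero n) (λ (_ , e) → z e)))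

  defect-negative : ∀ {n} → n < 0ℤ → defect n ≡ 0ℤ
  defect-negative {n} n<0 = defect-vanishes
    (empty (twoSquares n) (λ {(x , y)} e → ℤₚ.<⇒≱ n<0 (subst (0ℤ ≤_) e (nonneg-+ (nonneg-sq x) (nonneg-sq y)))))
    (empty (factors n) (λ (p , q , e) → ℤₚ.<⇒≱ n<0 (subst (0ℤ ≤_) e (pos⇒nonneg (pos-* p q)))))
    (λ e → ℤₚ.<-irrefl e n<0)

  -- A sum of two squares is never 3 modulo 4. In a product `j * d` that is 3 modulo 4 one factor is
  -- 1 and the other 3, so exchanging the factors reverses the sign of the divisor sum.
  defect-three : ∀ q → defect (1ℤ + + 2 * (1ℤ + + 2 * q)) ≡ 0ℤ
  defect-three q = defect-vanishes (empty (twoSquares n) (λ {(x , y)} → no-squares x y)) no-X (λ e → odd≢even {0ℤ} {1ℤ + + 2 * q} (sym e))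
    where
    n = 1ℤ + + 2 * (1ℤ + + 2 * q)
    no-squares : ∀ x y → ¬ (x * x + y * y ≡ n)
    no-squares x y h with parity x | parity y
    ... | a , inj₁ refl | b , inj₁ refl = odd≢even {+ 2 * (a * a + b * b)} {1ℤ + + 2 * q} (trans (eq a b) h)
      where
      eq : ∀ a b → + 2 * (+ 2 * (a * a + b * b)) ≡ + 2 * a * (+ 2 * a) + + 2 * b * (+ 2 * b)
      eq = solve-∀
    ... | a , inj₂ refl | b , inj₂ refl = odd≢even {1ℤ + + 2 * (a * a + a + b * b + b)} {1ℤ + + 2 * q} (trans (eq a b) h)
      where
      eq : ∀ a b → + 2 * (1ℤ + + 2 * (a * a + a + b * b + b)) ≡ (1ℤ + + 2 * a) * (1ℤ + + 2 * a) + (1ℤ + + 2 * b) * (1ℤ + + 2 * b)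
      eq = solve-∀
    ... | a , inj₁ refl | b , inj₂ refl = odd≢even {a * a + b * b + b} {q} (cancel-double (trans (eq a b) (trans (cong (_- 1ℤ) h) (3+4x-1≡2[1+2x] q))))
      where
      eq : ∀ a b → + 2 * (+ 2 * (a * a + b * b + b)) ≡ + 2 * a * (+ 2 * a) + (1ℤ + + 2 * b) * (1ℤ + + 2 * b) - 1ℤ
      eq = solve-∀
    ... | a , inj₂ refl | b , inj₁ refl = odd≢even {a * a + b * b + a} {q} (cancel-double (trans (eq a b) (trans (cong (_- 1ℤ) h) (3+4x-1≡2[1+2x] q))))
      where
      eq : ∀ a b → + 2 * (+ 2 * (a * a + b * b + a)) ≡ (1ℤ + + 2 * a) * (1ℤ + + 2 * a) + + 2 * b * (+ 2 * b) - 1ℤ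
      eq = solve-∀
    opposite : ∀ j d → j * d ≡ n → χ d ≡ -1ℤ * χ j
    opposite j d h with parity j | parity d
    ... | a , inj₁ refl | b , _ = ⊥-elim (odd≢even {a * d} {1ℤ + + 2 * q} (trans (sym (ℤₚ.*-assoc (+ 2) a d)) h))
    ... | a , _ | b , inj₁ refl = ⊥-elim (odd≢even {j * b} {1ℤ + + 2 * q} (trans (2[xy]≡x[2y] j b) h))
    ... | a , inj₂ refl | b , inj₂ refl = trans (cong sg b≡) (trans (sg-+ (a + + 2 * (q - a * b - a)) 1ℤ) (trans (cong (_* -1ℤ) (trans (sg-+ a (+ 2 * (q - a * b - a))) (cong (λ x → sg a * x) (sg-even (q - a * b - a))))) (eq₃ (sg a))))
      where
      eq₁ : ∀ a b → + 2 * b ≡ (1ℤ + + 2 * a) * (1ℤ + + 2 * b) - 1ℤ - + 2 * a - + 4 * (a * b)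
      eq₁ = solve-∀
      eq₂ : ∀ a b q → 1ℤ + + 2 * (1ℤ + + 2 * q) - 1ℤ - + 2 * a - + 4 * (a * b) ≡ + 2 * (a + + 2 * (q - a * b - a) + 1ℤ)
      eq₂ = solve-∀
      eq₃ : ∀ x → x * 1ℤ * -1ℤ ≡ -1ℤ * x
      eq₃ = solve-∀
      b≡ : b ≡ a + + 2 * (q - a * b - a) + 1ℤ
      b≡ = cancel-double (trans (eq₁ a b) (trans (cong (λ x → x - 1ℤ - + 2 * a - + 4 * (a * b)) h) (eq₂ a b q)))
    swap≅ : Factor n ≅ Factor n
    swap≅ = record
      { to = λ (j , d) → d , j ; from = λ (j , d) → d , j
      ; to-∈ = λ {(j , d)} (p , q , e) → q , p , trans (ℤₚ.*-comm d j) e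
      ; from-∈ = λ {(j , d)} (p , q , e) → q , p , trans (ℤₚ.*-comm d j) e
      ; from-to = λ _ → refl ; to-from = λ _ → refl }
    no-X : X n ≡ 0ℤ
    no-X = self-neg⇒0 (trans (∑-bij swap≅ (factors n) (factors n) {v = λ (j , d) → -1ℤ * χ d} (λ {(j , d)} (_ , _ , e) → opposite j d e))
      (trans (∑-* -1ℤ (factors n) (χ ∘ proj₂)) (ℤₚ.-1*i≡-i (X n))))

  -- The map `(x, y)` to `(x - y, x + y)` doubles the sum of squares, and is onto because `x` and
  -- `y` have equal parity when that sum is even. On the divisor side, a factorisation of `2k` with
  -- odd `j` has even `d`, hence weight 0; halving an even `j` gives a factorisation of `k`.
  defect-even : ∀ k → k ≢ 0ℤ → defect (+ 2 * k) ≡ defect k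
  defect-even k k≢0 = cong₂ (λ a b → a - b) (cong₂ (λ a b → a - + 4 * b) r≡ X≡)
    (trans (empty (isZero (+ 2 * k)) (λ (_ , e) → k≢0 (cancel-double {k} {0ℤ} e))) (sym (empty (isZero k) (λ (_ , e) → k≢0 e))))
    where
    ev : ∀ x y → x * x + y * y ≡ + 2 * k → + 2 * half (y - x) ≡ y - x
    ev x y h = half-diff x y (k - y * y) (trans (eq₁ x y) (trans (cong (_- y * y) h) (eq₂ y k)))
      where
      eq₁ : ∀ x y → x * x ≡ x * x + y * y - y * y
      eq₁ = solve-∀
      eq₂ : ∀ y k → + 2 * k - y * y ≡ y * y + + 2 * (k - y * y)
      eq₂ = solve-∀
    squares≅ : TwoSquares k ≅ TwoSquares (+ 2 * k)
    squares≅ = record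
      { to      = λ (x , y) → x - y , x + y
      ; from    = λ (x , y) → x + half (y - x) , half (y - x)
      ; to-∈    = λ {(x , y)} h → trans (eq₁ x y) (cong (λ z → + 2 * z) h)
      ; from-∈  = λ {(x , y)} h → cancel-double (trans (eq₂ x (half (y - x))) (trans (cong (λ z → x * x + (x + z) * (x + z)) (ev x y h)) (trans (eq₃ x y) h)))
      ; from-to = λ {(x , y)} _ → let z = trans (cong half ([x+y]-[x-y]≡2y x y)) (half-double y) in
          cong₂ _,_ (trans (cong (λ t → x - y + t) z) ([x-y]+y≡x x y)) z
      ; to-from = λ {(x , y)} h → cong₂ _,_ ([x+y]-y≡x x (half (y - x))) (trans ([x+y]+y≡x+2y x (half (y - x))) (trans (cong (λ t → x + t) (ev x y h)) (x+[y-x]≡y x y)))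
      }
      where
      eq₁ : ∀ x y → (x - y) * (x - y) + (x + y) * (x + y) ≡ + 2 * (x * x + y * y)
      eq₁ = solve-∀
      eq₂ : ∀ x z → + 2 * ((x + z) * (x + z) + z * z) ≡ x * x + (x + + 2 * z) * (x + + 2 * z)
      eq₂ = solve-∀
      eq₃ : ∀ x y → x * x + (x + (y - x)) * (x + (y - x)) ≡ x * x + y * y
      eq₃ = solve-∀
    r≡ : r₂ (+ 2 * k) ≡ r₂ k
    r≡ = sym (∑-bij squares≅ (twoSquares k) (twoSquares (+ 2 * k)) (λ _ → refl))
    even? : (a : ℤ²) → Dec (sg (proj₁ a) ≡ 1ℤ)
    even? a = sg (proj₁ a) ≟ 1ℤ
    sg-half : ∀ j → sg j ≡ 1ℤ → + 2 * half j ≡ j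
    sg-half j e with parity j
    ... | a , inj₁ refl = refl
    sg-half j () | a , inj₂ refl
    even≅ : Factor k ≅ (λ a → Factor (+ 2 * k) a × sg (proj₁ a) ≡ 1ℤ)
    even≅ = record
      { to      = λ (j , d) → + 2 * j , d
      ; from    = λ (j , d) → half j , d
      ; to-∈    = λ {(j , d)} (p , q , e) → (pos-double p , q , trans (ℤₚ.*-assoc (+ 2) j d) (cong (λ z → + 2 * z) e)) , sg-even j
      ; from-∈  = λ {(j , d)} ((p , q , e) , s) → let h = sg-half j s in
          pos-half (pos≡ p (sym h)) , q , cancel-double (trans (sym (ℤₚ.*-assoc (+ 2) (half j) d)) (trans (cong (_* d) h) e))
      ; from-to = λ {(j , d)} _ → cong (_, d) (half-double j)
      ; to-from = λ {(j , d)} (_ , s) → cong (_, d) (sg-half j s)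
      }
    odd-factor : ∀ j d → j * d ≡ + 2 * k → sg j ≢ 1ℤ → χ d ≡ 0ℤ
    odd-factor j d e ne with parity j | parity d
    ... | a , inj₁ refl | _ = ⊥-elim (ne refl)
    ... | a , inj₂ refl | b , inj₁ refl = refl
    ... | a , inj₂ refl | b , inj₂ refl = ⊥-elim (odd≢even {k} {a + b + + 2 * (a * b)} (trans (sym e) (odd*odd a b)))
    X≡ : X (+ 2 * k) ≡ X k
    X≡ = trans (∑-split (factors (+ 2 * k)) even? (χ ∘ proj₂))
      (trans (cong₂ _+_ (sym (∑-bij even≅ (factors k) (restrict (factors (+ 2 * k)) even?) (λ _ → refl)))
        (∑-zero (restrict (factors (+ 2 * k)) (λ a → ¬? (even? a))) (λ {(j , d)} ((_ , _ , e) , ne) → odd-factor j d e ne))) (ℤₚ.+-identityʳ (X k)))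

  -- In the recurrence the term `i = 0` has coefficient `3 - 1 = 2`, and every other term has a
  -- smaller argument.
  defect-one : ∀ q → 0ℤ ≤ q → (∀ m → m < 1ℤ + + 4 * q → defect m ≡ 0ℤ) → defect (1ℤ + + 4 * q) ≡ 0ℤ
  defect-one q q≥0 ih = cancel-double {y = 0ℤ} (trans (trans (cong (λ x → + 2 * defect x) (sym (ℤₚ.+-identityʳ n)))
    (sym (∑-single (box ∣ n ∣) {λ i → (+ 3 * sg i - 1ℤ) * defect (n - i * i)} 0ℤ ℕ.z≤n others))) (defect-recurrence q))
    where
    n = 1ℤ + + 4 * q
    sq-pos : ∀ i → i ≢ 0ℤ → Pos (i * i)
    sq-pos (+ zero)  ne = ⊥-elim (ne refl)
    sq-pos (+ suc _) ne = +<+ (ℕ.s≤s ℕ.z≤n)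
    sq-pos -[1+ _ ]  ne = +<+ (ℕ.s≤s ℕ.z≤n)
    others : ∀ {i} → Box ∣ n ∣ i → i ≢ 0ℤ → (+ 3 * sg i - 1ℤ) * defect (n - i * i) ≡ 0ℤ
    others {i} _ ne = trans (cong (λ x → (+ 3 * sg i - 1ℤ) * x) (ih (n - i * i) smaller)) (ℤₚ.*-zeroʳ (+ 3 * sg i - 1ℤ))
      where
      smaller : n - i * i < n
      smaller = subst (n - i * i <_) (ℤₚ.+-identityʳ n) (ℤₚ.+-monoʳ-< n (ℤₚ.neg-mono-< (sq-pos i ne)))

  half< : ∀ {k y} → + k ≡ + 2 * y → y ≢ 0ℤ → ∃ λ y′ → y ≡ + y′ × y′ ℕ.< k
  half< {k} {+ zero}  e ne = ⊥-elim (ne refl)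
  half< {k} {+ suc y} e ne = suc y , refl , subst (suc y ℕ.<_) (sym (ℤₚ.+-injective e)) (ℕₚ.m<m+n (suc y) (ℕ.s≤s ℕ.z≤n))
  half< {k} { -[1+ y ]} () ne

  quarter≥0 : ∀ {k} q → + k ≡ 1ℤ + + 2 * (+ 2 * q) → 0ℤ ≤ q
  quarter≥0 (+ q) _ = +≤+ ℕ.z≤n
  quarter≥0 -[1+ zero ] ()
  quarter≥0 -[1+ suc q ] ()

defect≡0 : ∀ n → defect n ≡ 0ℤ
defect≡0 -[1+ n ] = defect-negative { -[1+ n ]} -<+
defect≡0 (+ k) = <-rec (λ k → defect (+ k) ≡ 0ℤ) step k
  where
  step : ∀ k → (∀ {j} → j ℕ.< k → defect (+ j) ≡ 0ℤ) → defect (+ k) ≡ 0ℤ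
  step zero ih = refl
  step k@(suc _) ih with parity (+ k)
  ... | y , inj₁ e with half< {k} {y} e (λ { refl → contra e })
    where
    contra : + k ≢ 0ℤ
    contra ()
  ...   | y′ , refl , y′<k = trans (cong defect e) (trans (defect-even (+ y′) (λ { refl → contra e })) (ih y′<k))
    where
    contra : + k ≢ 0ℤ
    contra ()
  step k@(suc _) ih | y , inj₂ e with parity y
  ... | q , inj₂ refl = trans (cong defect e) (defect-three q)
  ... | q , inj₁ refl = trans (cong defect e′) (defect-one q (quarter≥0 q e) below)
    where
    eq : ∀ q → 1ℤ + + 2 * (+ 2 * q) ≡ 1ℤ + + 4 * q
    eq = solve-∀
    e′ = trans e (eq q)
    below : ∀ m → m < 1ℤ + + 4 * q → defect m ≡ 0ℤ
    below -[1+ m ] _ = defect-negative { -[1+ m ]} -<+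
    below (+ m) h = ih (ℤₚ.drop‿+<+ (subst (+ m <_) (sym e′) h))

two-squares : ∀ n → r₂ n ≡ + 4 * X n + count (isZero n)
two-squares n = trans (eq (r₂ n) (+ 4 * X n) (count (isZero n))) (trans (cong (λ x → x + (+ 4 * X n + count (isZero n))) (defect≡0 n)) (ℤₚ.+-identityˡ _))
  where
  eq : ∀ r x z → r ≡ r - x - z + (x + z)
  eq = solve-∀

product : {A B : Set} {P : A → Set} {Q : B → Set} → Enum P → Enum Q → Enum (λ (p : A × B) → P (proj₁ p) × Q (proj₂ p))
product E F = sigma (λ _ → F) E

∑-product : {A B : Set} {P : A → Set} {Q : B → Set} (E : Enum P) (F : Enum Q) (w : A → ℤ) (v : B → ℤ) →
            ∑ (product E F) (λ (a , b) → w a * v b) ≡ ∑ E w * ∑ F v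
∑-product E F w v = trans (∑-sigma (λ _ → F) E (λ (a , b) → w a * v b))
  (trans (∑-cong E (λ {a} _ → trans (∑-* (w a) F v) (ℤₚ.*-comm (w a) (∑ F v)))) (trans (∑-* (∑ F v) E w) (ℤₚ.*-comm (∑ F v) (∑ E w))))

-- Representations by two squares plus twice two squares

module FourSquares (m : ℤ) where

  open Liouville m (λ _ → 0ℤ) sg (λ _ → ℤₚ.≤-refl) (λ _ → refl) sg-neg

  ℤ⁵ : Set
  ℤ⁵ = ℤ × (ℤ² × ℤ²)

  bound-t : ∀ {t r} → 0ℤ ≤ t → 0ℤ ≤ r → r ≡ N - + 2 * t → Box ∣ N ∣ t
  bound-t {t} {r} ht hr e = ∣∣-mono ht (subst (t ≤_) (trans (eq t r) (unmove {r} {+ 2 * t} {N} e)) (≤-+ʳ (nonneg-+ ht hr)))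
    where
    eq : ∀ t r → t + (t + r) ≡ r + + 2 * t
    eq = solve-∀

  C : ℤ⁵ → Set
  C (t , a , b) = Factor (N - + 2 * t) a × Factor t b

  private
    bound-C : ∀ {t p} → C (t , p) → Box ∣ N ∣ t
    bound-C {t} ((pd , pj , e) , (ph , ps , e′)) = bound-t {t} (subst (0ℤ ≤_) e′ (pos⇒nonneg (pos-* ph ps))) (pos⇒nonneg (pos-* pd pj)) e

    F : ∀ t → Enum _
    F t = product (factors (N - + 2 * t)) (factors t)

  C-enum : Enum C
  C-enum = fibred ∣ N ∣ F (λ {t} {p} → bound-C {t} {p})

  wC : ℤ⁵ → ℤ
  wC (t , (d , j) , (h , s)) = χ j * χ s

  S : ℤ
  S = ∑ C-enum wC

  S≡ : S ≡ ∑ (box ∣ N ∣) (λ t → X (N - + 2 * t) * X t)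
  S≡ = trans (∑-fibred ∣ N ∣ F (λ {t} {p} → bound-C {t} {p}) wC)
    (∑-cong (box ∣ N ∣) (λ {t} _ → ∑-product (factors (N - + 2 * t)) (factors t) (χ ∘ proj₂) (χ ∘ proj₂)))

  odd? : (a : ℤ⁵) → Dec (sg (proj₂ (proj₂ (proj₂ a))) ≡ -1ℤ)
  odd? a = sg (proj₂ (proj₂ (proj₂ a))) ≟ -1ℤ

  Cᵒ : ℤ⁵ → Set
  Cᵒ a = C a × sg (proj₂ (proj₂ (proj₂ a))) ≡ -1ℤ

  -- In `T₁` and `T₂` the number `s` has the parity of `j`, which is odd with `N`. The solutions in
  -- `C` with even `s` have weight `χ s = 0`, so discarding them leaves the sum unchanged.
  odd-part : S ≡ ∑ (restrict C-enum odd?) wC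
  odd-part = trans (∑-split C-enum odd? wC) (trans (+-congʳ (∑ (restrict C-enum odd?) wC)
    (∑-zero (restrict C-enum (λ a → ¬? (odd? a))) (λ {(t , (d , j) , (h , s))} (_ , ne) → trans (cong (λ x → χ j * x) (χ-vanishes s ne)) (ℤₚ.*-zeroʳ (χ j)))))
    (ℤₚ.+-identityʳ _))
    where
    χ-vanishes : ∀ s → sg s ≢ -1ℤ → χ s ≡ 0ℤ
    χ-vanishes s ne with parity s
    ... | _ , inj₁ _ = refl
    ... | _ , inj₂ _ = ⊥-elim (ne refl)

  odd-form : ∀ s → sg s ≡ -1ℤ → s ≡ 1ℤ + + 2 * half s
  odd-form s e with parity s
  ... | y , inj₂ refl = refl
  odd-form s () | y , inj₁ _

  odd-factor : ∀ d j r → d * j + + 2 * r ≡ N → j ≡ 1ℤ + + 2 * half j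
  odd-factor d j r e with parity j
  ... | y , inj₂ refl = refl
  ... | y , inj₁ refl = ⊥-elim (odd≢even {d * y + r} {m} (trans (eq d y r) e))
    where
    eq : ∀ d y r → + 2 * (d * y + r) ≡ d * (+ 2 * y) + + 2 * r
    eq = solve-∀

  odd-C : ∀ {t d j h s} → C (t , (d , j) , (h , s)) → j ≡ 1ℤ + + 2 * half j
  odd-C {t} {d} {j} ((_ , _ , e) , _) = odd-factor d j t (unmove {d * j} {+ 2 * t} {N} e)

  half-minus : ∀ s j → s ≡ 1ℤ + + 2 * half s → j ≡ 1ℤ + + 2 * half j → + 2 * half (s - j) ≡ s - j
  half-minus s j e e′ = even-half {y = half s - half j} (trans (cong₂ _-_ e e′) (eq (half s) (half j)))
    where
    eq : ∀ a b → 1ℤ + + 2 * a - (1ℤ + + 2 * b) ≡ + 2 * (a - b)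
    eq = solve-∀

  half-plus : ∀ s j → s ≡ 1ℤ + + 2 * half s → j ≡ 1ℤ + + 2 * half j → + 2 * half (s + j) ≡ s + j
  half-plus s j e e′ = even-half {y = 1ℤ + half s + half j} (trans (cong₂ _+_ e e′) (odd+odd (half s) (half j)))

  χχ-minus : ∀ j u → j ≡ 1ℤ + + 2 * half j → sg u ≡ χ j * χ (j + + 2 * u)
  χχ-minus j u e = sym (trans (cong (λ x → χ j * x) (χ-shift j u)) (trans (eq (χ j) (sg u)) (trans (cong (λ x → sg u * (x * x)) (trans (cong χ e) (χ-odd (half j))))
    (trans (cong (λ x → sg u * x) (sg-sq (half j))) (ℤₚ.*-identityʳ (sg u))))))
    where
    eq : ∀ c s → c * (s * c) ≡ s * (c * c)
    eq = solve-∀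

  T₁≅C : T₁ ≅ Cᵒ
  T₁≅C = record
    { to      = λ (j , d , u , h) → (j + + 2 * u) * h , (d , j) , (h , j + + 2 * u)
    ; from    = λ (t , (d , j) , (h , s)) → j , d , half (s - j) , h
    ; to-∈    = λ {(j , d , u , h)} (pj , pd , ph , ps , q) →
        ((pd , pj , move {y = + 2 * ((j + + 2 * u) * h)} {N} (trans (xy+2z≡yx+2z+0 d j ((j + + 2 * u) * h)) q)) , (ph , ps , ℤₚ.*-comm h (j + + 2 * u))) ,
        trans (sg-+ j (+ 2 * u)) (cong₂ _*_ (trans (cong sg (oddj j d ((j + + 2 * u) * h) q)) (sg-odd (half j))) (sg-even u))
    ; from-∈  = λ {(t , (d , j) , (h , s))} (c@((pd , pj , e) , (ph , ps , e′)) , o) →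
        let s≡ = recover s j (half-minus s j (odd-form s o) (odd-C {t} {d} {j} {h} {s} c)) in
        pj , pd , ph , pos≡ ps s≡ , trans (cong (λ x → j * d + + 2 * (x * h) + + 2 * 0ℤ) (sym s≡)) (trans (eq₂ d j h s) (trans (cong (λ x → d * j + + 2 * x) e′) (unmove {d * j} {+ 2 * t} {N} e)))
    ; from-to = λ {(j , d , u , h)} _ → tuple⁴ refl refl (trans (cong half ([x+2y]-x≡2y j u)) (half-double u)) refl
    ; to-from = λ {(t , (d , j) , (h , s))} (c@(_ , (_ , _ , e′)) , o) →
        let s≡ = recover s j (half-minus s j (odd-form s o) (odd-C {t} {d} {j} {h} {s} c)) in
        cong₂ _,_ (trans (cong (_* h) (sym s≡)) (trans (ℤₚ.*-comm s h) e′)) (cong (λ x → (d , j) , (h , x)) (sym s≡))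
    }
    where
    eq₂ : ∀ d j h s → j * d + + 2 * (s * h) + + 2 * 0ℤ ≡ d * j + + 2 * (h * s)
    eq₂ = solve-∀
    oddj : ∀ j d r → j * d + + 2 * r + + 2 * 0ℤ ≡ N → j ≡ 1ℤ + + 2 * half j
    oddj j d r q = odd-factor d j r (trans (xy+2z≡yx+2z+0 d j r) q)
    recover : ∀ s j → + 2 * half (s - j) ≡ s - j → s ≡ j + + 2 * half (s - j)
    recover s j e = trans (eq s j) (cong (λ x → j + x) (sym e))
      where
      eq : ∀ s j → s ≡ j + (s - j)
      eq = solve-∀

  T₂≅C : T₂ ≅ Cᵒ
  T₂≅C = record
    { to      = λ (j , d , u , h) → (+ 2 * u - j) * h , (d , j) , (h , + 2 * u - j)
    ; from    = λ (t , (d , j) , (h , s)) → j , d , half (s + j) , h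
    ; to-∈    = λ {(j , d , u , h)} (pj , pd , ph , ps , q) →
        ((pd , pj , move {y = + 2 * ((+ 2 * u - j) * h)} {N} (trans (xy+2z≡yx+2z+0 d j ((+ 2 * u - j) * h)) q)) , (ph , ps , ℤₚ.*-comm h (+ 2 * u - j))) ,
        trans (sg-+ (+ 2 * u) (- j)) (cong₂ _*_ (sg-even u) (trans (sg-neg j) (trans (cong sg (oddj j d ((+ 2 * u - j) * h) q)) (sg-odd (half j)))))
    ; from-∈  = λ {(t , (d , j) , (h , s))} (c@((pd , pj , e) , (ph , ps , e′)) , o) →
        let s≡ = recover s j (half-plus s j (odd-form s o) (odd-C {t} {d} {j} {h} {s} c)) in
        pj , pd , ph , pos≡ ps s≡ , trans (cong (λ x → j * d + + 2 * (x * h) + + 2 * 0ℤ) (sym s≡)) (trans (eq₂ d j h s) (trans (cong (λ x → d * j + + 2 * x) e′) (unmove {d * j} {+ 2 * t} {N} e)))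
    ; from-to = λ {(j , d , u , h)} _ → tuple⁴ refl refl (trans (cong half ([2y-x]+x≡2y j u)) (half-double u)) refl
    ; to-from = λ {(t , (d , j) , (h , s))} (c@(_ , (_ , _ , e′)) , o) →
        let s≡ = recover s j (half-plus s j (odd-form s o) (odd-C {t} {d} {j} {h} {s} c)) in
        cong₂ _,_ (trans (cong (_* h) (sym s≡)) (trans (ℤₚ.*-comm s h) e′)) (cong (λ x → (d , j) , (h , x)) (sym s≡))
    }
    where
    eq₂ : ∀ d j h s → j * d + + 2 * (s * h) + + 2 * 0ℤ ≡ d * j + + 2 * (h * s)
    eq₂ = solve-∀
    oddj : ∀ j d r → j * d + + 2 * r + + 2 * 0ℤ ≡ N → j ≡ 1ℤ + + 2 * half j
    oddj j d r q = odd-factor d j r (trans (xy+2z≡yx+2z+0 d j r) q)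
    recover : ∀ s j → + 2 * half (s + j) ≡ s + j → s ≡ + 2 * half (s + j) - j
    recover s j e = trans (x≡[x+y]-y s j) (cong (_- j) (sym e))

  private
    oddj : ∀ j d r → j * d + + 2 * r + + 2 * 0ℤ ≡ N → j ≡ 1ℤ + + 2 * half j
    oddj j d r q = odd-factor d j r (trans (xy+2z≡yx+2z+0 d j r) q)

  S₁≡ : S₁ ≡ S
  S₁≡ = trans (∑-bij T₁≅C T₁-enum (restrict C-enum odd?) (λ {(j , d , u , h)} (_ , _ , _ , _ , q) → χχ-minus j u (oddj j d ((j + + 2 * u) * h) q))) (sym odd-part)

  S₂≡ : S₂ ≡ - S
  S₂≡ = trans (∑-bij T₂≅C T₂-enum (restrict C-enum odd?) {v = λ a → -1ℤ * wC a} (λ {(j , d , u , h)} (_ , _ , _ , _ , q) → χχ-plus j u (oddj j d ((+ 2 * u - j) * h) q)))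
    (trans (∑-* -1ℤ (restrict C-enum odd?) wC) (trans (ℤₚ.-1*i≡-i (∑ (restrict C-enum odd?) wC)) (cong -_ (sym odd-part))))
    where
    eq₁ : ∀ j u → + 2 * u - j ≡ - (j + + 2 * - u)
    eq₁ = solve-∀
    eq₂ : ∀ a b → -1ℤ * (a * - b) ≡ a * b
    eq₂ = solve-∀
    χχ-plus : ∀ j u → j ≡ 1ℤ + + 2 * half j → sg u ≡ -1ℤ * (χ j * χ (+ 2 * u - j))
    χχ-plus j u e = trans (sym (sg-neg u)) (trans (χχ-minus j (- u) e)
      (sym (trans (cong (λ x → -1ℤ * (χ j * x)) (trans (cong χ (eq₁ j u)) (χ-neg (j + + 2 * - u)))) (eq₂ (χ j) (χ (j + + 2 * - u))))))

  l₀ : ℤ³ → ℤ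
  l₀ (j , d , u) = j - + 2 * u - + 2

  T₀⁺≅T₀⁺ : (λ a → T₀ a × Pos (l₀ a)) ≅ (λ a → T₀ a × Pos (l₀ a))
  T₀⁺≅T₀⁺ = record
    { to = φ ; from = φ ; to-∈ = λ {a} → φ-∈ {a} ; from-∈ = λ {a} → φ-∈ {a}
    ; from-to = λ {(j , d , u)} _ → tuple³ refl refl (eq₁ u)
    ; to-from = λ {(j , d , u)} _ → tuple³ refl refl (eq₁ u)
    }
    where
    φ : ℤ³ → ℤ³
    φ (j , d , u) = j , d , -1ℤ - u
    eq₁ : ∀ u → -1ℤ - (-1ℤ - u) ≡ u
    eq₁ = solve-∀
    eq₂ : ∀ j u → j - + 2 * u - + 2 ≡ j + + 2 * (-1ℤ - u)
    eq₂ = solve-∀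
    eq₃ : ∀ j u → j + + 2 * u + + 2 ≡ j - + 2 * (-1ℤ - u)
    eq₃ = solve-∀
    eq₄ : ∀ j u → j + + 2 * u ≡ j - + 2 * (-1ℤ - u) - + 2
    eq₄ = solve-∀
    φ-∈ : ∀ {a} → T₀ a × Pos (l₀ a) → T₀ (φ a) × Pos (l₀ (φ a))
    φ-∈ {j , d , u} ((pj , pd , p⁺ , p⁻ , q) , pl) =
      (pj , pd , pos≡ pl (eq₂ j u) , pos≡ (pos-+ p⁺ (+<+ (ℕ.s≤s ℕ.z≤n))) (eq₃ j u) , q) , pos≡ p⁺ (eq₄ j u)

  T₀⁻≅Factor : (λ a → T₀ a × Pos (- l₀ a)) ≅ Factor N
  T₀⁻≅Factor = record
    { to      = λ (j , d , u) → d , j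
    ; from    = λ (d , j) → j , d , half j
    ; to-∈    = λ {(j , d , u)} ((pj , pd , _ , _ , q) , _) → pd , pj , trans (eq₀ j d) q
    ; from-∈  = λ {(d , j)} (pd , pj , q) → let j≡ = odd-factor d j 0ℤ (trans (ℤₚ.+-identityʳ (d * j)) q) in
        (pj , pd , pos≡ (odd-pos pj) (trans (eq₅ j) (cong (λ x → j + x) (trans (cong (_- 1ℤ) j≡) (sym (eq₃ (half j)))))) , pos≡ (+<+ (ℕ.s≤s ℕ.z≤n)) (trans (eq₁ (half j)) (cong (_- + 2 * half j) (sym j≡))) , trans (sym (eq₀ j d)) q) ,
        pos≡ (+<+ (ℕ.s≤s ℕ.z≤n)) (trans (eq₂ (half j)) (cong (λ x → - (x - + 2 * half j - + 2)) (sym j≡)))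
    ; from-to = λ {(j , d , u)} ((pj , pd , p⁺ , p⁻ , q) , pl) → tuple³ refl refl (cancel-double (trans (eq₃ (half j)) (trans (cong (_- 1ℤ) (sym (odd-factor d j 0ℤ (trans (ℤₚ.+-identityʳ (d * j)) (trans (eq₀ j d) q))))) (trans (cong (λ x → j - x) (sym (between p⁻ pl))) (x-[x-2y]≡2y j u)))))
    ; to-from = λ _ → refl
    }
    where
    eq₀ : ∀ j d → d * j ≡ j * d + + 2 * 0ℤ
    eq₀ = solve-∀
    eq₁ : ∀ x → 1ℤ ≡ 1ℤ + + 2 * x - + 2 * x
    eq₁ = solve-∀
    eq₂ : ∀ x → 1ℤ ≡ - (1ℤ + + 2 * x - + 2 * x - + 2)
    eq₂ = solve-∀
    eq₃ : ∀ x → + 2 * x ≡ 1ℤ + + 2 * x - 1ℤ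
    eq₃ = solve-∀
    eq₅ : ∀ j → + 2 * j - 1ℤ ≡ j + (j - 1ℤ)
    eq₅ = solve-∀

  -- For each factor `j` of `N` this is the sum of `(-1)^u` over `|u| ≤ (j - 1)/2`. Pairing `u` with
  -- `-1 - u` leaves only `u = (j - 1)/2`, whose sign is `χ j`.
  S₀≡ : S₀ ≡ X N
  S₀≡ = trans (∑-sign≢0 T₀-enum l₀ w (λ {(j , d , u)} (_ , _ , _ , _ , q) z → odd≢even {(u + 1ℤ) * d} {m} (trans (eq₁ d u) (trans (cong (λ x → x * d + + 2 * (u + 1ℤ) * d) (sym z)) (trans (eq₂ j d u) q)))))
    (trans (cong₂ _+_ vanish (∑-bij T₀⁻≅Factor (negPart T₀-enum l₀) (factors N) weight)) (ℤₚ.+-identityˡ (X N)))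
    where
    w : ℤ³ → ℤ
    w (j , d , u) = sg u
    eq₁ : ∀ d u → + 2 * ((u + 1ℤ) * d) ≡ 0ℤ * d + + 2 * (u + 1ℤ) * d
    eq₁ = solve-∀
    eq₂ : ∀ j d u → (j - + 2 * u - + 2) * d + + 2 * (u + 1ℤ) * d ≡ j * d + + 2 * 0ℤ
    eq₂ = solve-∀
    vanish : ∑ (posPart T₀-enum l₀) w ≡ 0ℤ
    vanish = self-neg⇒0 (trans (∑-bij T₀⁺≅T₀⁺ (posPart T₀-enum l₀) (posPart T₀-enum l₀) {v = λ a → -1ℤ * w a} (λ {(j , d , u)} _ → opposite u))
      (trans (∑-* -1ℤ (posPart T₀-enum l₀) w) (ℤₚ.-1*i≡-i _)))
      where
      eq : ∀ s → -1ℤ * (-1ℤ * s) ≡ s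
      eq = solve-∀
      opposite : ∀ u → sg u ≡ -1ℤ * sg (-1ℤ - u)
      opposite u = sym (trans (cong (λ x → -1ℤ * x) (trans (sg-+ -1ℤ (- u)) (cong (λ x → -1ℤ * x) (sg-neg u)))) (eq (sg u)))
    weight : ∀ {a} → T₀ a × Pos (- l₀ a) → w a ≡ χ (proj₁ a)
    weight {j , d , u} ((_ , _ , _ , p⁻ , _) , pl) = sym (trans (cong χ (trans (eq₃ j u) (cong (_+ + 2 * u) (between p⁻ pl)))) (χ-odd u))
      where
      eq₃ : ∀ j u → j ≡ j - + 2 * u + + 2 * u
      eq₃ = solve-∀

  -- Jacobi's formula turns the sum into `16S + 4 X N`; the correction at zero matters only for
  -- `t = 0`, as `N - 2t` is odd. For odd `j` and `s` the signs of `(s - j)/2` and `(s + j)/2` are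
  -- `χ j * χ s` and its negative, so `S₁ = S` and `S₂ = -S`, and `liouville` reads
  -- `4S + X N = mass N`.
  four-squares : ∑ (box ∣ N ∣) (λ t → r₂ (N - + 2 * t) * r₂ t) ≡ + 4 * mass N
  four-squares = begin
    ∑ Bx (λ t → r₂ (N - + 2 * t) * r₂ t)
      ≡⟨ ∑-cong Bx (λ {t} _ → trans (cong₂ _*_ (r≡ t) (two-squares t)) (eq₁ (X (N - + 2 * t)) (X t) (count (isZero t)))) ⟩
    ∑ Bx (λ t → + 16 * (X (N - + 2 * t) * X t) + + 4 * (X (N - + 2 * t) * count (isZero t)))
      ≡⟨ trans (∑-+ Bx (λ t → + 16 * f t) (λ t → + 4 * g t)) (cong₂ _+_ (∑-* (+ 16) Bx f) (∑-* (+ 4) Bx g)) ⟩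
    + 16 * ∑ Bx f + + 4 * ∑ Bx g
      ≡⟨ cong₂ (λ x y → + 16 * x + + 4 * y) (sym S≡) single ⟩
    + 16 * S + + 4 * X N
      ≡⟨ eq₂ S (X N) ⟩
    + 4 * (+ 2 * S - + 2 * - S + X N)
      ≡⟨ cong₂ (λ x y → + 4 * (+ 2 * x - + 2 * y + X N)) (sym S₁≡) (sym S₂≡) ⟩
    + 4 * (+ 2 * S₁ - + 2 * S₂ + X N)
      ≡⟨ cong (λ x → + 4 * (+ 2 * S₁ - + 2 * S₂ + x)) (sym S₀≡) ⟩
    + 4 * (+ 2 * S₁ - + 2 * S₂ + S₀)
      ≡⟨ cong (λ x → + 4 * x) (liouville refl refl) ⟩
    + 4 * mass N ∎
    where
    open ≡-Reasoning
    Bx = box ∣ N ∣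
    f g : ℤ → ℤ
    f t = X (N - + 2 * t) * X t
    g t = X (N - + 2 * t) * count (isZero t)
    eq₁ : ∀ x y z → + 4 * x * (+ 4 * y + z) ≡ + 16 * (x * y) + + 4 * (x * z)
    eq₁ = solve-∀
    eq₂ : ∀ s x → + 16 * s + + 4 * x ≡ + 4 * (+ 2 * s - + 2 * - s + x)
    eq₂ = solve-∀
    r≡ : ∀ t → r₂ (N - + 2 * t) ≡ + 4 * X (N - + 2 * t)
    r≡ t = trans (two-squares (N - + 2 * t)) (trans (+-congʳ (+ 4 * X (N - + 2 * t)) (∑-zero (isZero (N - + 2 * t))
      (λ (_ , e) → ⊥-elim (odd≢even {t} {m} (sym (ℤₚ.i-j≡0⇒i≡j N (+ 2 * t) e)))))) (ℤₚ.+-identityʳ _))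
    single : ∑ Bx g ≡ X N
    single = trans (∑-single Bx 0ℤ ℕ.z≤n (λ {t} _ ne → trans (cong (λ x → X (N - + 2 * t) * x) (∑-zero (isZero t) (λ (_ , e) → ⊥-elim (ne e)))) (ℤₚ.*-zeroʳ (X (N - + 2 * t)))))
      (trans (ℤₚ.*-identityʳ (X (N - 0ℤ))) (cong X (ℤₚ.+-identityʳ N)))

-- Ternary forms

module _ {A : Set} {P : A → Set} where

  ∑-empty : (E : Enum P) {w : A → ℤ} → (∀ {a} → P a → ⊥) → ∑ E w ≡ 0ℤ
  ∑-empty E h = ∑-zero E (λ p → ⊥-elim (h p))

EvenForm : ℤ → ℤ³ → Set
EvenForm n (z , t) = TwoSquares (n - + 2 * (z * z)) t

bound-EvenForm : ∀ {n z t} → EvenForm n (z , t) → Box ∣ n ∣ z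
bound-EvenForm {n} {z} {x , y} h = bound-sq {z} (nonneg-+ (nonneg-+ (nonneg-sq x) (nonneg-sq y)) (nonneg-sq z))
  (trans (x²+[y+x²]≡y+2x² z (x * x + y * y)) (unmove {y = + 2 * (z * z)} {n} h))

evenForms : ∀ n → Enum (EvenForm n)
evenForms n = fibred ∣ n ∣ (λ z → twoSquares (n - + 2 * (z * z))) (λ {z} {t} → bound-EvenForm {n} {z} {t})

OddForm : ℤ → ℤ³ → Set
OddForm n (o , w , z) = o * o + + 4 * (w * w + z * z) ≡ n

oddForms : ∀ n → Enum (OddForm n)
oddForms n = enum³ ∣ n ∣ (λ (o , w , z) → o * o + + 4 * (w * w + z * z) ≟ n)
  λ {o} {w} {z} h →
    bound-sq {o} (nonneg-* {+ 4} (+≤+ ℕ.z≤n) (nonneg-+ (nonneg-sq w) (nonneg-sq z))) h ,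
    bound-sq {w} (nonneg-+ (nonneg-sq o) (nonneg-+ (nonneg-* {+ 3} (+≤+ ℕ.z≤n) (nonneg-sq w)) (nonneg-* {+ 4} (+≤+ ℕ.z≤n) (nonneg-sq z)))) (trans (eq₁ o w z) h) ,
    bound-sq {z} (nonneg-+ (nonneg-sq o) (nonneg-+ (nonneg-* {+ 3} (+≤+ ℕ.z≤n) (nonneg-sq z)) (nonneg-* {+ 4} (+≤+ ℕ.z≤n) (nonneg-sq w)))) (trans (eq₂ o w z) h)
  where
  eq₁ : ∀ o w z → w * w + (o * o + (+ 3 * (w * w) + + 4 * (z * z))) ≡ o * o + + 4 * (w * w + z * z)
  eq₁ = solve-∀
  eq₂ : ∀ o w z → z * z + (o * o + (+ 3 * (z * z) + + 4 * (w * w))) ≡ o * o + + 4 * (w * w + z * z)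
  eq₂ = solve-∀

module _ (m : ℤ) where

  private
    N N₂ : ℤ
    N = 1ℤ + + 2 * m
    N₂ = + 2 * N

    one : {A : Set} → A → ℤ
    one _ = 1ℤ

    G : ℤ × (ℤ² × ℤ²) → Set
    G (t , a , b) = TwoSquares (N - + 2 * t) a × TwoSquares t b

    H : ∀ t → Enum _
    H t = product (twoSquares (N - + 2 * t)) (twoSquares t)

    bound-G : ∀ {t p} → G (t , p) → Box ∣ N ∣ t
    bound-G {t} {(x , y) , (w , z)} (e , e′) = FourSquares.bound-t m {t} (subst (0ℤ ≤_) e′ (nonneg-+ (nonneg-sq w) (nonneg-sq z))) (nonneg-+ (nonneg-sq x) (nonneg-sq y)) e

    G-enum : Enum G
    G-enum = fibred ∣ N ∣ H (λ {t} {p} → bound-G {t} {p})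

    count-G : count G-enum ≡ + 4 * mass N
    count-G = trans (∑-fibred ∣ N ∣ H (λ {t} {p} → bound-G {t} {p}) one)
      (trans (∑-cong (box ∣ N ∣) (λ {t} _ → ∑-product (twoSquares (N - + 2 * t)) (twoSquares t) one one)) (FourSquares.four-squares m))

    E₂ : ℤ⁴ → Set
    E₂ (w , t) = EvenForm (N - + 2 * (w * w)) t

    bound-E₂ : ∀ {w t} → E₂ (w , t) → Box ∣ N ∣ w
    bound-E₂ {w} {z , x , y} h = bound-sq {w} {N = N} (nonneg-+ (nonneg-sq w) (nonneg-+ (nonneg-double (nonneg-sq z)) (nonneg-+ (nonneg-sq x) (nonneg-sq y))))
      (trans (eq w z (x * x + y * y)) (unmove {y = + 2 * (w * w)} {N} (unmove {y = + 2 * (z * z)} h)))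
      where
      eq : ∀ w z r → w * w + (w * w + (+ 2 * (z * z) + r)) ≡ r + + 2 * (z * z) + + 2 * (w * w)
      eq = solve-∀

    E₂-enum : Enum E₂
    E₂-enum = fibred ∣ N ∣ (λ w → evenForms (N - + 2 * (w * w))) (λ {w} {t} → bound-E₂ {w} {t})

    E₂≅G : E₂ ≅ G
    E₂≅G = record
      { to      = λ (w , z , a) → w * w + z * z , a , (w , z)
      ; from    = λ (t , a , (w , z)) → w , z , a
      ; to-∈    = λ {(w , z , x , y)} h → trans h (eq₁ w z N) , refl
      ; from-∈  = λ {(t , (x , y) , (w , z))} (h , h′) → trans h (trans (cong (λ x → N - + 2 * x) (sym h′)) (sym (eq₁ w z N)))
      ; from-to = λ _ → refl
      ; to-from = λ {(t , a , (w , z))} (h , h′) → cong (λ x → x , a , (w , z)) h′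
      }
      where
      eq₁ : ∀ w z N → N - + 2 * (w * w) - + 2 * (z * z) ≡ N - + 2 * (w * w + z * z)
      eq₁ = solve-∀

    O₂ : ℤ⁴ → Set
    O₂ (k , t) = OddForm (N₂ - k * k) t

    bound-O₂ : ∀ {k t} → O₂ (k , t) → Box ∣ N₂ ∣ k
    bound-O₂ {k} {o , w , z} h = bound-sq {k} {N = N₂} (nonneg-+ (nonneg-sq o) (nonneg-* {+ 4} (+≤+ ℕ.z≤n) (nonneg-+ (nonneg-sq w) (nonneg-sq z))))
      (trans (ℤₚ.+-comm (k * k) _) (unmove {y = k * k} {N₂} h))

    O₂-enum : Enum O₂
    O₂-enum = fibred ∣ N₂ ∣ (λ k → oddForms (N₂ - k * k)) (λ {k} {t} → bound-O₂ {k} {t})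

    ev : ∀ k o w z → o * o + + 4 * (w * w + z * z) ≡ N₂ - k * k → + 2 * half (o - k) ≡ o - k
    ev k o w z h = half-diff k o (N - o * o - + 2 * (w * w + z * z)) (trans (x²≡2y-[2y-x²] k N) (trans (cong (λ x → + 2 * N - x) (sym h)) (eq₂ o (w * w + z * z) N)))
      where
      eq₂ : ∀ o r N → + 2 * N - (o * o + + 4 * r) ≡ o * o + + 2 * (N - o * o - + 2 * r)
      eq₂ = solve-∀

    -- As `k` and `o` have equal parity, `k = x - y` and `o = x + y` turn `k² + o²` into
    -- `2(x² + y²)`; half of the equation is then `x² + y² + 2(w² + z²) = N`. So both ternary forms
    -- are fibres of one and the same quaternary count.
    O₂≅G : O₂ ≅ G
    O₂≅G = record
      { to      = λ (k , o , w , z) → w * w + z * z , (k + half (o - k) , half (o - k)) , (w , z)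
      ; from    = λ (t , (x , y) , (w , z)) → x - y , x + y , w , z
      ; to-∈    = λ {(k , o , w , z)} h → move {y = + 2 * (w * w + z * z)} {N} (cancel-double (trans (eq₁ k (half (o - k)) (w * w + z * z))
          (trans (cong (λ x → k * k + (k + x) * (k + x) + + 4 * (w * w + z * z)) (ev k o w z h)) (trans (eq₂ k o (w * w + z * z)) (unmove {y = k * k} {N₂} h))))) , refl
      ; from-∈  = λ {(t , (x , y) , (w , z))} (h , h′) → move {y = (x - y) * (x - y)} {N₂} (trans (eq₃ x y (w * w + z * z))
          (cong (λ x → + 2 * x) (trans (cong (λ s → x * x + y * y + + 2 * s) h′) (unmove {y = + 2 * t} {N} h))))
      ; from-to = λ {(k , o , w , z)} h → tuple⁴ ([x+y]-y≡x k (half (o - k))) (trans ([x+y]+y≡x+2y k (half (o - k))) (trans (cong (λ x → k + x) (ev k o w z h)) (x+[y-x]≡y k o))) refl refl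
      ; to-from = λ {(t , (x , y) , (w , z))} (h , h′) → let y≡ = trans (cong half ([x+y]-[x-y]≡2y x y)) (half-double y) in
          cong₂ _,_ h′ (cong (_, (w , z)) (cong₂ _,_ (trans (cong (λ v → x - y + v) y≡) ([x-y]+y≡x x y)) y≡))
      }
      where
      eq₁ : ∀ k v r → + 2 * ((k + v) * (k + v) + v * v + + 2 * r) ≡ k * k + (k + + 2 * v) * (k + + 2 * v) + + 4 * r
      eq₁ = solve-∀
      eq₂ : ∀ k o r → k * k + (k + (o - k)) * (k + (o - k)) + + 4 * r ≡ o * o + + 4 * r + k * k
      eq₂ = solve-∀
      eq₃ : ∀ x y r → (x + y) * (x + y) + + 4 * r + (x - y) * (x - y) ≡ + 2 * (x * x + y * y + + 2 * r)
      eq₃ = solve-∀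

    difference : ∀ {B : ℤ → Set} (E : Enum B) (f g : ℤ → ℤ) k → ∑ E (λ i → f i - k * g i) ≡ ∑ E f - k * ∑ E g
    difference E f g k = trans (∑-cong E (λ {i} _ → cong (λ x → f i + x) (ℤₚ.neg-distribˡ-* k (g i)))) (trans (∑-+ E f (λ i → - k * g i))
      (+-congʳ (∑ E f) (trans (∑-* (- k) E g) (sym (ℤₚ.neg-distribˡ-* k (∑ E g))))))

  even-recurrence : ∑ (box ∣ 1ℤ + + 2 * m ∣) (λ w → count (evenForms (1ℤ + + 2 * m - + 2 * (w * w))) - + 4 * c₂ (1ℤ + + 2 * m - + 2 * (w * w))) ≡ 0ℤ
  even-recurrence = trans (difference (box ∣ N ∣) (λ w → count (evenForms (N - + 2 * (w * w)))) (λ w → c₂ (N - + 2 * (w * w))) (+ 4))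
    (trans (cong₂ (λ x y → x - + 4 * y)
      (trans (sym (∑-fibred ∣ N ∣ (λ w → evenForms (N - + 2 * (w * w))) (λ {w} {t} → bound-E₂ {w} {t}) one)) (trans (∑-bij E₂≅G E₂-enum G-enum (λ _ → refl)) count-G))
      (EvenRelation.even-relation m)) (ℤₚ.+-inverseʳ (+ 4 * mass N)))

  odd-recurrence : ∑ (box ∣ + 2 * (1ℤ + + 2 * m) ∣) (λ k → count (oddForms (+ 2 * (1ℤ + + 2 * m) - k * k)) - + 2 * c₁ (+ 2 * (1ℤ + + 2 * m) - k * k)) ≡ 0ℤ
  odd-recurrence = trans (difference (box ∣ N₂ ∣) (λ k → count (oddForms (N₂ - k * k))) (λ k → c₁ (N₂ - k * k)) (+ 2))
    (trans (cong₂ (λ x y → x - + 2 * y)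
      (trans (sym (∑-fibred ∣ N₂ ∣ (λ k → oddForms (N₂ - k * k)) (λ {k} {t} → bound-O₂ {k} {t}) one)) (trans (∑-bij O₂≅G O₂-enum G-enum (λ _ → refl)) count-G))
      (OddRelation.odd-relation m)) (eq (mass N)))
    where
    eq : ∀ x → + 4 * x - + 2 * (+ 2 * x) ≡ 0ℤ
    eq = solve-∀

sq-pos : ∀ i → i ≢ 0ℤ → Pos (i * i)
sq-pos (+ zero)  ne = ⊥-elim (ne refl)
sq-pos (+ suc _) ne = +<+ (ℕ.s≤s ℕ.z≤n)
sq-pos -[1+ _ ]  ne = +<+ (ℕ.s≤s ℕ.z≤n)

sub-pos< : ∀ n {x} → Pos x → n - x < n
sub-pos< n {x} p = subst (n - x <_) (ℤₚ.+-identityʳ n) (ℤₚ.+-monoʳ-< n (ℤₚ.neg-mono-< p))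

-- Negative integers are included because the boxes of the recurrences reach negative arguments,
-- where all solution sets are empty.
ℤ-rec : (P : ℤ → Set) → (∀ {n} → n < 0ℤ → P n) → (∀ n → 0ℤ ≤ n → (∀ k → k < n → P k) → P n) → ∀ n → P n
ℤ-rec P negative step -[1+ n ] = negative -<+
ℤ-rec P negative step (+ n) = <-rec (λ n → P (+ n)) (λ n ih → step (+ n) (+≤+ ℕ.z≤n) (below ih)) n
  where
  below : ∀ {n} → (∀ {j} → j ℕ.< n → P (+ j)) → ∀ k → k < + n → P k
  below ih -[1+ k ] _ = negative -<+
  below ih (+ k) (+<+ h) = ih h

-- The term `w = 0` of `even-recurrence` is the claim for `m`; the term at any other `w` is the
-- claim for the smaller `m - w * w`.
count-evenForms : ∀ m → count (evenForms (1ℤ + + 2 * m)) - + 4 * c₂ (1ℤ + + 2 * m) ≡ 0ℤ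
count-evenForms = ℤ-rec (λ m → excess (1ℤ + + 2 * m) ≡ 0ℤ) (λ {m} → negative m) step
  where
  excess : ℤ → ℤ
  excess n = count (evenForms n) - + 4 * c₂ n
  negative : ∀ m → m < 0ℤ → excess (1ℤ + + 2 * m) ≡ 0ℤ
  negative m m<0 = cong₂ (λ x y → x - + 4 * y)
    (∑-empty (evenForms n) (λ {(z , x , y)} h → contra (trans (ℤₚ.+-comm (+ 2 * (z * z)) _) (unmove {y = + 2 * (z * z)} {n} h)) (nonneg-+ (nonneg-double (nonneg-sq z)) (nonneg-+ (nonneg-sq x) (nonneg-sq y)))))
    (cong₂ _+_ (∑-empty (triples n) (λ (pl , pp , pv , h) → contra h (nonneg-+ (pos⇒nonneg (pos-double (pos-* pl pp))) (pos⇒nonneg (pos-* pv (pos-+ pl pp))))))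
               (∑-empty (factors n) (λ (pj , pd , h) → contra h (pos⇒nonneg (pos-* pj pd)))))
    where
    n = 1ℤ + + 2 * m
    below : ∀ m → m < 0ℤ → 1ℤ + + 2 * m < 0ℤ
    below -[1+ zero ] -<+ = -<+
    below -[1+ suc k ] -<+ = -<+
    contra : ∀ {x} → x ≡ n → 0ℤ ≤ x → ⊥
    contra refl h = ℤₚ.<⇒≱ (below m m<0) h
  step : ∀ m → 0ℤ ≤ m → (∀ k → k < m → excess (1ℤ + + 2 * k) ≡ 0ℤ) → excess (1ℤ + + 2 * m) ≡ 0ℤ
  step m _ ih = trans (cong excess (sym (ℤₚ.+-identityʳ (1ℤ + + 2 * m))))
    (trans (sym (∑-single (box ∣ 1ℤ + + 2 * m ∣) 0ℤ ℕ.z≤n (λ {w} _ ne → trans (cong excess (eq m (w * w))) (ih (m - w * w) (sub-pos< m (sq-pos w ne)))))) (even-recurrence m))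
    where
    eq : ∀ m s → 1ℤ + + 2 * m - + 2 * s ≡ 1ℤ + + 2 * (m - s)
    eq = solve-∀

excess₁ : ℤ → ℤ
excess₁ n = count (oddForms n) - + 2 * c₁ n

excess₁-empty : ∀ {n} → (∀ t → ¬ OddForm n t) → (∀ t → ¬ OddTriple n t) → (∀ t → ¬ OddPair n t) → excess₁ n ≡ 0ℤ
excess₁-empty {n} h₁ h₂ h₃ = cong₂ (λ x y → x - + 2 * y) (∑-empty (oddForms n) (λ {t} → h₁ t))
  (cong₂ (λ x y → + 2 * x + y) (∑-empty (oddTriples n) (λ {t} → h₂ t)) (∑-empty (oddPairs n) (λ {t} → h₃ t)))

-- These are the terms of `odd-recurrence` with even `k`. Modulo 4, `o * o` is 0 or 1, and
-- `l(2J - l)` is a multiple of 4 or odd, so a number that is 2 modulo 4 has no solutions of any of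
-- the three kinds.
excess₁-two : ∀ r → excess₁ (+ 2 * (1ℤ + + 2 * r)) ≡ 0ℤ
excess₁-two r = excess₁-empty (λ (o , w , z) → forms o (w * w + z * z)) (λ (l , J , h) (_ , _ , _ , e) → triple l J (h * J) e)
  (λ (l , J) (_ , _ , e) → triple l J 0ℤ (trans (ℤₚ.+-identityʳ _) e))
  where
  forms : ∀ o s → ¬ (o * o + + 4 * s ≡ + 2 * (1ℤ + + 2 * r))
  forms o s h with parity o
  ... | a , inj₁ refl = odd≢even {a * a + s} {r} (cancel-double (trans (eq a s) h))
    where
    eq : ∀ a s → + 2 * (+ 2 * (a * a + s)) ≡ + 2 * a * (+ 2 * a) + + 4 * s
    eq = solve-∀
  ... | a , inj₂ refl = odd≢even {1ℤ + + 2 * r} {+ 2 * (a * a + a + s)} (trans (sym h) (eq a s))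
    where
    eq : ∀ a s → (1ℤ + + 2 * a) * (1ℤ + + 2 * a) + + 4 * s ≡ 1ℤ + + 2 * (+ 2 * (a * a + a + s))
    eq = solve-∀
  triple : ∀ l J s → ¬ (l * (+ 2 * J - l) + + 4 * s ≡ + 2 * (1ℤ + + 2 * r))
  triple l J s h with parity l
  ... | a , inj₁ refl = odd≢even {a * J - a * a + s} {r} (cancel-double (trans (eq a J s) h))
    where
    eq : ∀ a J s → + 2 * (+ 2 * (a * J - a * a + s)) ≡ + 2 * a * (+ 2 * J - + 2 * a) + + 4 * s
    eq = solve-∀
  ... | a , inj₂ refl = odd≢even {1ℤ + + 2 * r} {J - 1ℤ + + 2 * (a * J - a * a - a) + + 2 * s} (trans (sym h) (eq a J s))
    where
    eq : ∀ a J s → (1ℤ + + 2 * a) * (+ 2 * J - (1ℤ + + 2 * a)) + + 4 * s ≡ 1ℤ + + 2 * (J - 1ℤ + + 2 * (a * J - a * a - a) + + 2 * s)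
    eq = solve-∀

-- In `odd-recurrence` the even `k` contribute nothing, `k = 1` and `k = -1` both give the argument
-- `1 + 4q`, and larger odd `k` give smaller arguments that are again 1 modulo 4. So the recurrence
-- reduces to twice the claim.
excess₁-one : ∀ q → excess₁ (1ℤ + + 4 * q) ≡ 0ℤ
excess₁-one = ℤ-rec (λ q → excess₁ (1ℤ + + 4 * q) ≡ 0ℤ) (λ {q} → negative q) step
  where
  negative : ∀ q → q < 0ℤ → excess₁ (1ℤ + + 4 * q) ≡ 0ℤ
  negative q q<0 = excess₁-empty
    (λ (o , w , z) h → contra h (nonneg-+ (nonneg-sq o) (nonneg-* {+ 4} (+≤+ ℕ.z≤n) (nonneg-+ (nonneg-sq w) (nonneg-sq z)))))
    (λ (l , J , h) (pl , pm , ph , e) → contra e (nonneg-+ (pos⇒nonneg (pos-* pl pm)) (nonneg-* {+ 4} (+≤+ ℕ.z≤n) (pos⇒nonneg (pos-* ph (mean-pos {l} {J} pl pm))))))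
    (λ (l , J) (pl , pm , e) → contra e (pos⇒nonneg (pos-* pl pm)))
    where
    n = 1ℤ + + 4 * q
    below : ∀ m → m < 0ℤ → 1ℤ + + 4 * m < 0ℤ
    below -[1+ zero ] -<+ = -<+
    below -[1+ suc k ] -<+ = -<+
    contra : ∀ {x} → x ≡ n → 0ℤ ≤ x → ⊥
    contra refl h = ℤₚ.<⇒≱ (below q q<0) h
  step : ∀ q → 0ℤ ≤ q → (∀ k → k < q → excess₁ (1ℤ + + 4 * k) ≡ 0ℤ) → excess₁ (1ℤ + + 4 * q) ≡ 0ℤ
  step q q≥0 ih = cancel-double {y = 0ℤ} (trans (sym total) (odd-recurrence q))
    where
    N₂ = + 2 * (1ℤ + + 2 * q)
    n = 1ℤ + + 4 * q
    W : ℤ → ℤ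
    W k = excess₁ (N₂ - k * k)
    eq₁ : ∀ q a → + 2 * (1ℤ + + 2 * q) - + 2 * a * (+ 2 * a) ≡ + 2 * (1ℤ + + 2 * (q - a * a))
    eq₁ = solve-∀
    eq₂ : ∀ q a → + 2 * (1ℤ + + 2 * q) - (1ℤ + + 2 * a) * (1ℤ + + 2 * a) ≡ 1ℤ + + 4 * (q - (a * a + a))
    eq₂ = solve-∀
    eq₃ : ∀ q → + 2 * (1ℤ + + 2 * q) - 1ℤ ≡ 1ℤ + + 4 * q
    eq₃ = solve-∀
    positive-odd : ∀ a → Pos (1ℤ + + 2 * a) → 1ℤ + + 2 * a ≢ 1ℤ → Pos (a * a + a)
    positive-odd (+ zero)   _ ne = ⊥-elim (ne refl)
    positive-odd (+ suc a)  _ ne = +<+ (ℕ.s≤s ℕ.z≤n)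
    positive-odd -[1+ zero ] () ne
    positive-odd -[1+ suc a ] () ne
    W-even : ∀ a → W (+ 2 * a) ≡ 0ℤ
    W-even a = trans (cong excess₁ (eq₁ q a)) (excess₁-two (q - a * a))
    Bx = box ∣ N₂ ∣
    N₂-bound : ∀ q → 0ℤ ≤ q → 1 ℕ.≤ ∣ + 2 * (1ℤ + + 2 * q) ∣
    N₂-bound (+ q) _ = subst (λ x → 1 ℕ.≤ ∣ + 2 * (1ℤ + x) ∣) (ℤₚ.pos-* 2 q) (ℕ.s≤s ℕ.z≤n)
    pos : ∑ (posPart Bx (λ k → k)) W ≡ excess₁ n
    pos = trans (∑-single (posPart Bx (λ k → k)) 1ℤ (N₂-bound q q≥0 , +<+ (ℕ.s≤s ℕ.z≤n)) others) (cong excess₁ (eq₃ q))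
      where
      others : ∀ {k} → Box ∣ N₂ ∣ k × Pos k → k ≢ 1ℤ → W k ≡ 0ℤ
      others {k} (_ , p) ne with parity k
      ... | a , inj₁ refl = W-even a
      ... | a , inj₂ refl = trans (cong excess₁ (eq₂ q a)) (ih (q - (a * a + a)) (sub-pos< q (positive-odd a p ne)))
    neg≅ : (λ k → Box ∣ N₂ ∣ k × Pos (- k)) ≅ (λ k → Box ∣ N₂ ∣ k × Pos k)
    neg≅ = record
      { to = -_ ; from = -_
      ; to-∈ = λ {k} (b , p) → subst (ℕ._≤ ∣ N₂ ∣) (sym (ℤₚ.∣-i∣≡∣i∣ k)) b , p
      ; from-∈ = λ {k} (b , p) → subst (ℕ._≤ ∣ N₂ ∣) (sym (ℤₚ.∣-i∣≡∣i∣ k)) b , pos≡ p (sym (ℤₚ.neg-involutive k))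
      ; from-to = λ {k} _ → ℤₚ.neg-involutive k ; to-from = λ {k} _ → ℤₚ.neg-involutive k }
    total : ∑ Bx W ≡ + 2 * excess₁ n
    total = trans (∑-sign Bx (λ k → k) W) (trans (cong₂ _+_ pos (cong₂ _+_
      (trans (∑-bij neg≅ (negPart Bx (λ k → k)) (posPart Bx (λ k → k)) {w = W} {v = W} (λ {k} _ → cong (λ x → excess₁ (N₂ - x)) (sym (neg-sq k)))) pos)
      (∑-zero (zeroPart Bx (λ k → k)) {w = W} (λ { (_ , refl) → W-even 0ℤ })))) (x+[x+0]≡2x (excess₁ n)))

private
  positive-count : ∀ {x k c} → x - k * c ≡ 0ℤ → Pos k → Pos c → Pos x
  positive-count {x} {k} {c} e pk pc = pos≡ (pos-* pk pc) (sym (ℤₚ.i-j≡0⇒i≡j x (k * c) e))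

  pos-nonneg : ∀ {x y} → 0ℤ ≤ x → Pos y → Pos (x + y)
  pos-nonneg = ℤₚ.+-mono-≤-<

  count≥0 : {A : Set} {P : A → Set} (E : Enum P) → 0ℤ ≤ count E
  count≥0 E = ∑-nonneg E (λ _ → +≤+ ℕ.z≤n)

odd-represented-proof : ∀ m → 0ℤ ≤ m → ∃ λ x → ∃ λ y → ∃ λ z → x * x + y * y + + 2 * (z * z) ≡ 1ℤ + + 2 * m
odd-represented-proof m m≥0 = extract (count>0⇒∃ (evenForms n) (positive-count {count (evenForms n)} {+ 4} {c₂ n} (count-evenForms m) (+<+ (ℕ.s≤s ℕ.z≤n)) c₂>0))
  where
  n = 1ℤ + + 2 * m
  extract : ∃ (EvenForm n) → ∃ λ x → ∃ λ y → ∃ λ z → x * x + y * y + + 2 * (z * z) ≡ n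
  extract ((z , x , y) , h) = x , y , z , unmove {x * x + y * y} {+ 2 * (z * z)} {n} h
  n>0 : Pos n
  n>0 = ℤₚ.+-mono-<-≤ {0ℤ} {1ℤ} {0ℤ} (+<+ (ℕ.s≤s ℕ.z≤n)) (nonneg-double m≥0)
  trivial : Factor n (1ℤ , n)
  trivial = +<+ (ℕ.s≤s ℕ.z≤n) , n>0 , ℤₚ.*-identityˡ n
  c₂>0 : Pos (c₂ n)
  c₂>0 = pos-nonneg {count (triples n)} {count (factors n)} (count≥0 (triples n)) (count>0 (factors n) {1ℤ , n} trivial)

abstract

  odd-represented : ∀ m → 0ℤ ≤ m → ∃ λ x → ∃ λ y → ∃ λ z → x * x + y * y + + 2 * (z * z) ≡ 1ℤ + + 2 * m
  odd-represented = odd-represented-proof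

one-mod-four-represented-proof : ∀ q → 0ℤ ≤ q → ∃ λ o → ∃ λ w → ∃ λ z → o * o + + 4 * (w * w + z * z) ≡ 1ℤ + + 4 * q
one-mod-four-represented-proof q q≥0 = extract (count>0⇒∃ (oddForms n) (positive-count {count (oddForms n)} {+ 2} {c₁ n} (excess₁-one q) (+<+ (ℕ.s≤s ℕ.z≤n)) c₁>0))
  where
  n = 1ℤ + + 4 * q
  extract : ∃ (OddForm n) → ∃ λ o → ∃ λ w → ∃ λ z → o * o + + 4 * (w * w + z * z) ≡ n
  extract ((o , w , z) , h) = o , w , z , h
  eq₁ : ∀ q → 1ℤ + + 4 * q ≡ + 2 * (1ℤ + + 2 * q) - 1ℤ
  eq₁ = solve-∀
  eq₂ : ∀ q → 1ℤ * (+ 2 * (1ℤ + + 2 * q) - 1ℤ) ≡ 1ℤ + + 4 * q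
  eq₂ = solve-∀
  n>0 : Pos n
  n>0 = ℤₚ.+-mono-<-≤ {0ℤ} {1ℤ} {0ℤ} (+<+ (ℕ.s≤s ℕ.z≤n)) (nonneg-* {+ 4} (+≤+ ℕ.z≤n) q≥0)
  trivial : OddPair n (1ℤ , 1ℤ + + 2 * q)
  trivial = +<+ (ℕ.s≤s ℕ.z≤n) , pos≡ n>0 (eq₁ q) , eq₂ q
  c₁>0 : Pos (c₁ n)
  c₁>0 = pos-nonneg {+ 2 * count (oddTriples n)} {count (oddPairs n)} (nonneg-double (count≥0 (oddTriples n))) (count>0 (oddPairs n) {1ℤ , 1ℤ + + 2 * q} trivial)

abstract

  one-mod-four-represented : ∀ q → 0ℤ ≤ q → ∃ λ o → ∃ λ w → ∃ λ z → o * o + + 4 * (w * w + z * z) ≡ 1ℤ + + 4 * q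
  one-mod-four-represented = one-mod-four-represented-proof

-- Arithmetic modulo 3

-- The class of 2 is written as minus the class of 1, because signs are free wherever only squares
-- matter.
mod3 : ∀ x → ∃ λ y → x ≡ + 3 * y ⊎ x ≡ 1ℤ + + 3 * y ⊎ x ≡ - (1ℤ + + 3 * y)
mod3 (+ n) = natural n
  where
  eq₁ : ∀ y → 1ℤ + (1ℤ + + 3 * y) ≡ - (1ℤ + + 3 * (- 1ℤ - y))
  eq₁ = solve-∀
  eq₂ : ∀ y → 1ℤ + - (1ℤ + + 3 * y) ≡ + 3 * - y
  eq₂ = solve-∀
  natural : ∀ n → ∃ λ y → + n ≡ + 3 * y ⊎ + n ≡ 1ℤ + + 3 * y ⊎ + n ≡ - (1ℤ + + 3 * y)
  natural zero = 0ℤ , inj₁ refl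
  natural (suc n) with natural n
  ... | y , inj₁ e        = y , inj₂ (inj₁ (cong (λ x → 1ℤ + x) e))
  ... | y , inj₂ (inj₁ e) = - 1ℤ - y , inj₂ (inj₂ (trans (cong (λ x → 1ℤ + x) e) (eq₁ y)))
  ... | y , inj₂ (inj₂ e) = - y , inj₁ (trans (cong (λ x → 1ℤ + x) e) (eq₂ y))
mod3 -[1+ n ] with mod3 (+ suc n)
... | y , inj₁ e        = - y , inj₁ (trans (cong -_ e) (ℤₚ.neg-distribʳ-* (+ 3) y))
... | y , inj₂ (inj₁ e) = y , inj₂ (inj₂ (cong -_ e))
... | y , inj₂ (inj₂ e) = y , inj₂ (inj₁ (trans (cong -_ e) (ℤₚ.neg-involutive _)))

cancel-factor : ∀ k {x y} → + suc k * x ≡ + suc k * y → x ≡ y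
cancel-factor k {x} {y} = ℤₚ.*-cancelˡ-≡ (+ suc k) x y

private
  no-third : ∀ y → + 3 * y ≢ 1ℤ
  no-third (+ zero) ()
  no-third (+ suc n) h = contra n (ℤₚ.+-injective h)
    where
    contra : ∀ n → 3 ℕ.* suc n ≢ 1
    contra n h with trans (sym (ℕₚ.+-suc n _)) (ℕₚ.suc-injective h)
    ... | ()
  no-third -[1+ n ] ()

3x≢1+3y : ∀ x y → + 3 * x ≢ 1ℤ + + 3 * y
3x≢1+3y x y e = no-third (x - y) (trans (eq₁ x y) (trans (cong (_- + 3 * y) e) (eq₂ y)))
  where
  eq₁ : ∀ x y → + 3 * (x - y) ≡ + 3 * x - + 3 * y
  eq₁ = solve-∀
  eq₂ : ∀ y → 1ℤ + + 3 * y - + 3 * y ≡ 1ℤ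
  eq₂ = solve-∀

3x≢2+3y : ∀ x y → + 3 * x ≢ + 2 + + 3 * y
3x≢2+3y x y e = 3x≢1+3y (1ℤ + y) x (trans (eq₁ y) (trans (cong (λ z → 1ℤ + z) (sym e)) refl))
  where
  eq₁ : ∀ y → + 3 * (1ℤ + y) ≡ 1ℤ + (+ 2 + + 3 * y)
  eq₁ = solve-∀

Div3 : ℤ → Set
Div3 x = ∃ λ y → x ≡ + 3 * y

unit-square : ∀ {x} → ¬ Div3 x → ∃ λ k → x * x ≡ 1ℤ + + 3 * k
unit-square {x} ne with mod3 x
... | y , inj₁ e            = ⊥-elim (ne (y , e))
... | y , inj₂ (inj₁ refl)  = + 2 * y + + 3 * (y * y) , eq y
  where
  eq : ∀ y → (1ℤ + + 3 * y) * (1ℤ + + 3 * y) ≡ 1ℤ + + 3 * (+ 2 * y + + 3 * (y * y))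
  eq = solve-∀
... | y , inj₂ (inj₂ refl)  = + 2 * y + + 3 * (y * y) , eq y
  where
  eq : ∀ y → - (1ℤ + + 3 * y) * - (1ℤ + + 3 * y) ≡ 1ℤ + + 3 * (+ 2 * y + + 3 * (y * y))
  eq = solve-∀

div3? : ∀ x → Dec (Div3 x)
div3? x with mod3 x
... | y , inj₁ e = yes (y , e)
... | y , inj₂ (inj₁ e) = no (λ (z , e′) → 3x≢1+3y z y (trans (sym e′) e))
... | y , inj₂ (inj₂ e) = no (λ (z , e′) → 3x≢1+3y (- z) y (trans (eq z) (trans (cong -_ (trans (sym e′) e)) (ℤₚ.neg-involutive _))))
  where
  eq : ∀ z → + 3 * - z ≡ - (+ 3 * z)
  eq = solve-∀

SquareMod3 : ℤ → Set
SquareMod3 x = (Div3 x × ∃ λ k → x * x ≡ + 3 * k) ⊎ (¬ Div3 x × ∃ λ k → x * x ≡ 1ℤ + + 3 * k)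

square-mod3 : ∀ x → SquareMod3 x
square-mod3 x with div3? x
... | yes (y , refl) = inj₁ ((y , refl) , + 3 * (y * y) , [3x]²≡3[3x²] y)
... | no ne = inj₂ (ne , unit-square ne)

div3-+ : ∀ {x y} → Div3 x → Div3 y → Div3 (x + y)
div3-+ (a , refl) (b , refl) = a + b , sym (ℤₚ.*-distribˡ-+ (+ 3) a b)

div3-neg : ∀ {x} → Div3 x → Div3 (- x)
div3-neg (a , refl) = - a , ℤₚ.neg-distribʳ-* (+ 3) a

div3-double : ∀ {x} → Div3 (+ 2 * x) → Div3 x
div3-double {x} (a , e) = x - a , trans (eq₁ x) (trans (cong (λ z → + 3 * x - z) e) (eq₂ x a))
  where
  eq₁ : ∀ x → x ≡ + 3 * x - + 2 * x
  eq₁ = solve-∀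
  eq₂ : ∀ x a → + 3 * x - + 3 * a ≡ + 3 * (x - a)
  eq₂ = solve-∀

div3-≡ : ∀ {x y} → Div3 x → x ≡ y → Div3 y
div3-≡ (a , e) refl = a , e

Odd Even : ℤ → Set
Odd x = ∃ λ t → x ≡ 1ℤ + + 2 * t
Even x = ∃ λ t → x ≡ + 2 * t

odd-shift : ∀ {x} d → Odd x → Odd (x + + 2 * d)
odd-shift d (t , refl) = t + d , eq t d
  where
  eq : ∀ t d → 1ℤ + + 2 * t + + 2 * d ≡ 1ℤ + + 2 * (t + d)
  eq = solve-∀

even-shift : ∀ {x} d → Even x → Even (x + + 2 * d)
even-shift d (t , refl) = t + d , sym (ℤₚ.*-distribˡ-+ (+ 2) t d)

sumSq : ℤ → ℤ → ℤ → ℤ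
sumSq a b c = a * a + b * b + c * c

-- If 3 divides (a, b, c), replace (a, b, c)/3 by a triple not divisible by 3 and apply 3 times the half-turn about (1, 1, 1).

Improved : ℤ → ℤ → ℤ → ℤ → Set
Improved n a b c = ∃ λ d → ∃ λ e → ∃ λ f →
  sumSq (a + + 2 * d) (b + + 2 * e) (c + + 2 * f) ≡ n × ¬ (Div3 (a + + 2 * d) × Div3 (b + + 2 * e) × Div3 (c + + 2 * f))

private
  -- The new first entry is `2(b + c) - a`. Modulo 3 it is `2(a + b + c)`, hence nonzero, and it
  -- differs from `3a` by an even number. Parities must survive, since in the end the residues
  -- modulo 6 are prescribed.
  reflect : ∀ n a b c → sumSq a b c ≡ n → ¬ Div3 (a + b + c) → Improved (+ 9 * n) (+ 3 * a) (+ 3 * b) (+ 3 * c)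
  reflect n a b c e ne = b + c - + 2 * a , a + c - + 2 * b , a + b - + 2 * c , trans (eq₁ a b c) (cong (λ x → + 9 * x) e) ,
    λ (h , _) → ne (div3-double (div3-≡ (div3-+ h (a , refl)) (eq₂ a b c)))
    where
    entry : ∀ a b c → + 3 * a + + 2 * (b + c - + 2 * a) ≡ + 2 * (b + c) - a
    entry = solve-∀
    expand : ∀ a b c → (+ 2 * (b + c) - a) * (+ 2 * (b + c) - a) + (+ 2 * (a + c) - b) * (+ 2 * (a + c) - b) + (+ 2 * (a + b) - c) * (+ 2 * (a + b) - c) ≡ + 9 * (a * a + b * b + c * c)
    expand = solve-∀
    eq₁ : ∀ a b c → sumSq (+ 3 * a + + 2 * (b + c - + 2 * a)) (+ 3 * b + + 2 * (a + c - + 2 * b)) (+ 3 * c + + 2 * (a + b - + 2 * c)) ≡ + 9 * sumSq a b c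
    eq₁ a b c = trans (cong₂ (λ (x , y) z → sumSq x y z) (cong₂ _,_ (entry a b c) (entry b a c)) (entry c a b)) (expand a b c)
    eq₂ : ∀ a b c → + 3 * a + + 2 * (b + c - + 2 * a) + + 3 * a ≡ + 2 * (a + b + c)
    eq₂ = solve-∀

  same-parity : ∀ n a b c a′ b′ c′ → Improved n (a + + 2 * a′) (b + + 2 * b′) (c + + 2 * c′) → Improved n a b c
  same-parity n a b c a′ b′ c′ (d , e , f , h , ne) = a′ + d , b′ + e , c′ + f ,
    subst (λ (x , y , z) → sumSq x y z ≡ n) (tuple a d a′ b e b′ c f c′) h ,
    subst (λ (x , y , z) → ¬ (Div3 x × Div3 y × Div3 z)) (tuple a d a′ b e b′ c f c′) ne
    where
    eq : ∀ a d a′ → a + + 2 * a′ + + 2 * d ≡ a + + 2 * (a′ + d)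
    eq = solve-∀
    tuple : ∀ a d a′ b e b′ c f c′ → (a + + 2 * a′ + + 2 * d , b + + 2 * b′ + + 2 * e , c + + 2 * c′ + + 2 * f) ≡ (a + + 2 * (a′ + d) , b + + 2 * (b′ + e) , c + + 2 * (c′ + f))
    tuple a d a′ b e b′ c f c′ = cong₂ _,_ (eq a d a′) (cong₂ _,_ (eq b e b′) (eq c f c′))

  -- Flipping the sign of a coordinate not divisible by 3 changes a + b + c modulo 3.
  reflect-signed : ∀ n a b c → sumSq a b c ≡ n → ¬ (Div3 a × Div3 b × Div3 c) → Improved (+ 9 * n) (+ 3 * a) (+ 3 * b) (+ 3 * c)
  reflect-signed n a b c e ne with div3? (a + b + c)
  ... | no h = reflect n a b c e h
  ... | yes h with div3? a
  ...   | no na = same-parity (+ 9 * n) (+ 3 * a) (+ 3 * b) (+ 3 * c) (- + 3 * a) 0ℤ 0ℤ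
    (subst (λ (x , y , z) → Improved (+ 9 * n) x y z) (cong₂ _,_ (eq₁ a) (cong₂ _,_ (x≡x+2*0 (+ 3 * b)) (x≡x+2*0 (+ 3 * c))))
      (reflect n (- a) b c (trans (neg a b c) e) (λ h′ → na (div3-double (div3-≡ (div3-+ h (div3-neg h′)) (eq₂ a b c))))))
    where
    eq₁ : ∀ a → + 3 * - a ≡ + 3 * a + + 2 * (- + 3 * a)
    eq₁ = solve-∀
    eq₂ : ∀ a b c → a + b + c + - (- a + b + c) ≡ + 2 * a
    eq₂ = solve-∀
    neg : ∀ a b c → - a * - a + b * b + c * c ≡ a * a + b * b + c * c
    neg = solve-∀
  ...   | yes da with div3? b
  ...     | no nb = same-parity (+ 9 * n) (+ 3 * a) (+ 3 * b) (+ 3 * c) 0ℤ (- + 3 * b) 0ℤ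
    (subst (λ (x , y , z) → Improved (+ 9 * n) x y z) (cong₂ _,_ (x≡x+2*0 (+ 3 * a)) (cong₂ _,_ (eq₁ b) (x≡x+2*0 (+ 3 * c))))
      (reflect n a (- b) c (trans (neg a b c) e) (λ h′ → nb (div3-double (div3-≡ (div3-+ h (div3-neg h′)) (eq₂ a b c))))))
    where
    eq₁ : ∀ a → + 3 * - a ≡ + 3 * a + + 2 * (- + 3 * a)
    eq₁ = solve-∀
    eq₂ : ∀ a b c → a + b + c + - (a + - b + c) ≡ + 2 * b
    eq₂ = solve-∀
    neg : ∀ a b c → a * a + - b * - b + c * c ≡ a * a + b * b + c * c
    neg = solve-∀
  ...     | yes db = ⊥-elim (ne (da , db , div3-≡ (div3-+ h (div3-neg (div3-+ da db))) (eq a b c)))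
    where
    eq : ∀ a b c → a + b + c + - (a + b) ≡ c
    eq = solve-∀

  ninth< : ∀ n → 0ℤ ≤ n → + 9 * n ≢ 0ℤ → n < + 9 * n
  ninth< n h ne = subst (_< + 9 * n) (eq n) (sub-pos< (+ 9 * n) {+ 8 * n} (pos-* {+ 8} (+<+ (ℕ.s≤s ℕ.z≤n)) (ℤₚ.≤∧≢⇒< h (λ e → ne (cong (λ x → + 9 * x) (sym e))))))
    where
    eq : ∀ n → + 9 * n - + 8 * n ≡ n
    eq = solve-∀

improve-proof : ∀ n → n ≢ 0ℤ → ∀ a b c → sumSq a b c ≡ n → Improved n a b c
improve-proof = ℤ-rec (λ n → n ≢ 0ℤ → ∀ a b c → sumSq a b c ≡ n → Improved n a b c)
  (λ n<0 _ a b c e → ⊥-elim (ℤₚ.<⇒≱ n<0 (subst (0ℤ ≤_) e (nonneg a b c)))) step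
  where
  nonneg : ∀ a b c → 0ℤ ≤ sumSq a b c
  nonneg a b c = nonneg-+ (nonneg-+ (nonneg-sq a) (nonneg-sq b)) (nonneg-sq c)
  trivially : ∀ n a b c → sumSq a b c ≡ n → ¬ (Div3 a × Div3 b × Div3 c) → Improved n a b c
  trivially n a b c e ne = 0ℤ , 0ℤ , 0ℤ , subst (λ (x , y , z) → sumSq x y z ≡ n) t e , subst (λ (x , y , z) → ¬ (Div3 x × Div3 y × Div3 z)) t ne
    where t = cong₂ _,_ (x≡x+2*0 a) (cong₂ _,_ (x≡x+2*0 b) (x≡x+2*0 c))
  eq₉ : ∀ a b c → + 3 * a * (+ 3 * a) + + 3 * b * (+ 3 * b) + + 3 * c * (+ 3 * c) ≡ + 9 * (a * a + b * b + c * c)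
  eq₉ = solve-∀
  eq₃ : ∀ a d → + 3 * (a + + 2 * d) ≡ + 3 * a + + 2 * (+ 3 * d)
  eq₃ = solve-∀
  step : ∀ n → 0ℤ ≤ n → (∀ k → k < n → k ≢ 0ℤ → ∀ a b c → sumSq a b c ≡ k → Improved k a b c) → n ≢ 0ℤ → ∀ a b c → sumSq a b c ≡ n → Improved n a b c
  step n _ ih ne a b c e with div3? a | div3? b | div3? c
  ... | no h | _ | _ = trivially n a b c e (λ (x , _) → h x)
  ... | yes _ | no h | _ = trivially n a b c e (λ (_ , x , _) → h x)
  ... | yes _ | yes _ | no h = trivially n a b c e (λ (_ , _ , x) → h x)
  step n _ ih ne a b c e | yes (α , refl) | yes (β , refl) | yes (γ , refl) =
    subst (λ x → Improved x (+ 3 * α) (+ 3 * β) (+ 3 * γ)) n≡ (lift (ih n′ n′<n (λ z → ne (trans (sym n≡) (cong (λ x → + 9 * x) z))) α β γ refl))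
    where
    n′ = sumSq α β γ
    n≡ : + 9 * n′ ≡ n
    n≡ = trans (sym (eq₉ α β γ)) e
    n′<n : n′ < n
    n′<n = subst (n′ <_) n≡ (ninth< n′ (nonneg α β γ) (λ z → ne (trans (sym n≡) z)))
    lift : Improved n′ α β γ → Improved (+ 9 * n′) (+ 3 * α) (+ 3 * β) (+ 3 * γ)
    lift (d , e , f , h , ne′) = same-parity (+ 9 * n′) (+ 3 * α) (+ 3 * β) (+ 3 * γ) (+ 3 * d) (+ 3 * e) (+ 3 * f)
      (subst (λ (x , y , z) → Improved (+ 9 * n′) x y z) (cong₂ _,_ (eq₃ α d) (cong₂ _,_ (eq₃ β e) (eq₃ γ f)))
        (reflect-signed n′ (α + + 2 * d) (β + + 2 * e) (γ + + 2 * f) h ne′))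

abstract

  improve : ∀ n → n ≢ 0ℤ → ∀ a b c → sumSq a b c ≡ n → Improved n a b c
  improve = improve-proof

-- For x² + 2y² the factor 3 is traded for (1 ± √-2)², which has the same norm 9.

Improved₂ : ℤ → ℤ → ℤ → Set
Improved₂ n a b = ∃ λ d → ∃ λ e →
  (a + + 2 * d) * (a + + 2 * d) + + 2 * ((b + + 2 * e) * (b + + 2 * e)) ≡ n × ¬ (Div3 (a + + 2 * d) × Div3 (b + + 2 * e))

improve₂-proof : ∀ n → n ≢ 0ℤ → ∀ a b → a * a + + 2 * (b * b) ≡ n → Improved₂ n a b
improve₂-proof = ℤ-rec (λ n → n ≢ 0ℤ → ∀ a b → a * a + + 2 * (b * b) ≡ n → Improved₂ n a b)
  (λ n<0 _ a b e → ⊥-elim (ℤₚ.<⇒≱ n<0 (subst (0ℤ ≤_) e (nonneg a b)))) step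
  where
  nonneg : ∀ a b → 0ℤ ≤ a * a + + 2 * (b * b)
  nonneg a b = nonneg-+ (nonneg-sq a) (nonneg-double (nonneg-sq b))
  trivially : ∀ n a b → a * a + + 2 * (b * b) ≡ n → ¬ (Div3 a × Div3 b) → Improved₂ n a b
  trivially n a b e ne = 0ℤ , 0ℤ , subst (λ (x , y) → x * x + + 2 * (y * y) ≡ n) t e , subst (λ (x , y) → ¬ (Div3 x × Div3 y)) t ne
    where t = cong₂ _,_ (x≡x+2*0 a) (x≡x+2*0 b)
  eq₉ : ∀ a b → + 3 * a * (+ 3 * a) + + 2 * (+ 3 * b * (+ 3 * b)) ≡ + 9 * (a * a + + 2 * (b * b))
  eq₉ = solve-∀
  step : ∀ n → 0ℤ ≤ n → (∀ k → k < n → k ≢ 0ℤ → ∀ a b → a * a + + 2 * (b * b) ≡ k → Improved₂ k a b) → n ≢ 0ℤ → ∀ a b → a * a + + 2 * (b * b) ≡ n → Improved₂ n a b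
  step n _ ih ne a b e with div3? a | div3? b
  ... | no h | _ = trivially n a b e (λ (x , _) → h x)
  ... | yes _ | no h = trivially n a b e (λ (_ , x) → h x)
  step n _ ih ne a b e | yes (α , refl) | yes (β , refl) =
    subst (λ x → Improved₂ x (+ 3 * α) (+ 3 * β)) n≡ (lift (ih n′ n′<n (λ z → ne (trans (sym n≡) (cong (λ x → + 9 * x) z))) α β refl))
    where
    n′ = α * α + + 2 * (β * β)
    n≡ : + 9 * n′ ≡ n
    n≡ = trans (sym (eq₉ α β)) e
    n′<n : n′ < n
    n′<n = subst (n′ <_) n≡ (ninth< n′ (nonneg α β) (λ z → ne (trans (sym n≡) z)))
    lift : Improved₂ n′ α β → Improved₂ (+ 9 * n′) (+ 3 * α) (+ 3 * β)
    lift (d , e , h , ne′) with div3? (α + + 2 * d + (β + + 2 * e))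
    -- With `A = α + 2d` and `B = β + 2e`, multiplying `A + B√-2` by `(1 + √-2)² = -1 + 2√-2` gives
    -- the entries `-A - 4B` and `2A - B`. The first is `-(A + B)` modulo 3.
    ... | no ns = - + 2 * α - d - + 2 * β - + 4 * e , - + 2 * β - e + α + + 2 * d ,
        trans (eq₁ α β d e) (cong (λ x → + 9 * x) h) , λ (x , _) → ns (div3-≡ (div3-+ (div3-neg x) (- (β + + 2 * e) , refl)) (eq₂ α β d e))
      where
      entry₁ : ∀ α β d e → + 3 * α + + 2 * (- + 2 * α - d - + 2 * β - + 4 * e) ≡ - (α + + 2 * d) - + 4 * (β + + 2 * e)
      entry₁ = solve-∀
      entry₂ : ∀ α β d e → + 3 * β + + 2 * (- + 2 * β - e + α + + 2 * d) ≡ + 2 * (α + + 2 * d) - (β + + 2 * e)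
      entry₂ = solve-∀
      expand : ∀ A B → (- A - + 4 * B) * (- A - + 4 * B) + + 2 * ((+ 2 * A - B) * (+ 2 * A - B)) ≡ + 9 * (A * A + + 2 * (B * B))
      expand = solve-∀
      eq₁ : ∀ α β d e → (+ 3 * α + + 2 * (- + 2 * α - d - + 2 * β - + 4 * e)) * (+ 3 * α + + 2 * (- + 2 * α - d - + 2 * β - + 4 * e)) + + 2 * ((+ 3 * β + + 2 * (- + 2 * β - e + α + + 2 * d)) * (+ 3 * β + + 2 * (- + 2 * β - e + α + + 2 * d)))
            ≡ + 9 * ((α + + 2 * d) * (α + + 2 * d) + + 2 * ((β + + 2 * e) * (β + + 2 * e)))
      eq₁ α β d e = trans (cong₂ (λ x y → x * x + + 2 * (y * y)) (entry₁ α β d e) (entry₂ α β d e)) (expand (α + + 2 * d) (β + + 2 * e))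
      eq₂ : ∀ α β d e → - (+ 3 * α + + 2 * (- + 2 * α - d - + 2 * β - + 4 * e)) + + 3 * - (β + + 2 * e) ≡ α + + 2 * d + (β + + 2 * e)
      eq₂ = solve-∀
    -- The conjugate factor gives the first entry `4B - A`, which is `B - A` modulo 3. If 3 divided
    -- both `A + B` and `A - B`, it would divide `A` and `B`.
    ... | yes ds = - + 2 * α - d + + 2 * β + + 4 * e , - + 2 * β - e - α - + 2 * d ,
        trans (eq₁ α β d e) (cong (λ x → + 9 * x) h) , λ (x , _) →
          let diff = div3-≡ (div3-+ (div3-neg x) (β + + 2 * e , refl)) (eq₂ α β d e) in
          ne′ (div3-double (div3-≡ (div3-+ ds diff) ([x+y]+[x-y]≡2x (α + + 2 * d) (β + + 2 * e))) , div3-double (div3-≡ (div3-+ ds (div3-neg diff)) ([x+y]+-[x-y]≡2y (α + + 2 * d) (β + + 2 * e))))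
      where
      entry₁ : ∀ α β d e → + 3 * α + + 2 * (- + 2 * α - d + + 2 * β + + 4 * e) ≡ + 4 * (β + + 2 * e) - (α + + 2 * d)
      entry₁ = solve-∀
      entry₂ : ∀ α β d e → + 3 * β + + 2 * (- + 2 * β - e - α - + 2 * d) ≡ - + 2 * (α + + 2 * d) - (β + + 2 * e)
      entry₂ = solve-∀
      expand : ∀ A B → (+ 4 * B - A) * (+ 4 * B - A) + + 2 * ((- + 2 * A - B) * (- + 2 * A - B)) ≡ + 9 * (A * A + + 2 * (B * B))
      expand = solve-∀
      eq₁ : ∀ α β d e → (+ 3 * α + + 2 * (- + 2 * α - d + + 2 * β + + 4 * e)) * (+ 3 * α + + 2 * (- + 2 * α - d + + 2 * β + + 4 * e)) + + 2 * ((+ 3 * β + + 2 * (- + 2 * β - e - α - + 2 * d)) * (+ 3 * β + + 2 * (- + 2 * β - e - α - + 2 * d)))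
            ≡ + 9 * ((α + + 2 * d) * (α + + 2 * d) + + 2 * ((β + + 2 * e) * (β + + 2 * e)))
      eq₁ α β d e = trans (cong₂ (λ x y → x * x + + 2 * (y * y)) (entry₁ α β d e) (entry₂ α β d e)) (expand (α + + 2 * d) (β + + 2 * e))
      eq₂ : ∀ α β d e → - (+ 3 * α + + 2 * (- + 2 * α - d + + 2 * β + + 4 * e)) + + 3 * (β + + 2 * e) ≡ α + + 2 * d - (β + + 2 * e)
      eq₂ = solve-∀

abstract

  improve₂ : ∀ n → n ≢ 0ℤ → ∀ a b → a * a + + 2 * (b * b) ≡ n → Improved₂ n a b
  improve₂ = improve₂-proof

-- Squares of integers in prescribed residue classes

-- A number prime to 6 is 1 or -1 modulo 6. The sign disappears in the square, so the conclusion is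
-- stated for squares; the lemmas on the other classes follow the same pattern.
odd-unit : ∀ {x} → Odd x → ¬ Div3 x → ∃ λ y → x * x ≡ (1ℤ + + 6 * y) * (1ℤ + + 6 * y)
odd-unit {x} (t , x≡) ne with mod3 x
... | y , inj₁ e = ⊥-elim (ne (y , e))
... | y , inj₂ (inj₁ refl) with parity y
...   | u , inj₁ refl = u , eq u
  where
  eq : ∀ u → (1ℤ + + 3 * (+ 2 * u)) * (1ℤ + + 3 * (+ 2 * u)) ≡ (1ℤ + + 6 * u) * (1ℤ + + 6 * u)
  eq = solve-∀
...   | u , inj₂ refl = ⊥-elim (odd≢even {+ 2 + + 3 * u} {t} (trans (eq u) x≡))
  where
  eq : ∀ u → + 2 * (+ 2 + + 3 * u) ≡ 1ℤ + + 3 * (1ℤ + + 2 * u)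
  eq = solve-∀
odd-unit {x} (t , x≡) ne | y , inj₂ (inj₂ refl) with parity y
...   | u , inj₁ refl = u , eq u
  where
  eq : ∀ u → - (1ℤ + + 3 * (+ 2 * u)) * - (1ℤ + + 3 * (+ 2 * u)) ≡ (1ℤ + + 6 * u) * (1ℤ + + 6 * u)
  eq = solve-∀
...   | u , inj₂ refl = ⊥-elim (odd≢even { - (+ 2 + + 3 * u)} {t} (trans (eq u) x≡))
  where
  eq : ∀ u → + 2 * - (+ 2 + + 3 * u) ≡ - (1ℤ + + 3 * (1ℤ + + 2 * u))
  eq = solve-∀

odd-multiple : ∀ {x} → Odd x → Div3 x → ∃ λ y → x * x ≡ (+ 3 + + 6 * y) * (+ 3 + + 6 * y)
odd-multiple (t , x≡) (y , refl) with parity y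
... | u , inj₁ refl = ⊥-elim (odd≢even {+ 3 * u} {t} (trans (2[3x]≡3[2x] u) x≡))
... | u , inj₂ refl = u , eq u
  where
  eq : ∀ u → + 3 * (1ℤ + + 2 * u) * (+ 3 * (1ℤ + + 2 * u)) ≡ (+ 3 + + 6 * u) * (+ 3 + + 6 * u)
  eq = solve-∀

even-unit : ∀ {x} → Even x → ¬ Div3 x → ∃ λ y → x * x ≡ (+ 2 + + 6 * y) * (+ 2 + + 6 * y)
even-unit (t , refl) ne with mod3 t
... | y , inj₁ refl        = ⊥-elim (ne (+ 2 * y , 2[3x]≡3[2x] y))
... | y , inj₂ (inj₁ refl) = y , eq y
  where
  eq : ∀ y → + 2 * (1ℤ + + 3 * y) * (+ 2 * (1ℤ + + 3 * y)) ≡ (+ 2 + + 6 * y) * (+ 2 + + 6 * y)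
  eq = solve-∀
... | y , inj₂ (inj₂ refl) = y , eq y
  where
  eq : ∀ y → + 2 * - (1ℤ + + 3 * y) * (+ 2 * - (1ℤ + + 3 * y)) ≡ (+ 2 + + 6 * y) * (+ 2 + + 6 * y)
  eq = solve-∀

even-multiple : ∀ {x} → Even x → Div3 x → ∃ λ y → x * x ≡ + 6 * y * (+ 6 * y)
even-multiple (t , x≡) (y , refl) with parity y
... | u , inj₁ refl = u , eq u
  where
  eq : ∀ u → + 3 * (+ 2 * u) * (+ 3 * (+ 2 * u)) ≡ + 6 * u * (+ 6 * u)
  eq = solve-∀
... | u , inj₂ refl = ⊥-elim (odd≢even {t} {1ℤ + + 3 * u} (trans (sym x≡) (eq u)))
  where
  eq : ∀ u → + 3 * (1ℤ + + 2 * u) ≡ 1ℤ + + 2 * (1ℤ + + 3 * u)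
  eq = solve-∀

odd-mod8 : ∀ {x} → Odd x → ∃ λ y → x * x ≡ (1ℤ + + 8 * y) * (1ℤ + + 8 * y) ⊎ x * x ≡ (+ 3 + + 8 * y) * (+ 3 + + 8 * y)
odd-mod8 (t , refl) with parity t
... | s , inj₁ refl with parity s
...   | r , inj₁ refl = r , inj₁ (eq r)
  where
  eq : ∀ r → (1ℤ + + 2 * (+ 2 * (+ 2 * r))) * (1ℤ + + 2 * (+ 2 * (+ 2 * r))) ≡ (1ℤ + + 8 * r) * (1ℤ + + 8 * r)
  eq = solve-∀
...   | r , inj₂ refl = - 1ℤ - r , inj₂ (eq r)
  where
  eq : ∀ r → (1ℤ + + 2 * (+ 2 * (1ℤ + + 2 * r))) * (1ℤ + + 2 * (+ 2 * (1ℤ + + 2 * r))) ≡ (+ 3 + + 8 * (- 1ℤ - r)) * (+ 3 + + 8 * (- 1ℤ - r))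
  eq = solve-∀
odd-mod8 (t , refl) | s , inj₂ refl with parity s
...   | r , inj₁ refl = r , inj₂ (eq r)
  where
  eq : ∀ r → (1ℤ + + 2 * (1ℤ + + 2 * (+ 2 * r))) * (1ℤ + + 2 * (1ℤ + + 2 * (+ 2 * r))) ≡ (+ 3 + + 8 * r) * (+ 3 + + 8 * r)
  eq = solve-∀
...   | r , inj₂ refl = - 1ℤ - r , inj₁ (eq r)
  where
  eq : ∀ r → (1ℤ + + 2 * (1ℤ + + 2 * (1ℤ + + 2 * r))) * (1ℤ + + 2 * (1ℤ + + 2 * (1ℤ + + 2 * r))) ≡ (1ℤ + + 8 * (- 1ℤ - r)) * (1ℤ + + 8 * (- 1ℤ - r))
  eq = solve-∀

odd-mod4 : ∀ {x} → Odd x → ∃ λ y → x * x ≡ (1ℤ + + 4 * y) * (1ℤ + + 4 * y)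
odd-mod4 (t , refl) with parity t
... | s , inj₁ refl = s , eq s
  where
  eq : ∀ s → (1ℤ + + 2 * (+ 2 * s)) * (1ℤ + + 2 * (+ 2 * s)) ≡ (1ℤ + + 4 * s) * (1ℤ + + 4 * s)
  eq = solve-∀
... | s , inj₂ refl = - 1ℤ - s , eq s
  where
  eq : ∀ s → (1ℤ + + 2 * (1ℤ + + 2 * s)) * (1ℤ + + 2 * (1ℤ + + 2 * s)) ≡ (1ℤ + + 4 * (- 1ℤ - s)) * (1ℤ + + 4 * (- 1ℤ - s))
  eq = solve-∀

-- Combining residues of three squares modulo 3

private
  residue1 : ∀ {i j k K} p q r → i ≡ 1ℤ + + 3 * p → j ≡ + 3 * q → k ≡ + 3 * r → i + j + k ≡ + 3 * K → ⊥
  residue1 {K = K} p q r refl refl refl e = 3x≢1+3y K (p + q + r) (trans (sym e) (eq p q r))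
    where
    eq : ∀ p q r → 1ℤ + + 3 * p + + 3 * q + + 3 * r ≡ 1ℤ + + 3 * (p + q + r)
    eq = solve-∀

  residue2 : ∀ {i j k K} p q r → i ≡ 1ℤ + + 3 * p → j ≡ 1ℤ + + 3 * q → k ≡ + 3 * r → i + j + k ≡ + 3 * K → ⊥
  residue2 {K = K} p q r refl refl refl e = 3x≢2+3y K (p + q + r) (trans (sym e) (eq p q r))
    where
    eq : ∀ p q r → 1ℤ + + 3 * p + (1ℤ + + 3 * q) + + 3 * r ≡ + 2 + + 3 * (p + q + r)
    eq = solve-∀

  rotate : ∀ i j k {n} → i + j + k ≡ n → j + k + i ≡ n
  rotate i j k e = trans (eq i j k) e
    where
    eq : ∀ i j k → j + k + i ≡ i + j + k
    eq = solve-∀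

-- Squares are 0 or 1 modulo 3, so three of them add up to 0 only if all are 0 or all are 1.
all-units : ∀ {a b c K} → sumSq a b c ≡ + 3 * K → ¬ (Div3 a × Div3 b × Div3 c) → ¬ Div3 a × ¬ Div3 b × ¬ Div3 c
all-units {a} {b} {c} {K} e ne with square-mod3 a | square-mod3 b | square-mod3 c
... | inj₁ (da , _) | inj₁ (db , _) | inj₁ (dc , _) = ⊥-elim (ne (da , db , dc))
... | inj₂ (_ , p , ep) | inj₁ (_ , q , eq) | inj₁ (_ , r , er) = ⊥-elim (residue1 {K = K} p q r ep eq er e)
... | inj₁ (_ , p , ep) | inj₂ (_ , q , eq) | inj₁ (_ , r , er) = ⊥-elim (residue1 {K = K} q r p eq er ep (rotate (a * a) (b * b) (c * c) e))
... | inj₁ (_ , p , ep) | inj₁ (_ , q , eq) | inj₂ (_ , r , er) = ⊥-elim (residue1 {K = K} r p q er ep eq (rotate (b * b) (c * c) (a * a) (rotate (a * a) (b * b) (c * c) e)))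
... | inj₂ (_ , p , ep) | inj₂ (_ , q , eq) | inj₁ (_ , r , er) = ⊥-elim (residue2 {K = K} p q r ep eq er e)
... | inj₁ (_ , p , ep) | inj₂ (_ , q , eq) | inj₂ (_ , r , er) = ⊥-elim (residue2 {K = K} q r p eq er ep (rotate (a * a) (b * b) (c * c) e))
... | inj₂ (_ , p , ep) | inj₁ (_ , q , eq) | inj₂ (_ , r , er) = ⊥-elim (residue2 {K = K} r p q er ep eq (rotate (b * b) (c * c) (a * a) (rotate (a * a) (b * b) (c * c) e)))
... | inj₂ (na , _) | inj₂ (nb , _) | inj₂ (nc , _) = na , nb , nc

private
  no-1≡2 : ∀ {i j k K} p q r → i ≡ 1ℤ + + 3 * p → j ≡ + 3 * q → k ≡ + 3 * r → i + j + k ≡ + 2 + + 3 * K → ⊥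
  no-1≡2 {K = K} p q r refl refl refl e = 3x≢1+3y (p + q + r - K) 0ℤ (trans (eq₁ p q r K) (trans (cong (λ x → x - 1ℤ - + 3 * K) e) (eq₂ K)))
    where
    eq₁ : ∀ p q r K → + 3 * (p + q + r - K) ≡ 1ℤ + + 3 * p + + 3 * q + + 3 * r - 1ℤ - + 3 * K
    eq₁ = solve-∀
    eq₂ : ∀ K → + 2 + + 3 * K - 1ℤ - + 3 * K ≡ 1ℤ + + 3 * 0ℤ
    eq₂ = solve-∀

  no-0≡2 : ∀ {i j k K} p q r → i ≡ + 3 * p → j ≡ + 3 * q → k ≡ + 3 * r → i + j + k ≡ + 2 + + 3 * K → ⊥
  no-0≡2 {K = K} p q r refl refl refl e = 3x≢2+3y (p + q + r) K (trans (eq p q r) e)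
    where
    eq : ∀ p q r → + 3 * (p + q + r) ≡ + 3 * p + + 3 * q + + 3 * r
    eq = solve-∀

  no-3≡2 : ∀ {i j k K} p q r → i ≡ 1ℤ + + 3 * p → j ≡ 1ℤ + + 3 * q → k ≡ 1ℤ + + 3 * r → i + j + k ≡ + 2 + + 3 * K → ⊥
  no-3≡2 {K = K} p q r refl refl refl e = 3x≢2+3y (1ℤ + p + q + r) K (trans (eq p q r) e)
    where
    eq : ∀ p q r → + 3 * (1ℤ + p + q + r) ≡ 1ℤ + + 3 * p + (1ℤ + + 3 * q) + (1ℤ + + 3 * r)
    eq = solve-∀

one-multiple : ∀ {a b c K} → sumSq a b c ≡ + 2 + + 3 * K → ¬ Div3 a → (Div3 b × ¬ Div3 c) ⊎ (¬ Div3 b × Div3 c)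
one-multiple {a} {b} {c} {K} e na with unit-square na | square-mod3 b | square-mod3 c
... | p , ep | inj₁ (db , _) | inj₂ (nc , _) = inj₁ (db , nc)
... | p , ep | inj₂ (nb , _) | inj₁ (dc , _) = inj₂ (nb , dc)
... | p , ep | inj₁ (_ , q , eq) | inj₁ (_ , r , er) = ⊥-elim (no-1≡2 {K = K} p q r ep eq er e)
... | p , ep | inj₂ (_ , q , eq) | inj₂ (_ , r , er) = ⊥-elim (no-3≡2 {K = K} p q r ep eq er e)

two-units : ∀ {a b c K} → sumSq a b c ≡ + 2 + + 3 * K → Div3 a → ¬ Div3 b × ¬ Div3 c
two-units {a} {b} {c} {K} e (y , refl) with square-mod3 b | square-mod3 c
... | inj₂ (nb , _) | inj₂ (nc , _) = nb , nc
... | inj₁ (_ , q , eq) | inj₁ (_ , r , er) = ⊥-elim (no-0≡2 {K = K} (+ 3 * (y * y)) q r ([3x]²≡3[3x²] y) eq er e)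
... | inj₁ (_ , q , eq) | inj₂ (_ , r , er) = ⊥-elim (no-1≡2 {K = K} r (+ 3 * (y * y)) q er ([3x]²≡3[3x²] y) eq (rotate (b * b) (c * c) _ (rotate (+ 3 * y * (+ 3 * y)) (b * b) (c * c) e)))
... | inj₂ (_ , q , eq) | inj₁ (_ , r , er) = ⊥-elim (no-1≡2 {K = K} q r (+ 3 * (y * y)) eq er ([3x]²≡3[3x²] y) (rotate (+ 3 * y * (+ 3 * y)) (b * b) (c * c) e))

opposite-units : ∀ {a b} → ¬ Div3 a → ¬ Div3 b → Div3 (a + b) ⊎ Div3 (a + - b)
opposite-units {a} {b} na nb with mod3 a | mod3 b
... | x , inj₁ e | _ = ⊥-elim (na (x , e))
... | _ , inj₂ _ | y , inj₁ e = ⊥-elim (nb (y , e))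
... | x , inj₂ (inj₁ refl) | y , inj₂ (inj₁ refl) = inj₂ (x - y , [1+3x]-[1+3y]≡3[x-y] x y)
... | x , inj₂ (inj₁ refl) | y , inj₂ (inj₂ refl) = inj₁ (x - y , [1+3x]-[1+3y]≡3[x-y] x y)
... | x , inj₂ (inj₂ refl) | y , inj₂ (inj₁ refl) = inj₁ (y - x , eq x y)
  where
  eq : ∀ x y → - (1ℤ + + 3 * x) + (1ℤ + + 3 * y) ≡ + 3 * (y - x)
  eq = solve-∀
... | x , inj₂ (inj₂ refl) | y , inj₂ (inj₂ refl) = inj₂ (y - x , eq x y)
  where
  eq : ∀ x y → - (1ℤ + + 3 * x) + - - (1ℤ + + 3 * y) ≡ + 3 * (y - x)
  eq = solve-∀

-- `improve₂` makes some entry prime to 3. The norm stays divisible by 3, and `a² + 2b²` is then 0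
-- modulo 3 only if 3 divides both entries or neither; so the first entry is prime to 3.
unit-first-proof : ∀ a b → a * a + + 2 * (b * b) ≢ 0ℤ → Div3 a → Div3 b →
  ∃ λ d → ∃ λ e → (a + + 2 * d) * (a + + 2 * d) + + 2 * ((b + + 2 * e) * (b + + 2 * e)) ≡ a * a + + 2 * (b * b) × ¬ Div3 (a + + 2 * d)
unit-first-proof a b ne da db with improve₂ (a * a + + 2 * (b * b)) ne a b refl
... | d , e , h , nd = d , e , h , λ da′ → nd (da′ , second (a + + 2 * d) (b + + 2 * e) h da′)
  where
  norm : ∀ {a b} → Div3 a → Div3 b → Div3 (a * a + + 2 * (b * b))
  norm (x , refl) (y , refl) = + 3 * (x * x) + + 6 * (y * y) , eq x y
    where
    eq : ∀ x y → + 3 * x * (+ 3 * x) + + 2 * (+ 3 * y * (+ 3 * y)) ≡ + 3 * (+ 3 * (x * x) + + 6 * (y * y))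
    eq = solve-∀
  second : ∀ a′ b′ → a′ * a′ + + 2 * (b′ * b′) ≡ a * a + + 2 * (b * b) → Div3 a′ → Div3 b′
  second a′ b′ h (x , refl) with square-mod3 b′ | norm da db
  ... | inj₁ (db′ , _) | _ = db′
  ... | inj₂ (_ , k , ek) | K , eK = ⊥-elim (3x≢2+3y K (+ 3 * (x * x) + + 2 * k) (trans (sym eK) (trans (sym h) (trans (cong (λ z → + 3 * x * (+ 3 * x) + + 2 * z) ek) (eq x k)))))
    where
    eq : ∀ x k → + 3 * x * (+ 3 * x) + + 2 * (1ℤ + + 3 * k) ≡ + 2 + + 3 * (+ 3 * (x * x) + + 2 * k)
    eq = solve-∀

abstract

  unit-first : ∀ a b → a * a + + 2 * (b * b) ≢ 0ℤ → Div3 a → Div3 b →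
    ∃ λ d → ∃ λ e → (a + + 2 * d) * (a + + 2 * d) + + 2 * ((b + + 2 * e) * (b + + 2 * e)) ≡ a * a + + 2 * (b * b) × ¬ Div3 (a + + 2 * d)
  unit-first = unit-first-proof

-- Universality of the five forms

private
  Represents : ℕ → ℕ → ℕ → ℕ → ℤ → Set
  Represents a b c d n = ∃ λ x → ∃ λ y → ∃ λ z → form a b c d x y z ≡ n

  substitute³ : ∀ {a b c i j k N} → a ≡ i → b ≡ j → c ≡ k → a + b + c ≡ N → i + j + k ≡ N
  substitute³ refl refl refl e = e

  -- Completing the square: `12 x(3x + b) = (6x + b)² - b²`, so the constant is the sum of the
  -- squares of the three linear coefficients, here `0 + 1 + 4`. For `a = 4` the identity is
  -- `16 x(4x + b) = (8x + b)² - b²`.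
  complete-q1 : ∀ X Y Z n → + 6 * X * (+ 6 * X) + (1ℤ + + 6 * Y) * (1ℤ + + 6 * Y) + (+ 2 + + 6 * Z) * (+ 2 + + 6 * Z) ≡ + 5 + + 12 * n → Represents 3 0 1 2 n
  complete-q1 X Y Z n e = X , Y , Z , cancel-factor 11 (trans (eq X Y Z) (trans (cong (_- + 5) e) (eq′ n)))
    where
    eq : ∀ X Y Z → + 12 * (X * (+ 3 * X + + 0) + Y * (+ 3 * Y + + 1) + Z * (+ 3 * Z + + 2)) ≡ + 6 * X * (+ 6 * X) + (1ℤ + + 6 * Y) * (1ℤ + + 6 * Y) + (+ 2 + + 6 * Z) * (+ 2 + + 6 * Z) - + 5
    eq = solve-∀
    eq′ : ∀ n → + 5 + + 12 * n - + 5 ≡ + 12 * n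
    eq′ = solve-∀

  complete-q2 : ∀ X Y Z n → (1ℤ + + 6 * X) * (1ℤ + + 6 * X) + (1ℤ + + 6 * Y) * (1ℤ + + 6 * Y) + (+ 2 + + 6 * Z) * (+ 2 + + 6 * Z) ≡ + 6 + + 12 * n → Represents 3 1 1 2 n
  complete-q2 X Y Z n e = X , Y , Z , cancel-factor 11 (trans (eq X Y Z) (trans (cong (_- + 6) e) (eq′ n)))
    where
    eq : ∀ X Y Z → + 12 * (X * (+ 3 * X + + 1) + Y * (+ 3 * Y + + 1) + Z * (+ 3 * Z + + 2)) ≡ (1ℤ + + 6 * X) * (1ℤ + + 6 * X) + (1ℤ + + 6 * Y) * (1ℤ + + 6 * Y) + (+ 2 + + 6 * Z) * (+ 2 + + 6 * Z) - + 6
    eq = solve-∀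
    eq′ : ∀ n → + 6 + + 12 * n - + 6 ≡ + 12 * n
    eq′ = solve-∀

  complete-q3 : ∀ X Y Z n → (1ℤ + + 6 * X) * (1ℤ + + 6 * X) + (+ 2 + + 6 * Y) * (+ 2 + + 6 * Y) + (+ 2 + + 6 * Z) * (+ 2 + + 6 * Z) ≡ + 9 + + 12 * n → Represents 3 1 2 2 n
  complete-q3 X Y Z n e = X , Y , Z , cancel-factor 11 (trans (eq X Y Z) (trans (cong (_- + 9) e) (eq′ n)))
    where
    eq : ∀ X Y Z → + 12 * (X * (+ 3 * X + + 1) + Y * (+ 3 * Y + + 2) + Z * (+ 3 * Z + + 2)) ≡ (1ℤ + + 6 * X) * (1ℤ + + 6 * X) + (+ 2 + + 6 * Y) * (+ 2 + + 6 * Y) + (+ 2 + + 6 * Z) * (+ 2 + + 6 * Z) - + 9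
    eq = solve-∀
    eq′ : ∀ n → + 9 + + 12 * n - + 9 ≡ + 12 * n
    eq′ = solve-∀

  complete-q4 : ∀ X Y Z n → (1ℤ + + 6 * X) * (1ℤ + + 6 * X) + (+ 2 + + 6 * Y) * (+ 2 + + 6 * Y) + (+ 3 + + 6 * Z) * (+ 3 + + 6 * Z) ≡ + 14 + + 12 * n → Represents 3 1 2 3 n
  complete-q4 X Y Z n e = X , Y , Z , cancel-factor 11 (trans (eq X Y Z) (trans (cong (_- + 14) e) (eq′ n)))
    where
    eq : ∀ X Y Z → + 12 * (X * (+ 3 * X + + 1) + Y * (+ 3 * Y + + 2) + Z * (+ 3 * Z + + 3)) ≡ (1ℤ + + 6 * X) * (1ℤ + + 6 * X) + (+ 2 + + 6 * Y) * (+ 2 + + 6 * Y) + (+ 3 + + 6 * Z) * (+ 3 + + 6 * Z) - + 14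
    eq = solve-∀
    eq′ : ∀ n → + 14 + + 12 * n - + 14 ≡ + 12 * n
    eq′ = solve-∀

  complete-q5 : ∀ X Y Z n → (1ℤ + + 8 * X) * (1ℤ + + 8 * X) + (+ 2 + + 8 * Y) * (+ 2 + + 8 * Y) + (+ 3 + + 8 * Z) * (+ 3 + + 8 * Z) ≡ + 14 + + 16 * n → Represents 4 1 2 3 n
  complete-q5 X Y Z n e = X , Y , Z , cancel-factor 15 (trans (eq X Y Z) (trans (cong (_- + 14) e) (eq′ n)))
    where
    eq : ∀ X Y Z → + 16 * (X * (+ 4 * X + + 1) + Y * (+ 4 * Y + + 2) + Z * (+ 4 * Z + + 3)) ≡ (1ℤ + + 8 * X) * (1ℤ + + 8 * X) + (+ 2 + + 8 * Y) * (+ 2 + + 8 * Y) + (+ 3 + + 8 * Z) * (+ 3 + + 8 * Z) - + 14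
    eq = solve-∀
    eq′ : ∀ n → + 14 + + 16 * n - + 14 ≡ + 16 * n
    eq′ = solve-∀

  affine≥0 : ∀ i k n → 0ℤ ≤ + i + + k * + n
  affine≥0 i k n = subst (λ x → 0ℤ ≤ + i + x) (ℤₚ.pos-* k n) (+≤+ ℕ.z≤n)

  affine≢0 : ∀ i k n → + suc i + + k * + n ≢ 0ℤ
  affine≢0 i k n e = contra (trans (cong (λ x → + suc i + x) (ℤₚ.pos-* k n)) e)
    where
    contra : + (suc i ℕ.+ k ℕ.* n) ≢ 0ℤ
    contra ()

  square≡ : ∀ {x y} → x ≡ y → x * x ≡ y * y
  square≡ refl = refl

-- Doubling `x² + y² + 2z²` gives `(x + y)² + (x - y)² + (2z)²`, and `x + y` is odd with `x² + y²`.
-- The original equation is returned too, for recognising the degenerate case of (3,1,2,3).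
two-mod-four-represented-proof : ∀ m → 0ℤ ≤ m → ∃ λ x → ∃ λ y → ∃ λ z →
  Odd (x + y) × Odd (x - y) × x * x + y * y + + 2 * (z * z) ≡ 1ℤ + + 2 * m × sumSq (x + y) (x - y) (+ 2 * z) ≡ + 2 * (1ℤ + + 2 * m)
two-mod-four-represented-proof m m≥0 with odd-represented m m≥0
... | x , y , z , e = x , y , z , odd , subst Odd (eq₁ x y) (odd-shift (- y) odd) , e , trans (eq₂ x y z) (cong (λ n → + 2 * n) e)
  where
  eq₁ : ∀ x y → x + y + + 2 * - y ≡ x - y
  eq₁ = solve-∀
  eq₂ : ∀ x y z → (x + y) * (x + y) + (x - y) * (x - y) + + 2 * z * (+ 2 * z) ≡ + 2 * (x * x + y * y + + 2 * (z * z))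
  eq₂ = solve-∀
  eq₃ : ∀ t x y z → + 2 * (t * (+ 2 * t) - x * y + z * z) ≡ + 2 * t * (+ 2 * t) - + 2 * (x * y) + + 2 * (z * z)
  eq₃ = solve-∀
  eq₄ : ∀ x y z → (x + y) * (x + y) - + 2 * (x * y) + + 2 * (z * z) ≡ x * x + y * y + + 2 * (z * z)
  eq₄ = solve-∀
  odd : Odd (x + y)
  odd with parity (x + y)
  ... | t , inj₂ h = t , h
  ... | t , inj₁ h = ⊥-elim (odd≢even {t * (+ 2 * t) - x * y + z * z} {m}
    (trans (eq₃ t x y z) (trans (cong (λ s → s * s - + 2 * (x * y) + + 2 * (z * z)) (sym h)) (trans (eq₄ x y z) e))))

abstract

  two-mod-four-represented : ∀ m → 0ℤ ≤ m → ∃ λ x → ∃ λ y → ∃ λ z →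
    Odd (x + y) × Odd (x - y) × x * x + y * y + + 2 * (z * z) ≡ 1ℤ + + 2 * m × sumSq (x + y) (x - y) (+ 2 * z) ≡ + 2 * (1ℤ + + 2 * m)
  two-mod-four-represented = two-mod-four-represented-proof

q2-universal : ∀ n → Represents 3 1 1 2 (+ n)
q2-universal n with two-mod-four-represented (1ℤ + + 3 * + n) (affine≥0 1 3 n)
... | x , y , z , oa , ob , _ , e with improve (+ 6 + + 12 * + n) (affine≢0 5 12 n) (x + y) (x - y) (+ 2 * z) (trans e (eq (+ n)))
  where
  eq : ∀ n → + 2 * (1ℤ + + 2 * (1ℤ + + 3 * n)) ≡ + 6 + + 12 * n
  eq = solve-∀
... | d , e′ , f , h , ne with all-units {K = + 2 + + 4 * + n} (trans h (eq (+ n))) ne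
  where
  eq : ∀ n → + 6 + + 12 * n ≡ + 3 * (+ 2 + + 4 * n)
  eq = solve-∀
... | na , nb , nc with odd-unit (odd-shift d oa) na | odd-unit (odd-shift e′ ob) nb | even-unit (even-shift f (z , refl)) nc
... | X , eX | Y , eY | Z , eZ = complete-q2 X Y Z (+ n) (substitute³ eX eY eZ h)

q3-universal : ∀ n → Represents 3 1 2 2 (+ n)
q3-universal n with one-mod-four-represented (+ 2 + + 3 * + n) (affine≥0 2 3 n)
... | o , w , z , e with parity o
...   | t , inj₁ refl = ⊥-elim (odd≢even {t * (+ 2 * t) + + 2 * (w * w + z * z)} {+ 2 * (+ 2 + + 3 * + n)} (trans (even-first t w z) (trans e (eq₂ (+ n)))))
  where
  eq₂ : ∀ n → 1ℤ + + 4 * (+ 2 + + 3 * n) ≡ 1ℤ + + 2 * (+ 2 * (+ 2 + + 3 * n))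
  eq₂ = solve-∀
...   | t , inj₂ o≡ with improve (+ 9 + + 12 * + n) (affine≢0 8 12 n) o (+ 2 * w) (+ 2 * z) (trans (even-last-two o w z) (trans e (eq₂ (+ n))))
  where
  eq₂ : ∀ n → 1ℤ + + 4 * (+ 2 + + 3 * n) ≡ + 9 + + 12 * n
  eq₂ = solve-∀
... | d , e′ , f , h , ne with all-units {K = + 3 + + 4 * + n} (trans h (eq (+ n))) ne
  where
  eq : ∀ n → + 9 + + 12 * n ≡ + 3 * (+ 3 + + 4 * n)
  eq = solve-∀
... | na , nb , nc with odd-unit (odd-shift d (t , o≡)) na | even-unit (even-shift e′ (w , refl)) nb | even-unit (even-shift f (z , refl)) nc
... | X , eX | Y , eY | Z , eZ = complete-q3 X Y Z (+ n) (substitute³ eX eY eZ h)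

private
  -- Twice the sum of squares is `2(c² + 2σ²) + (a - b)²` with `σ = (a + b)/2`. Adding `2f` to both
  -- `a` and `b` keeps `a - b`, so only the binary norm `c² + 2σ²` has to be preserved.
  shifted : ∀ c a b σ c′ f → a + b ≡ + 2 * σ → c′ * c′ + + 2 * ((σ + + 2 * f) * (σ + + 2 * f)) ≡ c * c + + 2 * (σ * σ) →
            sumSq c′ (a + + 2 * f) (b + + 2 * f) ≡ sumSq c a b
  shifted c a b σ c′ f s h = cancel-double (begin
    + 2 * (c′ * c′ + (a + + 2 * f) * (a + + 2 * f) + (b + + 2 * f) * (b + + 2 * f))
      ≡⟨ eq₁ c′ a b f ⟩
    + 2 * (c′ * c′) + (a + b + + 4 * f) * (a + b + + 4 * f) + (a - b) * (a - b)
      ≡⟨ cong (λ x → + 2 * (c′ * c′) + (x + + 4 * f) * (x + + 4 * f) + (a - b) * (a - b)) s ⟩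
    + 2 * (c′ * c′) + (+ 2 * σ + + 4 * f) * (+ 2 * σ + + 4 * f) + (a - b) * (a - b)
      ≡⟨ cong (_+ (a - b) * (a - b)) (eq₂ c′ σ f) ⟩
    + 2 * (c′ * c′ + + 2 * ((σ + + 2 * f) * (σ + + 2 * f))) + (a - b) * (a - b)
      ≡⟨ cong (λ x → + 2 * x + (a - b) * (a - b)) h ⟩
    + 2 * (c * c + + 2 * (σ * σ)) + (a - b) * (a - b)
      ≡⟨ cong (_+ (a - b) * (a - b)) (eq₃ c σ) ⟩
    + 2 * (c * c) + + 2 * σ * (+ 2 * σ) + (a - b) * (a - b)
      ≡⟨ cong (λ x → + 2 * (c * c) + x * x + (a - b) * (a - b)) s ⟨
    + 2 * (c * c) + (a + b) * (a + b) + (a - b) * (a - b)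
      ≡⟨ eq₄ c a b ⟩
    + 2 * (c * c + a * a + b * b) ∎)
    where
    open ≡-Reasoning
    eq₁ : ∀ c a b f → + 2 * (c * c + (a + + 2 * f) * (a + + 2 * f) + (b + + 2 * f) * (b + + 2 * f)) ≡ + 2 * (c * c) + (a + b + + 4 * f) * (a + b + + 4 * f) + (a - b) * (a - b)
    eq₁ = solve-∀
    eq₂ : ∀ c σ f → + 2 * (c * c) + (+ 2 * σ + + 4 * f) * (+ 2 * σ + + 4 * f) ≡ + 2 * (c * c + + 2 * ((σ + + 2 * f) * (σ + + 2 * f)))
    eq₂ = solve-∀
    eq₃ : ∀ c σ → + 2 * (c * c + + 2 * (σ * σ)) ≡ + 2 * (c * c) + + 2 * σ * (+ 2 * σ)
    eq₃ = solve-∀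
    eq₄ : ∀ c a b → + 2 * (c * c) + (a + b) * (a + b) + (a - b) * (a - b) ≡ + 2 * (c * c + a * a + b * b)
    eq₄ = solve-∀

  swap₁ : ∀ a b c → a + b + c ≡ b + a + c
  swap₁ = solve-∀

  swap₂ : ∀ a b c → a + b + c ≡ b + c + a
  swap₂ = solve-∀

  5+12n : ∀ n → + 5 + + 12 * n ≡ + 2 + + 3 * (1ℤ + + 4 * n)
  5+12n = solve-∀

  14+12n : ∀ n → + 14 + + 12 * n ≡ + 2 + + 3 * (+ 4 + + 4 * n)
  14+12n = solve-∀

  finish-q1 : ∀ o w z n → Odd o → Even w → Even z → ¬ Div3 o → sumSq o w z ≡ + 5 + + 12 * n → Represents 3 0 1 2 n
  finish-q1 o w z n oo ew ez nₒ e = split (one-multiple {o} {w} {z} {1ℤ + + 4 * n} (trans e (5+12n n)) nₒ)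
    where
    split : (Div3 w × ¬ Div3 z) ⊎ (¬ Div3 w × Div3 z) → Represents 3 0 1 2 n
    split (inj₁ (dw , nz)) =
      let (X , eX) = even-multiple ew dw ; (Y , eY) = odd-unit oo nₒ ; (Z , eZ) = even-unit ez nz
      in complete-q1 X Y Z n (substitute³ eX eY eZ (trans (swap₁ (w * w) (o * o) (z * z)) e))
    split (inj₂ (nw , dz)) =
      let (X , eX) = even-multiple ez dz ; (Y , eY) = odd-unit oo nₒ ; (Z , eZ) = even-unit ew nw
      in complete-q1 X Y Z n (substitute³ eX eY eZ (trans (swap₂ (z * z) (o * o) (w * w)) e))

  repair-q1 : ∀ o w z n → Odd o → Div3 o → Div3 (w + z) → sumSq o (+ 2 * w) (+ 2 * z) ≡ + 5 + + 12 * n → Represents 3 0 1 2 n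
  repair-q1 o w z n (t , o≡) dₒ ds e = finish (unit-first o (w + z) nonzero dₒ ds)
    where
    eq : ∀ t s → (1ℤ + + 2 * t) * (1ℤ + + 2 * t) + + 2 * s ≡ 1ℤ + + 2 * (+ 2 * t + + 2 * (t * t) + s)
    eq = solve-∀
    -- Oddness of `o` excludes the zero vector, which no rotation can move. In `repair-q4` the
    -- corresponding coordinate is even, and the nonvanishing becomes a hypothesis.
    nonzero : o * o + + 2 * ((w + z) * (w + z)) ≢ 0ℤ
    nonzero h = odd≢even {0ℤ} {+ 2 * t + + 2 * (t * t) + (w + z) * (w + z)}
      (trans (sym h) (trans (cong (λ x → x * x + + 2 * ((w + z) * (w + z))) o≡) (eq t ((w + z) * (w + z)))))
    finish : (∃ λ d → ∃ λ f → (o + + 2 * d) * (o + + 2 * d) + + 2 * ((w + z + + 2 * f) * (w + z + + 2 * f)) ≡ o * o + + 2 * ((w + z) * (w + z)) × ¬ Div3 (o + + 2 * d)) → Represents 3 0 1 2 n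
    finish (d , f , h , nₒ) = finish-q1 (o + + 2 * d) (+ 2 * w + + 2 * f) (+ 2 * z + + 2 * f) n (odd-shift d (t , o≡)) (even-shift f (w , refl)) (even-shift f (z , refl)) nₒ
      (trans (shifted o (+ 2 * w) (+ 2 * z) (w + z) (o + + 2 * d) f (sym (ℤₚ.*-distribˡ-+ (+ 2) w z)) h) e)

  div3-half : ∀ {x} → ¬ Div3 (+ 2 * x) → ¬ Div3 x
  div3-half ne (y , refl) = ne (+ 2 * y , 2[3x]≡3[2x] y)

q1-universal : ∀ n → Represents 3 0 1 2 (+ n)
q1-universal n with one-mod-four-represented (1ℤ + + 3 * + n) (affine≥0 1 3 n)
... | o , w , z , e with parity o
...   | t , inj₁ refl = ⊥-elim (odd≢even {t * (+ 2 * t) + + 2 * (w * w + z * z)} {+ 2 * (1ℤ + + 3 * + n)} (trans (even-first t w z) (trans e (eq₂ (+ n)))))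
  where
  eq₂ : ∀ n → 1ℤ + + 4 * (1ℤ + + 3 * n) ≡ 1ℤ + + 2 * (+ 2 * (1ℤ + + 3 * n))
  eq₂ = solve-∀
...   | t , inj₂ o≡ = cases (div3? o)
  where
  eq₂ : ∀ n → 1ℤ + + 4 * (1ℤ + + 3 * n) ≡ + 5 + + 12 * n
  eq₂ = solve-∀
  sum : sumSq o (+ 2 * w) (+ 2 * z) ≡ + 5 + + 12 * + n
  sum = trans (even-last-two o w z) (trans e (eq₂ (+ n)))
  neg : ∀ o w z → o * o + + 2 * w * (+ 2 * w) + + 2 * - z * (+ 2 * - z) ≡ o * o + + 2 * w * (+ 2 * w) + + 2 * z * (+ 2 * z)
  neg = solve-∀
  cases : Dec (Div3 o) → Represents 3 0 1 2 (+ n)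
  cases (no no′) = finish-q1 o (+ 2 * w) (+ 2 * z) (+ n) (t , o≡) (w , refl) (z , refl) no′ sum
  cases (yes dₒ) with two-units {o} {+ 2 * w} {+ 2 * z} {1ℤ + + 4 * + n} (trans sum (5+12n (+ n))) dₒ
  ... | nw , nz with opposite-units {w} {z} (div3-half nw) (div3-half nz)
  ...   | inj₁ ds = repair-q1 o w z (+ n) (t , o≡) dₒ ds sum
  ...   | inj₂ ds = repair-q1 o w (- z) (+ n) (t , o≡) dₒ ds (trans (neg o w z) sum)

private
  finish-q4 : ∀ a b c n → Odd a → Odd b → Even c → ¬ Div3 c → sumSq c a b ≡ + 14 + + 12 * n → Represents 3 1 2 3 n
  finish-q4 a b c n oa ob ec nc e = split (one-multiple {c} {a} {b} {+ 4 + + 4 * n} (trans e (14+12n n)) nc)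
    where
    split : (Div3 a × ¬ Div3 b) ⊎ (¬ Div3 a × Div3 b) → Represents 3 1 2 3 n
    split (inj₁ (da , nb)) =
      let (X , eX) = odd-unit ob nb ; (Y , eY) = even-unit ec nc ; (Z , eZ) = odd-multiple oa da
      in complete-q4 X Y Z n (substitute³ eX eY eZ (trans (swap₂ (b * b) (c * c) (a * a)) e))
    split (inj₂ (na , db)) =
      let (X , eX) = odd-unit oa na ; (Y , eY) = even-unit ec nc ; (Z , eZ) = odd-multiple ob db
      in complete-q4 X Y Z n (substitute³ eX eY eZ (trans (swap₁ (a * a) (c * c) (b * b)) e))

  sum-nonzero : ∀ c s → c ≢ 0ℤ ⊎ s ≢ 0ℤ → c * c + + 2 * (s * s) ≢ 0ℤ
  sum-nonzero c s (inj₁ h) e = ℤₚ.<-irrefl (sym e) (ℤₚ.+-mono-<-≤ {0ℤ} {c * c} {0ℤ} (sq-pos c h) (nonneg-double (nonneg-sq s)))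
  sum-nonzero c s (inj₂ h) e = ℤₚ.<-irrefl (sym e) (ℤₚ.+-mono-≤-< {0ℤ} {c * c} {0ℤ} (nonneg-sq c) (pos-double (sq-pos s h)))

  repair-q4 : ∀ a b c n → Odd a → Odd b → Even c → c ≢ 0ℤ ⊎ a + b ≢ 0ℤ → Div3 c → Div3 (a + b) → sumSq c a b ≡ + 14 + + 12 * n → Represents 3 1 2 3 n
  repair-q4 a b c n (s , a≡) (t , b≡) ec nz dc ds e = finish (unit-first c σ (sum-nonzero c σ (nonzero nz)) dc (div3-double (div3-≡ ds a+b≡)))
    where
    σ = 1ℤ + s + t
    a+b≡ : a + b ≡ + 2 * σ
    a+b≡ = trans (cong₂ _+_ a≡ b≡) (odd+odd s t)
    nonzero : c ≢ 0ℤ ⊎ a + b ≢ 0ℤ → c ≢ 0ℤ ⊎ σ ≢ 0ℤ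
    nonzero (inj₁ h) = inj₁ h
    nonzero (inj₂ h) = inj₂ (λ z → h (trans a+b≡ (cong (λ x → + 2 * x) z)))
    finish : (∃ λ d → ∃ λ f → (c + + 2 * d) * (c + + 2 * d) + + 2 * ((σ + + 2 * f) * (σ + + 2 * f)) ≡ c * c + + 2 * (σ * σ) × ¬ Div3 (c + + 2 * d)) → Represents 3 1 2 3 n
    finish (d , f , h , nc) = finish-q4 (a + + 2 * f) (b + + 2 * f) (c + + 2 * d) n (odd-shift f (s , a≡)) (odd-shift f (t , b≡)) (even-shift d ec) nc
      (trans (shifted c a b σ (c + + 2 * d) f a+b≡ h) e)

  odd-neg : ∀ {x} → Odd x → Odd (- x)
  odd-neg (t , refl) = - 1ℤ - t , eq t
    where
    eq : ∀ t → - (1ℤ + + 2 * t) ≡ 1ℤ + + 2 * (- 1ℤ - t)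
    eq = solve-∀

  -- Which of `a + b` and `a - b` is divisible by 3 is not known beforehand, so if `c = 0` both must
  -- be nonzero for the rotation to apply.
  nondegenerate-q4 : ∀ a b c n → Odd a → Odd b → Even c → c ≢ 0ℤ ⊎ (a + b ≢ 0ℤ × a + - b ≢ 0ℤ) → sumSq c a b ≡ + 14 + + 12 * n → Represents 3 1 2 3 n
  nondegenerate-q4 a b c n oa ob ec nz e = cases (div3? c)
    where
    neg : ∀ a b c → c * c + a * a + - b * - b ≡ c * c + a * a + b * b
    neg = solve-∀
    signs : Div3 c → Div3 (a + b) ⊎ Div3 (a + - b) → Represents 3 1 2 3 n
    signs dc (inj₁ ds) = repair-q4 a b c n oa ob ec (Sum.map₂ proj₁ nz) dc ds e
    signs dc (inj₂ ds) = repair-q4 a (- b) c n oa (odd-neg ob) ec (Sum.map₂ proj₂ nz) dc ds (trans (neg a b c) e)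
    cases : Dec (Div3 c) → Represents 3 1 2 3 n
    cases (no nc) = finish-q4 a b c n oa ob ec nc e
    cases (yes dc) = let (na , nb) = two-units {c} {a} {b} {+ 4 + + 4 * n} (trans e (14+12n n)) dc in signs dc (opposite-units {a} {b} na nb)

  product≢0 : ∀ {x y} → x ≢ 0ℤ → y ≢ 0ℤ → x * y ≢ 0ℤ
  product≢0 {x} hx hy e with ℤₚ.i*j≡0⇒i≡0∨j≡0 x e
  ... | inj₁ z = hx z
  ... | inj₂ z = hy z

  -- The excluded case is `c = 0` with `a = b` or `a = -b`, where `12n + 14` is `2 o²`. What is
  -- wanted is another representation of that number, with `c` nonzero.
  DoubleSquare : ℤ → Set
  DoubleSquare o = ∃ λ a → ∃ λ b → ∃ λ c → Odd a × Odd b × Even c × c ≢ 0ℤ × sumSq c a b ≡ + 2 * (o * o)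

  odd-minus : ∀ {o} k → Odd o → Odd (+ 2 * k - o)
  odd-minus k (t , refl) = k - t - 1ℤ , eq k t
    where
    eq : ∀ k t → + 2 * k - (1ℤ + + 2 * t) ≡ 1ℤ + + 2 * (k - t - 1ℤ)
    eq = solve-∀

  -- The reflection of (o, o, 0) in the vector (x + y, x - y, 2z), which has norm 2o.
  reflected : ∀ x y z o → x ≢ 0ℤ → z ≢ 0ℤ → Odd o → x * x + y * y + + 2 * (z * z) ≡ o → DoubleSquare o
  reflected x y z o hx hz oo e = + 2 * (x * (x + y)) - o , + 2 * (x * (x - y)) - o , + 2 * (+ 2 * (x * z)) ,
    odd-minus (x * (x + y)) oo , odd-minus (x * (x - y)) oo , (+ 2 * (x * z) , refl) ,
    product≢0 {+ 2} (λ ()) (product≢0 {+ 2} (λ ()) (product≢0 hx hz)) ,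
    trans (eq₁ x y z o) (trans (cong (λ s → + 8 * (x * x) * s - + 8 * (x * x) * o + + 2 * (o * o)) e) (eq₂ (x * x) o))
    where
    eq₁ : ∀ x y z o → + 2 * (+ 2 * (x * z)) * (+ 2 * (+ 2 * (x * z))) + (+ 2 * (x * (x + y)) - o) * (+ 2 * (x * (x + y)) - o) + (+ 2 * (x * (x - y)) - o) * (+ 2 * (x * (x - y)) - o) ≡ + 8 * (x * x) * (x * x + y * y + + 2 * (z * z)) - + 8 * (x * x) * o + + 2 * (o * o)
    eq₁ = solve-∀
    eq₂ : ∀ s o → + 8 * s * o - + 8 * s * o + + 2 * (o * o) ≡ + 2 * (o * o)
    eq₂ = solve-∀

  -- The reflection of (o, o, 0) in the vector (x, 0, y), which has norm o.
  reflected₂ : ∀ x y o → x ≢ 0ℤ → y ≢ 0ℤ → Odd o → x * x + y * y ≡ o → DoubleSquare o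
  reflected₂ x y o hx hy oo e = + 2 * (x * x) - o , o , + 2 * (x * y) , odd-minus (x * x) oo , oo , (x * y , refl) ,
    product≢0 {+ 2} (λ ()) (product≢0 hx hy) , trans (eq₁ x y o) (trans (cong (λ s → + 4 * (x * x) * s - + 4 * (x * x) * o + + 2 * (o * o)) e) (eq₂ (x * x) o))
    where
    eq₁ : ∀ x y o → + 2 * (x * y) * (+ 2 * (x * y)) + (+ 2 * (x * x) - o) * (+ 2 * (x * x) - o) + o * o ≡ + 4 * (x * x) * (x * x + y * y) - + 4 * (x * x) * o + + 2 * (o * o)
    eq₁ = solve-∀
    eq₂ : ∀ s o → + 4 * s * o - + 4 * s * o + + 2 * (o * o) ≡ + 2 * (o * o)
    eq₂ = solve-∀

  odd-* : ∀ {x y} → Odd x → Odd y → Odd (x * y)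
  odd-* (s , refl) (t , refl) = s + t + + 2 * (s * t) , odd*odd s t

  even-* : ∀ {x} y → Even x → Even (y * x)
  even-* y (t , refl) = y * t , eq y t
    where
    eq : ∀ y t → y * (+ 2 * t) ≡ + 2 * (y * t)
    eq = solve-∀

  scaled : ∀ f → f ≢ 0ℤ → Odd f → DoubleSquare f → DoubleSquare (f * f)
  scaled f hf of (a , b , c , oa , ob , ec , hc , e) = f * a , f * b , f * c , odd-* of oa , odd-* of ob , even-* f ec , product≢0 hf hc ,
    trans (eq₁ f a b c) (trans (cong (λ s → f * f * s) e) (eq₂ f))
    where
    eq₁ : ∀ f a b c → f * c * (f * c) + f * a * (f * a) + f * b * (f * b) ≡ f * f * (c * c + a * a + b * b)
    eq₁ = solve-∀
    eq₂ : ∀ f → f * f * (+ 2 * (f * f)) ≡ + 2 * (f * f * (f * f))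
    eq₂ = solve-∀

  odd-root : ∀ f → Odd (f * f) → Odd f
  odd-root f (t , e) with parity f
  ... | s , inj₂ h = s , h
  ... | s , inj₁ refl = ⊥-elim (odd≢even {s * (+ 2 * s)} {t} (trans (eq s) e))
    where
    eq : ∀ s → + 2 * (s * (+ 2 * s)) ≡ + 2 * s * (+ 2 * s)
    eq = solve-∀

  abs-square : ∀ y → + ∣ y ∣ * + ∣ y ∣ ≡ y * y
  abs-square (+ n)    = refl
  abs-square -[1+ n ] = refl

  root-bounds : ∀ k → 1ℤ < + k * + k → 1ℤ < + k × + k < + k * + k
  root-bounds zero h = ⊥-elim (ℤₚ.<⇒≱ h (+≤+ ℕ.z≤n))
  root-bounds (suc zero) h = ⊥-elim (ℤₚ.<-irrefl refl h)
  root-bounds (suc (suc k)) h = +<+ (ℕ.s≤s (ℕ.s≤s ℕ.z≤n)) , +<+ (ℕₚ.m<m*n (suc (suc k)) (suc (suc k)) (ℕ.s≤s (ℕ.s≤s ℕ.z≤n)))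

  -- Write `o = x² + y² + 2z²`. A reflection of `(o, o, 0)` gives a nonzero third entry unless
  -- `z = 0` and one of `x`, `y` vanishes. Then `o` is the square of some smaller `f > 1`, and a
  -- representation for `f` is multiplied by `f`. The value 1 is excluded because 2 is only
  -- `1 + 1 + 0`.
  double-square-proof : ∀ o → 1ℤ < o → Odd o → DoubleSquare o
  double-square-proof = ℤ-rec (λ o → 1ℤ < o → Odd o → DoubleSquare o) (λ o<0 h _ → ⊥-elim (ℤₚ.<-asym o<0 (ℤₚ.<-trans (+<+ (ℕ.s≤s ℕ.z≤n)) h))) step
    where
    step : ∀ o → 0ℤ ≤ o → (∀ k → k < o → 1ℤ < k → Odd k → DoubleSquare k) → 1ℤ < o → Odd o → DoubleSquare o
    step o _ ih h oo@(m , o≡) = split (odd-represented m (m≥0 m (subst (1ℤ <_) o≡ h)))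
      where
      m≥0 : ∀ m → 1ℤ < 1ℤ + + 2 * m → 0ℤ ≤ m
      m≥0 (+ m) _ = +≤+ ℕ.z≤n
      m≥0 -[1+ zero ] ()
      m≥0 -[1+ suc m ] ()
      root : ∀ y → y * y ≡ o → DoubleSquare o
      root y e = subst DoubleSquare e′ (scaled (+ ∣ y ∣) (λ z → ℤₚ.<-asym (+<+ (ℕ.s≤s ℕ.z≤n)) (subst (1ℤ <_) z (proj₁ bounds))) odd
        (ih (+ ∣ y ∣) (subst (+ ∣ y ∣ <_) e′ (proj₂ bounds)) (proj₁ bounds) odd))
        where
        e′ = trans (abs-square y) e
        bounds = root-bounds ∣ y ∣ (subst (1ℤ <_) (sym e′) h)
        odd = odd-root (+ ∣ y ∣) (subst Odd (sym e′) oo)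
      split : (∃ λ x → ∃ λ y → ∃ λ z → x * x + y * y + + 2 * (z * z) ≡ 1ℤ + + 2 * m) → DoubleSquare o
      split (x , y , z , e) with x ≟ 0ℤ | y ≟ 0ℤ | z ≟ 0ℤ
      ... | no hx | _ | no hz = reflected x y z o hx hz oo (trans e (sym o≡))
      ... | yes _ | no hy | no hz = reflected y x z o hy hz oo (trans (cong (_+ + 2 * (z * z)) (ℤₚ.+-comm (y * y) (x * x))) (trans e (sym o≡)))
      ... | yes refl | yes refl | _ = ⊥-elim (odd≢even {z * z} {m} (trans (sym (ℤₚ.+-identityˡ _)) e))
      ... | no hx | no hy | yes refl = reflected₂ x y o hx hy oo (trans (sym (ℤₚ.+-identityʳ _)) (trans e (sym o≡)))
      ... | yes refl | no hy | yes refl = root y (trans (pad-first y) (trans e (sym o≡)))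
      ... | no hx | yes refl | yes refl = root x (trans (pad-second x) (trans e (sym o≡)))

abstract

  double-square : ∀ o → 1ℤ < o → Odd o → DoubleSquare o
  double-square = double-square-proof

private
  degenerate-q4 : ∀ y n → y * y ≡ + 7 + + 6 * + n → Represents 3 1 2 3 (+ n)
  degenerate-q4 y n e = split (double-square (+ ∣ y ∣) (proj₁ (root-bounds ∣ y ∣ (subst (1ℤ <_) (sym e′) big))) (odd-root (+ ∣ y ∣) (+ 3 + + 3 * + n , trans e′ (eq₁ (+ n)))))
    where
    e′ = trans (abs-square y) e
    eq₁ : ∀ n → + 7 + + 6 * n ≡ 1ℤ + + 2 * (+ 3 + + 3 * n)
    eq₁ = solve-∀
    eq₂ : ∀ n → + 2 * (+ 7 + + 6 * n) ≡ + 14 + + 12 * n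
    eq₂ = solve-∀
    big : 1ℤ < + 7 + + 6 * + n
    big = subst (λ x → 1ℤ < + 7 + x) (ℤₚ.pos-* 6 n) (+<+ (ℕ.s≤s (ℕ.s≤s ℕ.z≤n)))
    split : DoubleSquare (+ ∣ y ∣) → Represents 3 1 2 3 (+ n)
    split (a , b , c , oa , ob , ec , hc , h) = nondegenerate-q4 a b c (+ n) oa ob ec (inj₁ hc) (trans h (trans (cong (λ s → + 2 * s) e′) (eq₂ (+ n))))

q4-universal : ∀ n → Represents 3 1 2 3 (+ n)
q4-universal n with two-mod-four-represented (+ 3 + + 3 * + n) (affine≥0 3 3 n)
... | x , y , z , oa , ob , h , e = split (x ≟ 0ℤ) (y ≟ 0ℤ) (z ≟ 0ℤ)
  where
  eq₁ : ∀ n → + 2 * (1ℤ + + 2 * (+ 3 + + 3 * n)) ≡ + 14 + + 12 * n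
  eq₁ = solve-∀
  eq₂ : ∀ n → 1ℤ + + 2 * (+ 3 + + 3 * n) ≡ + 7 + + 6 * n
  eq₂ = solve-∀
  eq₃ : ∀ a b c → c * c + a * a + b * b ≡ a * a + b * b + c * c
  eq₃ = solve-∀
  drop-x : x ≡ 0ℤ → z ≡ 0ℤ → y * y ≡ x * x + y * y + + 2 * (z * z)
  drop-x refl refl = pad-first y
  drop-y : y ≡ 0ℤ → z ≡ 0ℤ → x * x ≡ x * x + y * y + + 2 * (z * z)
  drop-y refl refl = pad-second x
  sum : sumSq (+ 2 * z) (x + y) (x - y) ≡ + 14 + + 12 * + n
  sum = trans (eq₃ (x + y) (x - y) (+ 2 * z)) (trans e (eq₁ (+ n)))
  split : Dec (x ≡ 0ℤ) → Dec (y ≡ 0ℤ) → Dec (z ≡ 0ℤ) → Represents 3 1 2 3 (+ n)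
  split _ _ (no hz) = nondegenerate-q4 (x + y) (x - y) (+ 2 * z) (+ n) oa ob (z , refl) (inj₁ (product≢0 {+ 2} (λ ()) hz)) sum
  split (no hx) (no hy) (yes _) = nondegenerate-q4 (x + y) (x - y) (+ 2 * z) (+ n) oa ob (z , refl)
    (inj₂ ((λ s → product≢0 {+ 2} (λ ()) hx (trans (sym ([x+y]+[x-y]≡2x x y)) s)) , (λ s → product≢0 {+ 2} (λ ()) hy (trans (sym ([x+y]+-[x-y]≡2y x y)) s)))) sum
  split (yes hx) _ (yes hz) = degenerate-q4 y n (trans (drop-x hx hz) (trans h (eq₂ (+ n))))
  split _ (yes hy) (yes hz) = degenerate-q4 x n (trans (drop-y hy hz) (trans h (eq₂ (+ n))))

private
  -- For odd `c` the term `(2c)²` is 4 modulo 16, so `a² + b²` is 10 modulo 16. An odd square is 1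
  -- modulo 16 if its root is 1 or -1 modulo 8, and 9 otherwise; hence one of `a`, `b` is of each
  -- kind.
  residues-q5 : ∀ a b c n → Odd a → Odd b → Odd c → sumSq a b (+ 2 * c) ≡ + 14 + + 16 * n → Represents 4 1 2 3 n
  residues-q5 a b c n oa ob oc e with odd-mod8 oa | odd-mod8 ob | odd-mod4 oc
  ... | X , inj₁ eX | Z , inj₂ eZ | Y , eY = complete-q5 X Y Z n (trans (eq X Y Z) (substitute³ eX eZ (trans ([2x]²≡4x² c) (trans (cong (λ s → + 4 * s) eY) (sym ([2x]²≡4x² (1ℤ + + 4 * Y))))) e))
    where
    eq : ∀ X Y Z → (1ℤ + + 8 * X) * (1ℤ + + 8 * X) + (+ 2 + + 8 * Y) * (+ 2 + + 8 * Y) + (+ 3 + + 8 * Z) * (+ 3 + + 8 * Z) ≡ (1ℤ + + 8 * X) * (1ℤ + + 8 * X) + (+ 3 + + 8 * Z) * (+ 3 + + 8 * Z) + + 2 * (1ℤ + + 4 * Y) * (+ 2 * (1ℤ + + 4 * Y))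
    eq = solve-∀
  ... | Z , inj₂ eZ | X , inj₁ eX | Y , eY = complete-q5 X Y Z n (trans (eq X Y Z) (substitute³ eZ eX (trans ([2x]²≡4x² c) (trans (cong (λ s → + 4 * s) eY) (sym ([2x]²≡4x² (1ℤ + + 4 * Y))))) e))
    where
    eq : ∀ X Y Z → (1ℤ + + 8 * X) * (1ℤ + + 8 * X) + (+ 2 + + 8 * Y) * (+ 2 + + 8 * Y) + (+ 3 + + 8 * Z) * (+ 3 + + 8 * Z) ≡ (+ 3 + + 8 * Z) * (+ 3 + + 8 * Z) + (1ℤ + + 8 * X) * (1ℤ + + 8 * X) + + 2 * (1ℤ + + 4 * Y) * (+ 2 * (1ℤ + + 4 * Y))
    eq = solve-∀
  ... | X , inj₁ eX | Z , inj₁ eZ | Y , eY = ⊥-elim (odd≢even {X + + 4 * (X * X) + Z + + 4 * (Z * Z) + + 2 * Y + + 4 * (Y * Y)} {n} (cancel-factor 7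
      (trans (eq₁ X Y Z) (trans (cong (_- + 6) (substitute³ eX eZ (trans ([2x]²≡4x² c) (cong (λ s → + 4 * s) eY)) e)) (8+16x≡8[1+2x] n)))))
    where
    eq₁ : ∀ X Y Z → + 8 * (+ 2 * (X + + 4 * (X * X) + Z + + 4 * (Z * Z) + + 2 * Y + + 4 * (Y * Y))) ≡ (1ℤ + + 8 * X) * (1ℤ + + 8 * X) + (1ℤ + + 8 * Z) * (1ℤ + + 8 * Z) + + 4 * ((1ℤ + + 4 * Y) * (1ℤ + + 4 * Y)) - + 6
    eq₁ = solve-∀
  ... | X , inj₂ eX | Z , inj₂ eZ | Y , eY = ⊥-elim (odd≢even {1ℤ + + 3 * X + + 4 * (X * X) + + 3 * Z + + 4 * (Z * Z) + + 2 * Y + + 4 * (Y * Y)} {n} (cancel-factor 7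
      (trans (eq₁ X Y Z) (trans (cong (_- + 6) (substitute³ eX eZ (trans ([2x]²≡4x² c) (cong (λ s → + 4 * s) eY)) e)) (8+16x≡8[1+2x] n)))))
    where
    eq₁ : ∀ X Y Z → + 8 * (+ 2 * (1ℤ + + 3 * X + + 4 * (X * X) + + 3 * Z + + 4 * (Z * Z) + + 2 * Y + + 4 * (Y * Y))) ≡ (+ 3 + + 8 * X) * (+ 3 + + 8 * X) + (+ 3 + + 8 * Z) * (+ 3 + + 8 * Z) + + 4 * ((1ℤ + + 4 * Y) * (1ℤ + + 4 * Y)) - + 6
    eq₁ = solve-∀

q5-universal : ∀ n → Represents 4 1 2 3 (+ n)
q5-universal n with two-mod-four-represented (+ 3 + + 4 * + n) (affine≥0 3 4 n)
... | x , y , z , oa@(s , es) , ob@(t , et) , _ , e = split (parity z)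
  where
  eq₁ : ∀ n → + 2 * (1ℤ + + 2 * (+ 3 + + 4 * n)) ≡ + 14 + + 16 * n
  eq₁ = solve-∀
  odd-square : ∀ s → ∃ λ k → (1ℤ + + 2 * s) * (1ℤ + + 2 * s) ≡ 1ℤ + + 8 * k
  odd-square s with parity s
  ... | r , inj₁ refl = r + + 2 * (r * r) , eq r
    where
    eq : ∀ r → (1ℤ + + 2 * (+ 2 * r)) * (1ℤ + + 2 * (+ 2 * r)) ≡ 1ℤ + + 8 * (r + + 2 * (r * r))
    eq = solve-∀
  ... | r , inj₂ refl = 1ℤ + + 3 * r + + 2 * (r * r) , eq r
    where
    eq : ∀ r → (1ℤ + + 2 * (1ℤ + + 2 * r)) * (1ℤ + + 2 * (1ℤ + + 2 * r)) ≡ 1ℤ + + 8 * (1ℤ + + 3 * r + + 2 * (r * r))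
    eq = solve-∀
  split : (∃ λ v → z ≡ + 2 * v ⊎ z ≡ 1ℤ + + 2 * v) → Represents 4 1 2 3 (+ n)
  split (v , inj₂ ez) = residues-q5 (x + y) (x - y) z (+ n) oa ob (v , ez) (trans e (eq₁ (+ n)))
  -- For even `z` the three squares add up to `1 + 1 + 0` modulo 8, whereas `16n + 14` is 6.
  split (v , inj₁ ez) with odd-square s | odd-square t
  ... | k , ek | l , el = ⊥-elim (odd≢even {k + l + + 2 * (v * v)} {1ℤ + + 2 * + n} (cancel-factor 3
    (trans (eq₂ k l v) (trans (cong (_- + 2)
      (substitute³ (trans (square≡ es) ek) (trans (square≡ et) el) (square≡ (cong (λ w → + 2 * w) ez)) (trans e (eq₁ (+ n))))) (eq₃ (+ n))))))
    where
    eq₂ : ∀ k l v → + 4 * (+ 2 * (k + l + + 2 * (v * v))) ≡ 1ℤ + + 8 * k + (1ℤ + + 8 * l) + + 2 * (+ 2 * v) * (+ 2 * (+ 2 * v)) - + 2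
    eq₂ = solve-∀
    eq₃ : ∀ n → + 14 + + 16 * n - + 2 ≡ + 4 * (1ℤ + + 2 * (1ℤ + + 2 * n))
    eq₃ = solve-∀

-- The values x(ax + b) as natural numbers

-- For `b ≤ a` the truncated subtraction is exact. Natural numbers make the values nonnegative by
-- construction and the finite check a computation.
value : ℕ → ℕ → ℤ → ℕ
value a b (+ k)    = k ℕ.* (a ℕ.* k ℕ.+ b)
value a b -[1+ k ] = suc k ℕ.* (a ℕ.* suc k ∸ b)

b≤a*k : ∀ {a b} k → b ℕ.≤ a → b ℕ.≤ a ℕ.* suc k
b≤a*k {a} k b≤a = ℕₚ.≤-trans b≤a (ℕₚ.m≤m*n a (suc k))

value-≡ : ∀ {a b} → b ℕ.≤ a → ∀ x → x * (+ a * x + + b) ≡ + value a b x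
value-≡ {a} {b} b≤a (+ k) = trans (cong (λ t → + k * (t + + b)) (sym (ℤₚ.pos-* a k))) (sym (ℤₚ.pos-* k _))
value-≡ {a} {b} b≤a -[1+ k ] = begin
  -[1+ k ] * (+ a * -[1+ k ] + + b)        ≡⟨ eq (+ suc k) (+ a) (+ b) ⟩
  + suc k * (+ a * + suc k - + b)          ≡⟨ cong (λ t → + suc k * (t - + b)) (sym (ℤₚ.pos-* a (suc k))) ⟩
  + suc k * (+ (a ℕ.* suc k) - + b)        ≡⟨ cong (λ t → + suc k * t) (trans (ℤₚ.m-n≡m⊖n (a ℕ.* suc k) b) (ℤₚ.⊖-≥ (b≤a*k k b≤a))) ⟩
  + suc k * + (a ℕ.* suc k ∸ b)            ≡⟨ ℤₚ.pos-* (suc k) _ ⟨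
  + value a b -[1+ k ]                     ∎
  where
  open ≡-Reasoning
  eq : ∀ k a b → - k * (a * - k + b) ≡ k * (a * k - b)
  eq = solve-∀

form-≡ : ∀ {a b c d} → b ℕ.≤ a → c ℕ.≤ a → d ℕ.≤ a → ∀ x y z →
         form a b c d x y z ≡ + (value a b x ℕ.+ value a c y ℕ.+ value a d z)
form-≡ hb hc hd x y z = cong₂ _+_ (cong₂ _+_ (value-≡ hb x) (value-≡ hc y)) (value-≡ hd z)

-- The value `a - b` is attained at `x = -1`. Every positive `x`, and every `x` from -2 downwards,
-- gives at least `a`.
value-small : ∀ {a b} → b ℕ.≤ a → ∀ x → value a b x ℕ.< a → value a b x ≡ 0 ⊎ value a b x ≡ a ∸ b
value-small b≤a (+ zero) _ = inj₁ refl
value-small {a} {b} b≤a (+ suc k) h = ⊥-elim (ℕₚ.<⇒≱ h (ℕₚ.≤-trans (ℕₚ.m≤m*n a (suc k)) (ℕₚ.≤-trans (ℕₚ.m≤m+n _ b) (ℕₚ.m≤n*m _ (suc k)))))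
value-small {a} {b} b≤a -[1+ zero ] _ = inj₂ (trans (ℕₚ.*-identityˡ _) (cong (_∸ b) (ℕₚ.*-identityʳ a)))
value-small {a} {b} b≤a -[1+ suc k ] h = ⊥-elim (ℕₚ.<⇒≱ h (ℕₚ.≤-trans bound (ℕₚ.m≤n*m _ (suc (suc k)))))
  where
  bound : a ℕ.≤ a ℕ.* suc (suc k) ∸ b
  bound = subst (ℕ._≤ a ℕ.* suc (suc k) ∸ b) (ℕₚ.m+n∸n≡m a b)
    (ℕₚ.∸-monoˡ-≤ b (subst (a ℕ.+ b ℕ.≤_) (sym (ℕₚ.*-suc a (suc k))) (ℕₚ.+-monoʳ-≤ a (b≤a*k k b≤a))))

roots : List ℤ
roots = + 0 ∷ -[1+ 0 ] ∷ + 1 ∷ -[1+ 1 ] ∷ + 2 ∷ -[1+ 2 ] ∷ + 3 ∷ []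

-- The bound 36 comes from `x = -4`: there the value is `4(4a - b)`, which is at least `12a`, and
-- `a ≥ 3`.
value-root : ∀ {a b} → 3 ℕ.≤ a → b ℕ.≤ a → ∀ x → value a b x ℕ.< 36 → x ∈ roots
value-root _ _ (+ 0) _ = here refl
value-root _ _ -[1+ 0 ] _ = there (here refl)
value-root _ _ (+ 1) _ = there (there (here refl))
value-root _ _ -[1+ 1 ] _ = there (there (there (here refl)))
value-root _ _ (+ 2) _ = there (there (there (there (here refl))))
value-root _ _ -[1+ 2 ] _ = there (there (there (there (there (here refl)))))
value-root _ _ (+ 3) _ = there (there (there (there (there (there (here refl))))))
value-root {a} {b} a≥3 b≤a (+ suc (suc (suc (suc k)))) h = ⊥-elim (ℕₚ.<⇒≱ h (ℕₚ.≤-trans (ℕₚ.m≤m+n 36 12)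
  (ℕₚ.*-mono-≤ {4} {4 ℕ.+ k} (ℕₚ.m≤m+n 4 k) (ℕₚ.≤-trans (ℕₚ.*-mono-≤ a≥3 (ℕₚ.m≤m+n 4 k)) (ℕₚ.m≤m+n _ b)))))
value-root {a} {b} a≥3 b≤a -[1+ suc (suc (suc k)) ] h = ⊥-elim (ℕₚ.<⇒≱ h (ℕₚ.*-mono-≤ {4} {4 ℕ.+ k} (ℕₚ.m≤m+n 4 k) bound))
  where
  bound : 9 ℕ.≤ a ℕ.* (4 ℕ.+ k) ∸ b
  bound = ℕₚ.≤-trans (subst (9 ℕ.≤_) (sym (ℕₚ.m+n∸n≡m (a ℕ.* (3 ℕ.+ k)) b)) (ℕₚ.*-mono-≤ a≥3 (ℕₚ.m≤m+n 3 k)))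
    (ℕₚ.∸-monoˡ-≤ b (subst (a ℕ.* (3 ℕ.+ k) ℕ.+ b ℕ.≤_) (trans (ℕₚ.+-comm _ a) (sym (ℕₚ.*-suc a (3 ℕ.+ k)))) (ℕₚ.+-monoʳ-≤ _ b≤a)))

-- Necessity

module _ {a b c d : ℕ} (b≤a : b ℕ.≤ a) (c≤a : c ℕ.≤ a) (d≤a : d ℕ.≤ a) (R : RepresentsExactlyℕ a b c d) where

  Sum : ℕ → Set
  Sum n = ∃ λ x → ∃ λ y → ∃ λ z → value a b x ℕ.+ value a c y ℕ.+ value a d z ≡ n

  sums : ∀ n → Sum n
  sums n = let (x , y , z , e) = proj₂ R n in x , y , z , ℤₚ.+-injective (trans (sym (form-≡ b≤a c≤a d≤a x y z)) e)

  -- The index is read in binary, with one digit each for `b`, `c` and `d`.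
  subset : Fin 8 → ℕ
  subset Fin.zero = 0
  subset (Fin.suc Fin.zero) = a ∸ d
  subset (Fin.suc (Fin.suc Fin.zero)) = a ∸ c
  subset (Fin.suc (Fin.suc (Fin.suc Fin.zero))) = (a ∸ c) ℕ.+ (a ∸ d)
  subset (Fin.suc (Fin.suc (Fin.suc (Fin.suc Fin.zero)))) = (a ∸ b) ℕ.+ 0
  subset (Fin.suc (Fin.suc (Fin.suc (Fin.suc (Fin.suc Fin.zero))))) = (a ∸ b) ℕ.+ 0 ℕ.+ (a ∸ d)
  subset (Fin.suc (Fin.suc (Fin.suc (Fin.suc (Fin.suc (Fin.suc Fin.zero)))))) = (a ∸ b) ℕ.+ (a ∸ c) ℕ.+ 0
  subset (Fin.suc (Fin.suc (Fin.suc (Fin.suc (Fin.suc (Fin.suc (Fin.suc Fin.zero))))))) = (a ∸ b) ℕ.+ (a ∸ c) ℕ.+ (a ∸ d)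

  subset-sum : ∀ n → n ℕ.< a → ∃ λ k → subset k ≡ n
  subset-sum n n<a with sums n
  ... | x , y , z , refl with value-small b≤a x (ℕₚ.≤-<-trans (ℕₚ.≤-trans (ℕₚ.m≤m+n _ _) (ℕₚ.m≤m+n _ _)) n<a)
                            | value-small c≤a y (ℕₚ.≤-<-trans (ℕₚ.≤-trans (ℕₚ.m≤n+m _ (value a b x)) (ℕₚ.m≤m+n _ _)) n<a)
                            | value-small d≤a z (ℕₚ.≤-<-trans (ℕₚ.m≤n+m _ (value a b x ℕ.+ value a c y)) n<a)
  ... | inj₁ p | inj₁ q | inj₁ r rewrite p | q | r = Fin.zero , refl
  ... | inj₁ p | inj₁ q | inj₂ r rewrite p | q | r = Fin.suc Fin.zero , refl
  ... | inj₁ p | inj₂ q | inj₁ r rewrite p | q | r = Fin.suc (Fin.suc Fin.zero) , sym (ℕₚ.+-identityʳ _)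
  ... | inj₁ p | inj₂ q | inj₂ r rewrite p | q | r = Fin.suc (Fin.suc (Fin.suc Fin.zero)) , refl
  ... | inj₂ p | inj₁ q | inj₁ r rewrite p | q | r = Fin.suc (Fin.suc (Fin.suc (Fin.suc Fin.zero))) , sym (ℕₚ.+-identityʳ _)
  ... | inj₂ p | inj₁ q | inj₂ r rewrite p | q | r = Fin.suc (Fin.suc (Fin.suc (Fin.suc (Fin.suc Fin.zero)))) , refl
  ... | inj₂ p | inj₂ q | inj₁ r rewrite p | q | r = Fin.suc (Fin.suc (Fin.suc (Fin.suc (Fin.suc (Fin.suc Fin.zero))))) , refl
  ... | inj₂ p | inj₂ q | inj₂ r rewrite p | q | r = Fin.suc (Fin.suc (Fin.suc (Fin.suc (Fin.suc (Fin.suc (Fin.suc Fin.zero)))))) , refl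

  a≤8 : a ℕ.≤ 8
  a≤8 = ℕₚ.≮⇒≥ contradiction
    where
    contradiction : ¬ (8 ℕ.< a)
    contradiction 8<a with Finₚ.pigeonhole (ℕₚ.n<1+n 8) pick
      where
      small : (i : Fin 9) → toℕ i ℕ.< a
      small i = ℕₚ.<-≤-trans (Finₚ.toℕ<n i) 8<a
      pick : Fin 9 → Fin 8
      pick i = proj₁ (subset-sum (toℕ i) (small i))
    ... | i , j , i<j , e = ℕₚ.<⇒≢ i<j (trans (sym (proj₂ (subset-sum (toℕ i) (small i)))) (trans (cong subset e) (proj₂ (subset-sum (toℕ j) (small j)))))
      where
      small : (i : Fin 9) → toℕ i ℕ.< a
      small i = ℕₚ.<-≤-trans (Finₚ.toℕ<n i) 8<a

-- The finite check of the remaining quadruples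

values : ℕ → ℕ → List ℕ
values a b = map (value a b) roots

hit₁ : ℕ → ℕ → ℕ → ℕ → Bool
hit₁ a d n s = any (λ w → s ℕ.+ w ≡ᵇ n) (values a d)

hit₂ : ℕ → ℕ → ℕ → ℕ → ℕ → Bool
hit₂ a c d n u = any (λ v → hit₁ a d n (u ℕ.+ v)) (values a c)

hit : ℕ → ℕ → ℕ → ℕ → ℕ → Bool
hit a b c d n = any (hit₂ a c d n) (values a b)

listed? : ∀ a b c d → Maybe (Listed a b c d)
listed? 3 0 1 2 = just q1
listed? 3 1 1 2 = just q2
listed? 3 1 2 2 = just q3
listed? 3 1 2 3 = just q4
listed? 4 1 2 3 = just q5
listed? _ _ _ _ = nothing

allBelow : ℕ → (ℕ → Bool) → Bool
allBelow zero    p = true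
allBelow (suc n) p = p n ∧ allBelow n p

-- Only arguments in `roots` are tried. By `value-root` this search is exhaustive for the numbers
-- below 36, so a failed search there proves that the number is missed.
check : ℕ → ℕ → ℕ → ℕ → Bool
check a b c d = is-just (listed? a b c d) ∨ any (λ n → not (hit a b c d n)) (upTo 36)

check-c : ℕ → ℕ → ℕ → Bool
check-c a d c = allBelow (suc c) (λ b → check (3 ℕ.+ a) b c d)

check-d : ℕ → ℕ → Bool
check-d a d = allBelow (suc d) (check-c a d)

check-a : ℕ → Bool
check-a a = allBelow (4 ℕ.+ a) (check-d a)

-- The index is `a - 3`, so it covers `a` from 3 to 8. The evaluation shows that every quadruple
-- that is not listed misses a number below 36.
checked : T (allBelow 6 check-a)
checked = tt

allBelow-lookup : ∀ n (p : ℕ → Bool) → T (allBelow n p) → ∀ {k} → k ℕ.< n → T (p k)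
allBelow-lookup (suc n) p t {k} k<1+n with p n in eq | ℕₚ.m≤n⇒m<n∨m≡n (ℕₚ.≤-pred k<1+n)
... | true | inj₁ k<n  = allBelow-lookup n p t k<n
... | true | inj₂ refl = subst T (sym eq) tt

hit-complete : ∀ {a b c d n} x y z → x ∈ roots → y ∈ roots → z ∈ roots →
               value a b x ℕ.+ value a c y ℕ.+ value a d z ≡ n → T (hit a b c d n)
hit-complete {a} {b} {c} {d} {n} x y z x∈ y∈ z∈ e =
  any⁺ (hit₂ a c d n) (lose (∈-map⁺ (value a b) x∈)
    (any⁺ (λ v → hit₁ a d n (value a b x ℕ.+ v)) (lose (∈-map⁺ (value a c) y∈)
      (any⁺ (λ w → value a b x ℕ.+ value a c y ℕ.+ w ≡ᵇ n) (lose (∈-map⁺ (value a d) z∈) (ℕₚ.≡⇒≡ᵇ _ n e))))))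

necessity : ∀ a b c d → 2 ℕ.< a → b ℕ.≤ c → c ℕ.≤ d → d ℕ.≤ a → RepresentsExactlyℕ a b c d → Listed a b c d
necessity 0 b c d () b≤c c≤d d≤a R
necessity 1 b c d (s≤s ()) b≤c c≤d d≤a R
necessity 2 b c d (s≤s (s≤s ())) b≤c c≤d d≤a R
necessity a@(suc (suc (suc a′))) b c d 2<a b≤c c≤d d≤a R =
  conclude (listed? a b c d) (allBelow-lookup (suc c) (λ b → check a b c d)
    (allBelow-lookup (suc d) (check-c a′ d) (allBelow-lookup (4 ℕ.+ a′) (check-d a′) (allBelow-lookup 6 check-a checked a′<6) (s≤s d≤a)) (s≤s c≤d)) (s≤s b≤c))
  where
  c≤a = ℕₚ.≤-trans c≤d d≤a
  b≤a = ℕₚ.≤-trans b≤c c≤a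
  a′<6 : a′ ℕ.< 6
  a′<6 = ℕₚ.+-cancelˡ-≤ 3 _ _ (subst (ℕ._≤ 9) (sym (ℕₚ.+-suc 3 a′)) (s≤s (a≤8 b≤a c≤a d≤a R)))
  missing : ∀ n → n ℕ.< 36 → T (not (hit a b c d n)) → ⊥
  missing n n<36 t = contra (hit a b c d n) t (hit-complete x y z
    (value-root 2<a b≤a x (ℕₚ.≤-<-trans (ℕₚ.≤-trans (ℕₚ.≤-trans (ℕₚ.m≤m+n _ _) (ℕₚ.m≤m+n _ _)) n≡) n<36))
    (value-root 2<a c≤a y (ℕₚ.≤-<-trans (ℕₚ.≤-trans (ℕₚ.≤-trans (ℕₚ.m≤n+m _ (value a b x)) (ℕₚ.m≤m+n _ _)) n≡) n<36))
    (value-root 2<a d≤a z (ℕₚ.≤-<-trans (ℕₚ.≤-trans (ℕₚ.m≤n+m _ (value a b x ℕ.+ value a c y)) n≡) n<36)) e)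
    where
    contra : ∀ t → T (not t) → T t → ⊥
    contra false _ ()
    contra true () _
    s = sums b≤a c≤a d≤a R n
    x = proj₁ s
    y = proj₁ (proj₂ s)
    z = proj₁ (proj₂ (proj₂ s))
    e = proj₂ (proj₂ (proj₂ s))
    n≡ = ℕₚ.≤-reflexive e
  conclude : (l : Maybe (Listed a b c d)) → T (is-just l ∨ any (λ n → not (hit a b c d n)) (upTo 36)) → Listed a b c d
  conclude (just l) _ = l
  conclude nothing t = let (n , n∈ , h) = find (any⁻ (λ n → not (hit a b c d n)) (upTo 36) t) in ⊥-elim (missing n (∈-upTo⁻ n∈) h)

sufficiency : ∀ {a b c d} → b ℕ.≤ a → c ℕ.≤ a → d ℕ.≤ a → Listed a b c d → RepresentsExactlyℕ a b c d
sufficiency b≤a c≤a d≤a l = (λ x y z → subst (0ℤ ≤_) (sym (form-≡ b≤a c≤a d≤a x y z)) (+≤+ z≤n)) , universal l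
  where
  universal : ∀ {a b c d} → Listed a b c d → ∀ n → ∃ λ x → ∃ λ y → ∃ λ z → form a b c d x y z ≡ + n
  universal q1 = q1-universal
  universal q2 = q2-universal
  universal q3 = q3-universal
  universal q4 = q4-universal
  universal q5 = q5-universal

theorem1p3 : (a b c d : ℕ) → 2 ℕ.< a → b ℕ.≤ c → c ℕ.≤ d → d ℕ.≤ a →
    RepresentsExactlyℕ a b c d ⇔ Listed a b c d
theorem1p3 a b c d 2<a b≤c c≤d d≤a = mk⇔ (necessity a b c d 2<a b≤c c≤d d≤a) (sufficiency (ℕₚ.≤-trans b≤c c≤a) c≤a d≤a)
  where c≤a = ℕₚ.≤-trans c≤d d≤a
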